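{- Let $\{a_n\}_{n\ge 0}$ be a sequence of real numbers, with $a_n\neq 0$ for all sufficiently large $n$, such that, as $n\to\infty$, \[ \frac{a_{n-1}a_{n+1}}{a_n^2} = 1+\sum_{i=1}^m \frac{r_i(\log n)}{n^{\alpha_i}} + o\left(\frac{1}{n^{\beta}}\right), \] where $m\ge 1$ is an integer, $\alpha_1,\dots,\alpha_m,\beta$ are real numbers with $0<\alpha_1<\alpha_2<\cdots<\alpha_m<\beta$, and $r_1(x),\dots,r_m(x)$ are rational functions of $x$ with real coefficients. Let $\ell=\lfloor \alpha_m/\alpha_1\rfloor$. If either (i) $0<\alpha_1<2$ and $r_1(x)<0$ for all sufficiently large $x$, or (ii) $\alpha_1=2$ and $r_1(x)<-2+\dfrac{1}{2^{\ell-2}}$ for all sufficiently large $x$, then $\{a_n\}_{n\ge 0}$ is asymptotically $\ell$-log-concave.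
   Context: Let $\varphi$ be the operator on real sequences given by $\varphi\{a_n\}_{n\ge 0}=\{a_{n+1}^2-a_na_{n+2}\}_{n\ge 0}$, and let $\varphi^k$ be the composition of $\varphi$ with itself $k$ times. A sequence is $\ell$-log-concave if all terms of the sequences $\varphi\{a_n\},\varphi^2\{a_n\},\dots,\varphi^{\ell}\{a_n\}$ are nonnegative. A sequence $\{a_n\}_{n\ge0}$ is asymptotically $\ell$-log-concave if there is an integer $N$ such that the sequence $\{a_n\}_{n\ge N}$ (re-indexed to start at $0$) is $\ell$-log-concave. -}

module Defs where

open import Algebra.Bundles using (CommutativeRing; Semiring)
import Algebra.Definitions.RawSemiring as RawSemiringDefinitions
open import Axiom.ExcludedMiddle using (ExcludedMiddle)
open import Data.Fin.Base using (Fin)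
open import Data.Integer.Base using (ℤ; +_; -[1+_])
open import Data.List.Base using (List; foldr)
open import Data.List.Relation.Unary.Any using (Any)
open import Data.Nat.Base as ℕ using (ℕ; zero; suc)
open import Data.Nat.GeneralisedArithmetic using (iterate)
open import Data.Product.Base using (∃; _×_; _,_)
open import Data.Sum.Base using ([_,_]′)
open import Level using (0ℓ) renaming (suc to lsuc)
open import Relation.Binary.Core using (Rel)
import Relation.Binary.Construct.NonStrictToStrict as ToStrict
open import Relation.Binary.Structures using (IsTotalOrder)
open import Relation.Nullary.Decidable.Core using (yes; no)

-- A Dedekind-complete ordered field. Classically there is exactly one up to
-- isomorphism, so a statement about an arbitrary such field is a statement
-- about the real numbers.

record CompleteOrderedField : Set (lsuc 0ℓ) where
  infix 8 _⁻¹
  infix 4 _≤_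
  field
    commutativeRing : CommutativeRing 0ℓ 0ℓ

  open CommutativeRing commutativeRing public

  field
    0≉1      : 0# ≉ 1#
    _⁻¹      : Carrier → Carrier
    ⁻¹-cong  : ∀ {x y} → x ≈ y → x ⁻¹ ≈ y ⁻¹
    inverseʳ : ∀ {x} → x ≉ 0# → x * x ⁻¹ ≈ 1#
    -- The inverse is totalised; this value is an arbitrary convention.
    0⁻¹≈0    : 0# ⁻¹ ≈ 0#

    _≤_          : Rel Carrier 0ℓ
    isTotalOrder : IsTotalOrder _≈_ _≤_
    +-monoˡ-≤    : ∀ {x y} z → x ≤ y → x + z ≤ y + z
    *-nonNeg     : ∀ {x y} → 0# ≤ x → 0# ≤ y → 0# ≤ x * y

  UpperBound : (Carrier → Set) → Carrier → Set
  UpperBound S u = ∀ x → S x → x ≤ u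

  field
    complete : ∀ (S : Carrier → Set) → ∃ S → ∃ (UpperBound S) →
               ∃ λ s → UpperBound S s × (∀ u → UpperBound S u → s ≤ u)

-- Excluded middle supplies the classical logic in which real analysis is
-- usually carried out.

module Reals (em : ExcludedMiddle 0ℓ) (𝓡 : CompleteOrderedField) where

  open CompleteOrderedField 𝓡 public
  open IsTotalOrder isTotalOrder public using (total)
  open RawSemiringDefinitions (Semiring.rawSemiring semiring) public using (_^_; sum)
    renaming (_×_ to _·_)
  open ToStrict _≈_ _≤_ public using (_<_)

  ℝ : Set
  ℝ = Carrier

  ι : ℕ → ℝ
  ι n = n · 1#

  infixl 7 _÷_
  _÷_ : ℝ → ℝ → ℝ
  x ÷ y = x * y ⁻¹

  infixr 8 _^ᶻ_
  _^ᶻ_ : ℝ → ℤ → ℝ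
  x ^ᶻ (+ n)    = x ^ n
  x ^ᶻ -[1+ n ] = (x ^ suc n) ⁻¹

  ∣_∣ : ℝ → ℝ
  ∣ x ∣ = [ (λ _ → x) , (λ _ → - x) ]′ (total 0# x)

  infix 4 _⟶_
  _⟶_ : (ℕ → ℝ) → ℝ → Set
  u ⟶ L = ∀ ε → 0# < ε → ∃ λ N → ∀ n → N ℕ.≤ n → ∣ u n - L ∣ ≤ ε

  -- Some element satisfying P, and 0 when there is none. It is applied only to
  -- predicates with at most one solution up to _≈_.
  the : (ℝ → Set) → ℝ
  the P with em {∃ P}
  ... | yes (x , _) = x
  ... | no _        = 0#

  lim : (ℕ → ℝ) → ℝ
  lim u = the (u ⟶_)

  exp : ℝ → ℝ
  exp x = lim (λ n → (1# + x ÷ ι n) ^ n)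

  -- The natural logarithm; its value at y ≤ 0 is the arbitrary 0.
  log : ℝ → ℝ
  log y = the (λ x → exp x ≈ y)

  -- Real powers, meaningful for a positive base.
  infixr 8 _^ʳ_
  _^ʳ_ : ℝ → ℝ → ℝ
  x ^ʳ α = exp (α * log x)

  -- f n = o(g n) as n → ∞
  LittleO : (ℕ → ℝ) → (ℕ → ℝ) → Set
  LittleO f g =
    ∀ ε → 0# < ε → ∃ λ N → ∀ n → N ℕ.≤ n → ∣ f n ∣ ≤ ε * ∣ g n ∣

  EventuallyReal : (ℝ → Set) → Set
  EventuallyReal P = ∃ λ X → ∀ x → X ≤ x → P x

  EventuallyNat : (ℕ → Set) → Set
  EventuallyNat P = ∃ λ N → ∀ n → N ℕ.≤ n → P n

  -- ⌊ x ⌋ = k, for x ≥ 0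
  IsFloor : ℝ → ℕ → Set
  IsFloor x k = ι k ≤ x × x < ι (suc k)

  -- Coefficients are listed from the constant term upwards.
  evalPoly : List ℝ → ℝ → ℝ
  evalPoly cs x = foldr (λ c v → c + x * v) 0# cs

  record RationalFunction : Set where
    field
      num   : List ℝ
      den   : List ℝ
      den≉0 : Any (_≉ 0#) den

  -- A nonzero polynomial has finitely many roots, so the convention for 0⁻¹
  -- does not affect the values at large x.
  eval : RationalFunction → ℝ → ℝ
  eval r x = evalPoly num x ÷ evalPoly den x
    where open RationalFunction r

  φ : (ℕ → ℝ) → (ℕ → ℝ)
  φ a n = a (1 ℕ.+ n) ^ 2 - a n * a (2 ℕ.+ n)

  LogConcave : ℕ → (ℕ → ℝ) → Set
  LogConcave ℓ a = ∀ k → 1 ℕ.≤ k → k ℕ.≤ ℓ → ∀ n → 0# ≤ iterate φ a k n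

  AsymptoticallyLogConcave : ℕ → (ℕ → ℝ) → Set
  AsymptoticallyLogConcave ℓ a = ∃ λ N → LogConcave ℓ (λ n → a (N ℕ.+ n))

{-
Put x n = a n * a (n+2) / a (n+1)² - 1. Then φ a = - a (n+1)² x, so φ a is positive as soon as x is
negative, and the sequence attached in the same way to φ a is

  x′ n = (1 + x (n+1))² * x n * x (n+2) / x (n+1)² - 1.

Write x = y / n² + e with y a smooth main term and e an error of size n^(-β). No derivatives are needed:
"smooth" means that f is a symbol of some weight w, i.e. the k-th difference of f is O(w / n^k) for
every k. Symbols are closed under sums and products, and under inversion when w = O(f); powers of n and
rational functions of log n are symbols of their own size. Since y n * y (n+2) / y (n+1)² - 1 is governed
by second differences, and the same expression for 1/n² is close to 1 + 2/n², the main term evolves as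
y ↦ 2 y + 2 up to lower order. Hence, if y = τ - κ D up to a symbol of weight D / log n, with D > 0, one
step turns (τ , κ) into (2 τ + 2 , 2 κ), and x stays negative while τ ≤ 0.

For α₁ = 2 take τ = -2 + 2^(2-ℓ) and D = τ - r₁(log n): the values of τ are ≤ 0 for the ℓ sequences
needed. For α₁ < 2 take D = - n^(2-α₁) r₁(log n), against which constants are negligible, and the fixed
point τ = -2. Each step divides the error e by about n^(-α₁), and β > ℓ α₁ leaves room for all of them.
-}

module Submission where

open import Defs
open import Algebra.Bundles using (CommutativeRing)
open import Axiom.ExcludedMiddle using (ExcludedMiddle)
open import Data.Empty using (⊥-elim)
open import Data.Fin.Base as Fin using (Fin; fromℕ)
open import Data.Integer.Base as ℤ using (_⊖_)
open import Data.List.Base using (List; []; _∷_; map)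
open import Data.List.Relation.Unary.Any using (Any; here; there)
open import Data.Nat.Base as ℕ using (ℕ; zero; suc; pred)
open import Data.Nat.GeneralisedArithmetic using (iterate)
import Data.Nat.Properties as ℕₚ
open import Data.Product.Base using (∃; _×_; _,_; proj₁; proj₂)
open import Data.Sum.Base using (_⊎_; inj₁; inj₂; [_,_]′)
open import Level using (0ℓ)
open import Relation.Binary.PropositionalEquality.Core as ≡ using (_≡_)
open import Relation.Binary.Structures using (IsTotalOrder)
open import Relation.Nullary using (¬_; yes; no)

-- The delicate quantity is `ρ y - 1`, that is y n * y (n+2) / y (n+1)² - 1. For a symbol y
-- comparable to its weight it is O(1/n²) in general, so it contributes a bounded term to the next
-- y, of the same order as the 2 in y ↦ 2 y + 2. For α₁ < 2 this is harmless, since D grows like a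
-- power of n. For α₁ = 2 there is no such room; there D is a function of log n, and its differences
-- are smaller by a further factor 1/log n. The field `ΔD-symbol` of `Setting` is a bound available
-- in both situations, so that one induction serves both.
--
-- At α₁ = 2 the sequence D may tend to 0, and after the last step τ is exactly 0, so that
-- negativity rests on D alone. Hence errors must be small against D and not merely against y, and
-- the size of y is 1 + D rather than D. The value -2 + 2^(2-ℓ) results from running τ ↦ 2 τ + 2
-- backwards ℓ - 1 times from 0.
--
-- The reals are given only as a complete ordered field, so the exponential and the logarithm are
-- built from Bernoulli's inequality and suprema.

-- A ring solver with integer coefficients.

module IntegerCoefficients (R : CommutativeRing 0ℓ 0ℓ) where

  open import Algebra.Solver.Ring.AlmostCommutativeRing
    using (_-Raw-AlmostCommutative⟶_; fromCommutativeRing)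
  open import Data.Integer.Base using (ℤ; +_; -[1+_]; _◃_)
  import Data.Integer.Properties as ℤₚ
  open import Data.Maybe.Base using (Maybe; just; nothing)
  import Data.Sign.Base as Sign
  open CommutativeRing R
  open import Algebra.Properties.Ring ring
  open import Algebra.Properties.AbelianGroup +-abelianGroup
  open import Algebra.Properties.Semiring.Mult.TCOptimised semiring
    using (×-homo-+; ×1-homo-*; 1+×) renaming (_×_ to _·_)
  open import Relation.Binary.Reasoning.Setoid setoid

  -- Here `1 · 1#` is `1#` by computation, so the solver's `:0` and `:1` denote `0#` and `1#`
  -- themselves, with no stray summand `0#`.
  fromℤ : ℤ → Carrier
  fromℤ (+ n)    = n · 1#
  fromℤ -[1+ n ] = - (suc n · 1#)

  fromℤ-⊖ : ∀ m n → fromℤ (m ⊖ n) ≈ m · 1# - n · 1#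
  fromℤ-⊖ m zero = sym (begin
    m · 1# - 0#  ≈⟨ +-congˡ ε⁻¹≈ε ⟩
    m · 1# + 0#  ≈⟨ +-identityʳ _ ⟩
    m · 1#       ∎)
  fromℤ-⊖ zero (suc n) = sym (+-identityˡ _)
  fromℤ-⊖ (suc m) (suc n) = begin
    fromℤ (suc m ⊖ suc n)                ≡⟨ ≡.cong fromℤ (ℤₚ.[1+m]⊖[1+n]≡m⊖n m n) ⟩
    fromℤ (m ⊖ n)                        ≈⟨ fromℤ-⊖ m n ⟩
    m · 1# - n · 1#                      ≈⟨ +-congʳ (+-identityʳ _) ⟨
    m · 1# + 0# - n · 1#                 ≈⟨ +-congʳ (+-congˡ (-‿inverseʳ 1#)) ⟨
    m · 1# + (1# - 1#) - n · 1#          ≈⟨ +-congʳ (+-assoc _ _ _) ⟨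
    m · 1# + 1# - 1# - n · 1#            ≈⟨ +-assoc _ _ _ ⟩
    m · 1# + 1# + (- 1# - n · 1#)        ≈⟨ +-cong (+-comm _ _) (⁻¹-∙-comm _ _) ⟩
    1# + m · 1# - (1# + n · 1#)          ≈⟨ +-cong (1+× m 1#) (-‿cong (1+× n 1#)) ⟨
    suc m · 1# - suc n · 1#              ∎

  fromℤ-neg : ∀ i → fromℤ (ℤ.- i) ≈ - fromℤ i
  fromℤ-neg (+ zero)  = sym ε⁻¹≈ε
  fromℤ-neg (+ suc n) = refl
  fromℤ-neg -[1+ n ]  = sym (⁻¹-involutive _)

  fromℤ-+ : ∀ i j → fromℤ (i ℤ.+ j) ≈ fromℤ i + fromℤ j
  fromℤ-+ (+ m)    (+ n)    = ×-homo-+ 1# m n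
  fromℤ-+ (+ m)    -[1+ n ] = fromℤ-⊖ m (suc n)
  fromℤ-+ -[1+ m ] (+ n)    = trans (fromℤ-⊖ n (suc m)) (+-comm _ _)
  fromℤ-+ -[1+ m ] -[1+ n ] = begin
    - (suc (suc (m ℕ.+ n)) · 1#)      ≡⟨ ≡.cong (λ k → - (suc k · 1#)) (ℕₚ.+-suc m n) ⟨
    - ((suc m ℕ.+ suc n) · 1#)        ≈⟨ -‿cong (×-homo-+ 1# (suc m) (suc n)) ⟩
    - (suc m · 1# + suc n · 1#)       ≈⟨ ⁻¹-∙-comm _ _ ⟨
    - (suc m · 1#) - suc n · 1#       ∎

  fromℤ-◃⁻ : ∀ n → fromℤ (Sign.- ◃ n) ≈ - (n · 1#)
  fromℤ-◃⁻ n = trans (reflexive (≡.cong fromℤ (ℤₚ.-◃n≡-n n))) (fromℤ-neg (+ n))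

  fromℤ-* : ∀ i j → fromℤ (i ℤ.* j) ≈ fromℤ i * fromℤ j
  fromℤ-* (+ m) (+ n) =
    trans (reflexive (≡.cong fromℤ (ℤₚ.+◃n≡+n (m ℕ.* n)))) (×1-homo-* m n)
  fromℤ-* (+ m) -[1+ n ] = trans (fromℤ-◃⁻ (m ℕ.* suc n))
    (trans (-‿cong (×1-homo-* m (suc n))) (-‿distribʳ-* _ _))
  fromℤ-* -[1+ m ] (+ n) = trans (fromℤ-◃⁻ (suc m ℕ.* n))
    (trans (-‿cong (×1-homo-* (suc m) n)) (-‿distribˡ-* _ _))
  fromℤ-* -[1+ m ] -[1+ n ] = begin
    (suc m ℕ.* suc n) · 1#               ≈⟨ ×1-homo-* (suc m) (suc n) ⟩
    (suc m · 1#) * (suc n · 1#)          ≈⟨ ⁻¹-involutive _ ⟨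
    - - ((suc m · 1#) * (suc n · 1#))    ≈⟨ -‿cong (-‿distribʳ-* _ _) ⟩
    - ((suc m · 1#) * - (suc n · 1#))    ≈⟨ -‿distribˡ-* _ _ ⟩
    - (suc m · 1#) * - (suc n · 1#)      ∎

  morphism : ℤ.+-*-rawRing -Raw-AlmostCommutative⟶ fromCommutativeRing R
  morphism = record
    { ⟦_⟧ = fromℤ
    ; +-homo = fromℤ-+
    ; *-homo = fromℤ-*
    ; -‿homo = fromℤ-neg
    ; 0-homo = refl
    ; 1-homo = refl
    }

  fromℤ-≟ : ∀ i j → Maybe (fromℤ i ≈ fromℤ j)
  fromℤ-≟ i j with i ℤₚ.≟ j
  ... | yes i≡j = just (reflexive (≡.cong fromℤ i≡j))
  ... | no  _   = nothing

-- Integer coefficients let the solver cancel terms although equality in R is not decidable.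
module RingSolver (R : CommutativeRing 0ℓ 0ℓ) where
  open import Algebra.Solver.Ring.AlmostCommutativeRing using (fromCommutativeRing)
  open import Data.Integer.Base using (+_; +-*-rawRing)
  open import Algebra.Solver.Ring +-*-rawRing (fromCommutativeRing R)
    (IntegerCoefficients.morphism R) (IntegerCoefficients.fromℤ-≟ R) public
    using (Polynomial; solve; con; _:=_; _:+_; _:*_; _:-_; :-_)

  :0 :1 : ∀ {n} → Polynomial n
  :0 = con (+ 0)
  :1 = con (+ 1)

-- Ordered-field arithmetic and absolute values.

module OrderedField (em : ExcludedMiddle 0ℓ) (𝓡 : CompleteOrderedField) where
  open Reals em 𝓡
  open RingSolver commutativeRing
  open IsTotalOrder isTotalOrder public using (antisym; ≤-respˡ-≈; ≤-respʳ-≈)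
    renaming (refl to ≤-refl; trans to ≤-trans; reflexive to ≤-reflexive)

  module ≈-Reasoning where
    open import Relation.Binary.Reasoning.Setoid setoid public

  by-contradiction : {A : Set} → ¬ ¬ A → A
  by-contradiction {A} ¬¬a with em {A}
  ... | yes a = a
  ... | no ¬a = ⊥-elim (¬¬a ¬a)

  0≤y-x : ∀ {x y} → x ≤ y → 0# ≤ y - x
  0≤y-x {x} x≤y = ≤-respˡ-≈ (-‿inverseʳ x) (+-monoˡ-≤ (- x) x≤y)

  -- Inequalities are proved by certificates throughout: the ring solver rewrites `y - x` as an
  -- expression `e` assembled from quantities known to be nonnegative.
  ≤-by : ∀ {x y e} → 0# ≤ e → y - x ≈ e → x ≤ y
  ≤-by {x} {y} {e} 0≤e eq =
    ≤-respʳ-≈ (trans (+-congʳ (sym eq)) (solve 2 (λ x y → y :- x :+ x := y) refl x y))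
      (≤-respˡ-≈ (+-identityˡ x) (+-monoˡ-≤ x 0≤e))

  ≈-by : ∀ {x y e} → e ≈ 0# → y - x ≈ e → x ≈ y
  ≈-by {x} {y} e≈0 eq = trans (sym (+-identityˡ x))
    (trans (+-congʳ (sym (trans eq e≈0))) (solve 2 (λ x y → y :- x :+ x := y) refl x y))

  0≤x+y : ∀ {x y} → 0# ≤ x → 0# ≤ y → 0# ≤ x + y
  0≤x+y {x} {y} 0≤x 0≤y =
    ≤-trans 0≤y (≤-respˡ-≈ (+-identityˡ y) (+-monoˡ-≤ y 0≤x))

  +-mono-≤ : ∀ {x y u v} → x ≤ y → u ≤ v → x + u ≤ y + v
  +-mono-≤ {x} {y} {u} {v} x≤y u≤v = ≤-by (0≤x+y (0≤y-x x≤y) (0≤y-x u≤v))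
    (solve 4 (λ x y u v → (y :+ v) :- (x :+ u) := (y :- x) :+ (v :- u)) refl x y u v)

  neg-mono-≤ : ∀ {x y} → x ≤ y → - y ≤ - x
  neg-mono-≤ {x} {y} x≤y = ≤-by (0≤y-x x≤y)
    (solve 2 (λ x y → :- x :- (:- y) := y :- x) refl x y)

  *-monoˡ-≤ : ∀ {x y z} → 0# ≤ z → x ≤ y → z * x ≤ z * y
  *-monoˡ-≤ {x} {y} {z} 0≤z x≤y = ≤-by (*-nonNeg 0≤z (0≤y-x x≤y))
    (solve 3 (λ x y z → z :* y :- z :* x := z :* (y :- x)) refl x y z)

  *-mono-≤ : ∀ {x y u v} → 0# ≤ x → 0# ≤ u → x ≤ y → u ≤ v → x * u ≤ y * v
  *-mono-≤ {x} {y} {u} {v} 0≤x 0≤u x≤y u≤v =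
    ≤-by (0≤x+y (*-nonNeg (0≤y-x x≤y) (≤-trans 0≤u u≤v)) (*-nonNeg 0≤x (0≤y-x u≤v)))
    (solve 4 (λ x y u v → y :* v :- x :* u := (y :- x) :* v :+ x :* (v :- u)) refl x y u v)

  0≤x*x : ∀ x → 0# ≤ x * x
  0≤x*x x with total 0# x
  ... | inj₁ 0≤x = *-nonNeg 0≤x 0≤x
  ... | inj₂ x≤0 = ≤-respʳ-≈ (solve 1 (λ x → (:0 :- x) :* (:0 :- x) := x :* x) refl x)
    (*-nonNeg (0≤y-x x≤0) (0≤y-x x≤0))

  0≤1 : 0# ≤ 1#
  0≤1 = ≤-respʳ-≈ (*-identityˡ 1#) (0≤x*x 1#)

  0<1 : 0# < 1#
  0<1 = 0≤1 , 0≉1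

  <⇒≤ : ∀ {x y} → x < y → x ≤ y
  <⇒≤ = proj₁

  <⇒≱ : ∀ {x y} → x < y → ¬ y ≤ x
  <⇒≱ (x≤y , x≉y) y≤x = x≉y (antisym x≤y y≤x)

  ≰⇒> : ∀ {x y} → ¬ x ≤ y → y < x
  ≰⇒> {x} {y} x≰y with total x y
  ... | inj₁ x≤y = ⊥-elim (x≰y x≤y)
  ... | inj₂ y≤x = y≤x , λ y≈x → x≰y (≤-reflexive (sym y≈x))

  ≤-or-> : ∀ x y → x ≤ y ⊎ y < x
  ≤-or-> x y with em {x ≤ y}
  ... | yes x≤y = inj₁ x≤y
  ... | no  x≰y = inj₂ (≰⇒> x≰y)

  <-≤-trans : ∀ {x y z} → x < y → y ≤ z → x < z
  <-≤-trans (x≤y , x≉y) y≤z =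
    ≤-trans x≤y y≤z , λ x≈z → x≉y (antisym x≤y (≤-respʳ-≈ (sym x≈z) y≤z))

  ≤-<-trans : ∀ {x y z} → x ≤ y → y < z → x < z
  ≤-<-trans x≤y (y≤z , y≉z) =
    ≤-trans x≤y y≤z , λ x≈z → y≉z (antisym y≤z (≤-respˡ-≈ x≈z x≤y))

  <-respʳ-≈ : ∀ {x y z} → y ≈ z → x < y → x < z
  <-respʳ-≈ y≈z x<y = <-≤-trans x<y (≤-reflexive y≈z)

  <-respˡ-≈ : ∀ {x y z} → x ≈ y → x < z → y < z
  <-respˡ-≈ x≈y x<z = ≤-<-trans (≤-reflexive (sym x≈y)) x<z

  >⇒≉0 : ∀ {x} → 0# < x → x ≉ 0#
  >⇒≉0 (_ , 0≉x) x≈0 = 0≉x (sym x≈0)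

  0<y-x : ∀ {x y} → x < y → 0# < y - x
  0<y-x (x≤y , x≉y) = 0≤y-x x≤y , λ 0≈y-x → x≉y (≈-by refl (sym 0≈y-x))

  <-by : ∀ {x y e} → 0# < e → y - x ≈ e → x < y
  <-by {x} {y} (0≤e , 0≉e) eq = ≤-by 0≤e eq , λ x≈y →
    0≉e (trans (sym (-‿inverseʳ x)) (trans (+-congʳ x≈y) eq))

  0<x+y : ∀ {x y} → 0# < x → 0# ≤ y → 0# < x + y
  0<x+y {x} {y} 0<x 0≤y = <-≤-trans 0<x
    (≤-by 0≤y (solve 2 (λ x y → x :+ y :- x := y) refl x y))

  0<2 : 0# < 1# + 1#
  0<2 = 0<x+y 0<1 0≤1

  *-cancel-0 : ∀ {x y} → x ≉ 0# → x * y ≈ 0# → y ≈ 0#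
  *-cancel-0 {x} {y} x≉0 xy≈0 = trans (sym (*-identityˡ y))
    (trans (*-congʳ (sym (inverseʳ x≉0)))
    (trans (solve 3 (λ x y z → x :* z :* y := z :* (x :* y)) refl x y (x ⁻¹))
    (trans (*-congˡ xy≈0) (zeroʳ _))))

  *-≉0 : ∀ {x y} → x ≉ 0# → y ≉ 0# → x * y ≉ 0#
  *-≉0 x≉0 y≉0 xy≈0 = y≉0 (*-cancel-0 x≉0 xy≈0)

  0<x*y : ∀ {x y} → 0# < x → 0# < y → 0# < x * y
  0<x*y 0<x 0<y = *-nonNeg (<⇒≤ 0<x) (<⇒≤ 0<y) ,
    λ 0≈xy → *-≉0 (>⇒≉0 0<x) (>⇒≉0 0<y) (sym 0≈xy)

  ⁻¹-unique : ∀ {x y} → x * y ≈ 1# → x ⁻¹ ≈ y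
  ⁻¹-unique {x} {y} xy≈1 = begin
    x ⁻¹             ≈⟨ *-identityʳ _ ⟨
    x ⁻¹ * 1#        ≈⟨ *-congˡ xy≈1 ⟨
    x ⁻¹ * (x * y)   ≈⟨ solve 3 (λ x y z → z :* (x :* y) := x :* z :* y) refl x y (x ⁻¹) ⟩
    x * x ⁻¹ * y     ≈⟨ *-congʳ (inverseʳ x≉0) ⟩
    1# * y           ≈⟨ *-identityˡ y ⟩
    y                ∎
    where
    open ≈-Reasoning
    x≉0 : x ≉ 0#
    x≉0 x≈0 = 0≉1 (trans (sym (zeroˡ y)) (trans (*-congʳ (sym x≈0)) xy≈1))

  x≈y*x÷y : ∀ {x y} → y ≉ 0# → x ≈ y * (x ÷ y)
  x≈y*x÷y {x} {y} y≉0 = trans (sym (*-identityˡ x)) (trans (*-congʳ (sym (inverseʳ y≉0)))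
    (solve 3 (λ x y z → y :* z :* x := y :* (x :* z)) refl x y (y ⁻¹)))

  ⁻¹-≉0 : ∀ {x} → x ≉ 0# → x ⁻¹ ≉ 0#
  ⁻¹-≉0 {x} x≉0 x⁻¹≈0 = 0≉1 (trans (sym (zeroʳ x)) (trans (*-congˡ (sym x⁻¹≈0)) (inverseʳ x≉0)))

  0<x⁻¹ : ∀ {x} → 0# < x → 0# < x ⁻¹
  0<x⁻¹ {x} 0<x = ≤-respʳ-≈ eq (*-nonNeg (<⇒≤ 0<x) (0≤x*x (x ⁻¹))) ,
    λ 0≈x⁻¹ → ⁻¹-≉0 (>⇒≉0 0<x) (sym 0≈x⁻¹)
    where
    eq : x * (x ⁻¹ * x ⁻¹) ≈ x ⁻¹
    eq = trans (sym (*-assoc _ _ _)) (trans (*-congʳ (inverseʳ (>⇒≉0 0<x))) (*-identityˡ _))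

  -- The convention `0⁻¹≈0` makes this unconditional, so products of weights are inverted without
  -- checking that the factors are nonzero.
  ⁻¹-distrib-* : ∀ x y → (x * y) ⁻¹ ≈ x ⁻¹ * y ⁻¹
  ⁻¹-distrib-* x y with em {x ≈ 0#} | em {y ≈ 0#}
  ... | yes x≈0 | _ = trans (⁻¹-cong (trans (*-congʳ x≈0) (zeroˡ y)))
    (trans 0⁻¹≈0 (sym (trans (*-congʳ (trans (⁻¹-cong x≈0) 0⁻¹≈0)) (zeroˡ _))))
  ... | no _ | yes y≈0 = trans (⁻¹-cong (trans (*-congˡ y≈0) (zeroʳ x)))
    (trans 0⁻¹≈0 (sym (trans (*-congˡ (trans (⁻¹-cong y≈0) 0⁻¹≈0)) (zeroʳ _))))
  ... | no x≉0 | no y≉0 = ⁻¹-unique (trans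
    (solve 4 (λ x y u v → x :* y :* (u :* v) := x :* u :* (y :* v)) refl x y (x ⁻¹) (y ⁻¹))
    (trans (*-cong (inverseʳ x≉0) (inverseʳ y≉0)) (*-identityˡ 1#)))

  *-cancelˡ-≤ : ∀ {x y z} → 0# < z → z * x ≤ z * y → x ≤ y
  *-cancelˡ-≤ {x} {y} {z} 0<z zx≤zy = ≤-respˡ-≈ (eq x) (≤-respʳ-≈ (eq y)
    (*-monoˡ-≤ (<⇒≤ (0<x⁻¹ 0<z)) zx≤zy))
    where
    eq : ∀ t → z ⁻¹ * (z * t) ≈ t
    eq t = trans (solve 3 (λ z w t → w :* (z :* t) := z :* w :* t) refl z (z ⁻¹) t)
      (trans (*-congʳ (inverseʳ (>⇒≉0 0<z))) (*-identityˡ t))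

  ÷-≤ : ∀ {x y z} → 0# < y → x ≤ z * y → x ÷ y ≤ z
  ÷-≤ {x} {y} {z} 0<y x≤zy = *-cancelˡ-≤ 0<y
    (≤-respˡ-≈ (x≈y*x÷y (>⇒≉0 0<y)) (≤-respʳ-≈ (*-comm z y) x≤zy))

  ≤-÷ : ∀ {x y z} → 0# < y → z * y ≤ x → z ≤ x ÷ y
  ≤-÷ {x} {y} {z} 0<y zy≤x = *-cancelˡ-≤ 0<y
    (≤-respʳ-≈ (x≈y*x÷y (>⇒≉0 0<y)) (≤-respˡ-≈ (*-comm z y) zy≤x))

  ½ : ℝ
  ½ = (1# + 1#) ⁻¹

  0<½ : 0# < ½
  0<½ = 0<x⁻¹ 0<2

  ½+½≈1 : ½ + ½ ≈ 1#
  ½+½≈1 = trans (solve 1 (λ h → h :+ h := (:1 :+ :1) :* h) refl ½) (inverseʳ (>⇒≉0 0<2))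

  1-½≈½ : 1# - ½ ≈ ½
  1-½≈½ = trans (+-congʳ (sym ½+½≈1)) (solve 1 (λ h → h :+ h :- h := h) refl ½)

  abs-cases : ∀ x → (0# ≤ x × ∣ x ∣ ≈ x) ⊎ (x ≤ 0# × ∣ x ∣ ≈ - x)
  abs-cases x with total 0# x
  ... | inj₁ 0≤x = inj₁ (0≤x , refl)
  ... | inj₂ x≤0 = inj₂ (x≤0 , refl)

  0≤∣x∣ : ∀ x → 0# ≤ ∣ x ∣
  0≤∣x∣ x with total 0# x
  ... | inj₁ 0≤x = 0≤x
  ... | inj₂ x≤0 = ≤-by (0≤y-x x≤0) (solve 1 (λ x → (:- x) :- :0 := :0 :- x) refl x)

  x≤∣x∣ : ∀ x → x ≤ ∣ x ∣
  x≤∣x∣ x with abs-cases x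
  ... | inj₁ (_ , eq) = ≤-reflexive (sym eq)
  ... | inj₂ (x≤0 , _) = ≤-trans x≤0 (0≤∣x∣ x)

  -x≤∣x∣ : ∀ x → - x ≤ ∣ x ∣
  -x≤∣x∣ x with abs-cases x
  ... | inj₂ (_ , eq) = ≤-reflexive (sym eq)
  ... | inj₁ (0≤x , _) = ≤-trans
    (≤-by 0≤x (solve 1 (λ x → :0 :- (:- x) := x) refl x)) (0≤∣x∣ x)

  ∣x∣≤ : ∀ {x c} → x ≤ c → - x ≤ c → ∣ x ∣ ≤ c
  ∣x∣≤ {x} x≤c -x≤c with total 0# x
  ... | inj₁ _ = x≤c
  ... | inj₂ _ = -x≤c

  ∣-∣-cong : ∀ {x y} → x ≈ y → ∣ x ∣ ≈ ∣ y ∣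
  ∣-∣-cong {x} {y} x≈y = antisym
    (∣x∣≤ (≤-respˡ-≈ (sym x≈y) (x≤∣x∣ y)) (≤-respˡ-≈ (-‿cong (sym x≈y)) (-x≤∣x∣ y)))
    (∣x∣≤ (≤-respˡ-≈ x≈y (x≤∣x∣ x)) (≤-respˡ-≈ (-‿cong x≈y) (-x≤∣x∣ x)))

  0≤x⇒∣x∣≈x : ∀ {x} → 0# ≤ x → ∣ x ∣ ≈ x
  0≤x⇒∣x∣≈x {x} 0≤x = antisym
    (∣x∣≤ ≤-refl (≤-by (0≤x+y 0≤x 0≤x) (solve 1 (λ x → x :- (:- x) := x :+ x) refl x))) (x≤∣x∣ x)

  ∣-x∣≈∣x∣ : ∀ x → ∣ - x ∣ ≈ ∣ x ∣
  ∣-x∣≈∣x∣ x = antisym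
    (∣x∣≤ (-x≤∣x∣ x) (≤-respˡ-≈ (sym (neg-neg x)) (x≤∣x∣ x)))
    (∣x∣≤ (≤-respˡ-≈ (neg-neg x) (-x≤∣x∣ (- x))) (x≤∣x∣ (- x)))
    where
    neg-neg : ∀ x → - (- x) ≈ x
    neg-neg = solve 1 (λ x → :- (:- x) := x) refl

  ∣x+y∣≤∣x∣+∣y∣ : ∀ x y → ∣ x + y ∣ ≤ ∣ x ∣ + ∣ y ∣
  ∣x+y∣≤∣x∣+∣y∣ x y = ∣x∣≤ (+-mono-≤ (x≤∣x∣ x) (x≤∣x∣ y))
    (≤-respˡ-≈ (solve 2 (λ x y → :- x :+ :- y := :- (x :+ y)) refl x y)
      (+-mono-≤ (-x≤∣x∣ x) (-x≤∣x∣ y)))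

  ∣x*y∣≈∣x∣*∣y∣ : ∀ x y → ∣ x * y ∣ ≈ ∣ x ∣ * ∣ y ∣
  ∣x*y∣≈∣x∣*∣y∣ x y with abs-cases x | abs-cases y
  ... | inj₁ (0≤x , ex) | inj₁ (0≤y , ey) =
    trans (0≤x⇒∣x∣≈x (*-nonNeg 0≤x 0≤y)) (sym (*-cong ex ey))
  ... | inj₁ (0≤x , ex) | inj₂ (y≤0 , ey) = trans (sym (∣-x∣≈∣x∣ _))
    (trans (0≤x⇒∣x∣≈x (≤-respʳ-≈ (solve 2 (λ x y → x :* (:0 :- y) := :- (x :* y)) refl x y)
      (*-nonNeg 0≤x (0≤y-x y≤0))))
    (trans (solve 2 (λ x y → :- (x :* y) := x :* (:- y)) refl x y) (sym (*-cong ex ey))))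
  ... | inj₂ (x≤0 , ex) | inj₁ (0≤y , ey) = trans (sym (∣-x∣≈∣x∣ _))
    (trans (0≤x⇒∣x∣≈x (≤-respʳ-≈ (solve 2 (λ x y → (:0 :- x) :* y := :- (x :* y)) refl x y)
      (*-nonNeg (0≤y-x x≤0) 0≤y)))
    (trans (solve 2 (λ x y → :- (x :* y) := (:- x) :* y) refl x y) (sym (*-cong ex ey))))
  ... | inj₂ (x≤0 , ex) | inj₂ (y≤0 , ey) =
    trans (0≤x⇒∣x∣≈x (≤-respʳ-≈ (solve 2 (λ x y → (:0 :- x) :* (:0 :- y) := x :* y) refl x y)
      (*-nonNeg (0≤y-x x≤0) (0≤y-x y≤0))))
    (trans (solve 2 (λ x y → x :* y := (:- x) :* (:- y)) refl x y) (sym (*-cong ex ey)))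

  x≉0⇒0<∣x∣ : ∀ {x} → x ≉ 0# → 0# < ∣ x ∣
  x≉0⇒0<∣x∣ {x} x≉0 = 0≤∣x∣ x , λ 0≈∣x∣ → x≉0 (antisym
    (≤-respʳ-≈ (sym 0≈∣x∣) (x≤∣x∣ x))
    (≤-by (≤-respʳ-≈ (solve 1 (λ x → :0 :- (:- x) := x) refl x)
      (0≤y-x (≤-respʳ-≈ (sym 0≈∣x∣) (-x≤∣x∣ x))))
      (solve 1 (λ x → x :- :0 := x) refl x)))

  ∣x⁻¹∣*∣x∣≈1 : ∀ {x} → x ≉ 0# → ∣ x ⁻¹ ∣ * ∣ x ∣ ≈ 1#
  ∣x⁻¹∣*∣x∣≈1 {x} x≉0 = trans (sym (∣x*y∣≈∣x∣*∣y∣ _ _))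
    (trans (∣-∣-cong (trans (*-comm _ _) (inverseʳ x≉0))) (0≤x⇒∣x∣≈x 0≤1))

  0≤ι : ∀ n → 0# ≤ ι n
  0≤ι ℕ.zero  = ≤-refl
  0≤ι (suc n) = 0≤x+y 0≤1 (0≤ι n)

  0<ι : ∀ n → 0# < ι (suc n)
  0<ι n = 0<x+y 0<1 (0≤ι n)

  ι-mono : ∀ {m n} → m ℕ.≤ n → ι m ≤ ι n
  ι-mono {n = n} ℕ.z≤n = 0≤ι n
  ι-mono (ℕ.s≤s m≤n)   = +-mono-≤ ≤-refl (ι-mono m≤n)

  0<^ : ∀ {x} n → 0# < x → 0# < x ^ n
  0<^ ℕ.zero  0<x = 0<1
  0<^ (suc n) 0<x = 0<x*y 0<x (0<^ n 0<x)

  ^-nonNeg : ∀ {x} n → 0# ≤ x → 0# ≤ x ^ n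
  ^-nonNeg ℕ.zero  0≤x = 0≤1
  ^-nonNeg (suc n) 0≤x = *-nonNeg 0≤x (^-nonNeg n 0≤x)

  ^-mono-≤ : ∀ {x y} n → 0# ≤ x → x ≤ y → x ^ n ≤ y ^ n
  ^-mono-≤ ℕ.zero  0≤x x≤y = ≤-refl
  ^-mono-≤ (suc n) 0≤x x≤y = *-mono-≤ 0≤x (^-nonNeg n 0≤x) x≤y (^-mono-≤ n 0≤x x≤y)

  ^-distrib-* : ∀ x y n → (x * y) ^ n ≈ x ^ n * y ^ n
  ^-distrib-* x y ℕ.zero  = sym (*-identityˡ 1#)
  ^-distrib-* x y (suc n) = trans (*-congˡ (^-distrib-* x y n))
    (solve 4 (λ x y a b → x :* y :* (a :* b) := x :* a :* (y :* b)) refl x y (x ^ n) (y ^ n))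

  ^-cong : ∀ {x y} n → x ≈ y → x ^ n ≈ y ^ n
  ^-cong ℕ.zero  x≈y = refl
  ^-cong (suc n) x≈y = *-cong x≈y (^-cong n x≈y)

  1^n≈1 : ∀ n → 1# ^ n ≈ 1#
  1^n≈1 ℕ.zero  = refl
  1^n≈1 (suc n) = trans (*-identityˡ _) (1^n≈1 n)

  bernoulli : ∀ {x} n → - 1# ≤ x → 1# + ι n * x ≤ (1# + x) ^ n
  bernoulli {x} ℕ.zero  -1≤x = ≤-reflexive (solve 1 (λ x → :1 :+ :0 :* x := :1) refl x)
  bernoulli {x} (suc n) -1≤x = ≤-trans
    (≤-by (*-nonNeg (0≤ι n) (0≤x*x x))
      (solve 2 (λ x k → (:1 :+ x) :* (:1 :+ k :* x) :- (:1 :+ (:1 :+ k) :* x)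
                        := k :* (x :* x)) refl x (ι n)))
    (*-monoˡ-≤ (≤-respʳ-≈ (solve 1 (λ x → x :- (:- :1) := :1 :+ x) refl x) (0≤y-x -1≤x))
      (bernoulli n -1≤x))

-- The exponential as a limit, and the existence of logarithms.

module Exponential (em : ExcludedMiddle 0ℓ) (𝓡 : CompleteOrderedField) where
  open Reals em 𝓡
  open OrderedField em 𝓡
  open RingSolver commutativeRing

  abstract
    ev-always : ∀ {P : ℕ → Set} → (∀ n → P n) → EventuallyNat P
    ev-always p = 0 , λ n _ → p n

    ev-map : ∀ {P Q : ℕ → Set} → (∀ n → P n → Q n) → EventuallyNat P → EventuallyNat Q
    ev-map f (N , p) = N , λ n N≤n → f n (p n N≤n)

    ev-map₂ : ∀ {P Q R : ℕ → Set} → (∀ n → P n → Q n → R n) →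
              EventuallyNat P → EventuallyNat Q → EventuallyNat R
    ev-map₂ f (M , p) (N , q) = M ℕ.⊔ N , λ n M⊔N≤n →
      f n (p n (ℕₚ.m⊔n≤o⇒m≤o M N M⊔N≤n)) (q n (ℕₚ.m⊔n≤o⇒n≤o M N M⊔N≤n))

    ev-and : ∀ {P Q : ℕ → Set} → EventuallyNat P → EventuallyNat Q → EventuallyNat (λ n → P n × Q n)
    ev-and = ev-map₂ (λ _ → _,_)

    ev-suc : ∀ {P : ℕ → Set} → EventuallyNat P → EventuallyNat (λ n → P (suc n))
    ev-suc (N , p) = N , λ n N≤n → p (suc n) (ℕₚ.m≤n⇒m≤1+n N≤n)

    ev-≥ : ∀ m → EventuallyNat (m ℕ.≤_)
    ev-≥ m = m , λ _ m≤n → m≤n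

    ev-const : ∀ {A : Set} → EventuallyNat (λ _ → A) → A
    ev-const (N , p) = p N ℕₚ.≤-refl

  ≤-from-ε : ∀ {x y} → (∀ ε → 0# < ε → x ≤ y + ε) → x ≤ y
  ≤-from-ε {x} {y} h with ≤-or-> x y
  ... | inj₁ x≤y = x≤y
  ... | inj₂ y<x = ⊥-elim (<⇒≱ mid<x (h ((x - y) * ½) (0<x*y (0<y-x y<x) 0<½)))
    where
    mid<x : y + (x - y) * ½ < x
    mid<x = <-by (0<x*y (0<y-x y<x) 0<½) (trans
      (solve 3 (λ x y h → x :- (y :+ (x :- y) :* h) := (x :- y) :* (:1 :- h)) refl x y ½)
      (*-congˡ 1-½≈½))

  abstract
    -- If `x` bounded the naturals, their supremum minus one would bound them as well.
    archimedean : ∀ x → ∃ λ n → x ≤ ι n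
    archimedean x = by-contradiction λ ¬∃ →
      let ub : UpperBound (λ y → ∃ λ n → y ≈ ι n) x
          ub = λ y (n , y≈ιn) → ≤-respˡ-≈ (sym y≈ιn) (<⇒≤ (≰⇒> λ x≤ιn → ¬∃ (n , x≤ιn)))
          (s , s-ub , s-least) = complete (λ y → ∃ λ n → y ≈ ι n) (0# , 0 , refl) (x , ub)
          s≤s-1 = s-least (s - 1#) λ y (n , y≈ιn) →
            ≤-by (0≤y-x (s-ub (ι (suc n)) (suc n , refl)))
              (trans (+-congˡ (-‿cong y≈ιn))
                (solve 2 (λ s k → s :- :1 :- k := s :- (:1 :+ k)) refl s (ι n)))
      in <⇒≱ (<-by 0<1 (solve 1 (λ s → s :- (s :- :1) := :1) refl s)) s≤s-1

    ev-≤ι : ∀ x → EventuallyNat (λ n → x ≤ ι n)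
    ev-≤ι x = let (N , x≤ιN) = archimedean x in N , λ n N≤n → ≤-trans x≤ιN (ι-mono N≤n)

    ev-0<ι : EventuallyNat (λ n → 0# < ι n)
    ev-0<ι = 1 , λ where (suc n) _ → 0<ι n

  the-spec : ∀ {P : ℝ → Set} → ∃ P → P (the P)
  the-spec {P} ∃P with em {∃ P}
  ... | yes (_ , p) = p
  ... | no  ¬∃P     = ⊥-elim (¬∃P ∃P)

  ⟶-upper : ∀ {u a c} → u ⟶ a → EventuallyNat (λ n → u n ≤ c) → a ≤ c
  ⟶-upper {u} {a} {c} u⟶a u≤c = ≤-from-ε λ ε 0<ε →
    ev-const (ev-map₂ (λ n d≤ε un≤c → ≤-by
      (0≤x+y (0≤y-x un≤c) (0≤y-x (≤-trans (-x≤∣x∣ _) d≤ε)))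
      (solve 4 (λ a c ε u → c :+ ε :- a := (c :- u) :+ (ε :- (:- (u :- a)))) refl a c ε (u n)))
      (u⟶a ε 0<ε) u≤c)

  ⟶-lower : ∀ {u a c} → u ⟶ a → EventuallyNat (λ n → c ≤ u n) → c ≤ a
  ⟶-lower {u} {a} {c} u⟶a c≤u = ≤-from-ε λ ε 0<ε →
    ev-const (ev-map₂ (λ n d≤ε c≤un → ≤-by
      (0≤x+y (0≤y-x c≤un) (0≤y-x (≤-trans (x≤∣x∣ _) d≤ε)))
      (solve 4 (λ a c ε u → a :+ ε :- c := (u :- c) :+ (ε :- (u :- a))) refl a c ε (u n)))
      (u⟶a ε 0<ε) c≤u)

  eventually-increasing : ∀ {u : ℕ → ℝ} {N} → (∀ n → N ℕ.≤ n → u n ≤ u (suc n)) →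
                          ∀ {m n} → N ℕ.≤ m → m ℕ.≤′ n → u m ≤ u n
  eventually-increasing inc N≤m (ℕ.≤′-reflexive ≡.refl) = ≤-refl
  eventually-increasing inc N≤m (ℕ.≤′-step m≤n) = ≤-trans
    (eventually-increasing inc N≤m m≤n) (inc _ (ℕₚ.≤-trans N≤m (ℕₚ.≤′⇒≤ m≤n)))

  monotone-converges : ∀ {u : ℕ → ℝ} {B} → EventuallyNat (λ n → u n ≤ u (suc n)) →
                       EventuallyNat (λ n → u n ≤ B) → ∃ (u ⟶_)
  monotone-converges {u} {B} (N₁ , inc₁) (N₂ , bd₂) = s , converges
    where
    N = N₁ ℕ.⊔ N₂
    inc : ∀ n → N ℕ.≤ n → u n ≤ u (suc n)
    inc n N≤n = inc₁ n (ℕₚ.m⊔n≤o⇒m≤o N₁ N₂ N≤n)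
    S : ℝ → Set
    S y = ∃ λ n → N ℕ.≤ n × y ≈ u n
    sup = complete S (u N , N , ℕₚ.≤-refl , refl)
      (B , λ y (n , N≤n , y≈un) → ≤-respˡ-≈ (sym y≈un) (bd₂ n (ℕₚ.m⊔n≤o⇒n≤o N₁ N₂ N≤n)))
    s = proj₁ sup
    converges : u ⟶ s
    converges ε 0<ε = m , λ n m≤n → ∣x∣≤
      (≤-trans (≤-by (0≤y-x (proj₁ (proj₂ sup) (u n) (n , ℕₚ.≤-trans N≤m m≤n , refl)))
        (solve 2 (λ s u → :0 :- (u :- s) := s :- u) refl s (u n))) (<⇒≤ 0<ε))
      (≤-by (0≤x+y (0≤y-x (<⇒≤ s-ε<um)) (0≤y-x (eventually-increasing inc N≤m (ℕₚ.≤⇒≤′ m≤n))))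
        (solve 4 (λ s ε um un → ε :- (:- (un :- s)) := (um :- (s :- ε)) :+ (un :- um)) refl s ε (u m) (u n)))
      where
      close : ∃ λ m → N ℕ.≤ m × s - ε < u m
      close = by-contradiction λ ¬close → <⇒≱
        (<-by 0<ε (solve 2 (λ s ε → s :- (s :- ε) := ε) refl s ε))
        (proj₂ (proj₂ sup) (s - ε) λ y (n , N≤n , y≈un) → ≤-respˡ-≈ (sym y≈un)
          (by-contradiction λ un≰ → ¬close (n , N≤n , ≰⇒> un≰)))
      m = proj₁ close
      N≤m = proj₁ (proj₂ close)
      s-ε<um = proj₂ (proj₂ close)

  expSeq : ℝ → ℕ → ℝ
  expSeq x n = (1# + x ÷ ι n) ^ n

  -- Equivalent to a positive base 1 + x/n. For negative `x` this holds only from some `n` on, and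
  -- from there `expSeq x` is positive and increasing.
  record Admissible (x : ℝ) (n : ℕ) : Set where
    constructor _∧_
    field
      0<k   : 0# < ι n
      0<k+x : 0# < ι n + x

  ev-admissible : ∀ x → EventuallyNat (Admissible x)
  ev-admissible x = ev-map₂ (λ n 0<ιn 1-x≤ιn → 0<ιn ∧
      (<-≤-trans 0<1 (≤-by (0≤y-x 1-x≤ιn) (solve 2 (λ k x → k :+ x :- :1 := k :- (:1 :- x)) refl (ι n) x))))
    ev-0<ι (ev-≤ι (1# - x))

  0<1+x÷ι : ∀ {x n} → Admissible x n → 0# < 1# + x ÷ ι n
  0<1+x÷ι {x} {n} (0<k ∧ 0<k+x) = <-respʳ-≈ eq (0<x*y 0<k+x (0<x⁻¹ 0<k))
    where
    eq : (ι n + x) ÷ ι n ≈ 1# + x ÷ ι n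
    eq = trans (distribʳ _ _ _) (+-congʳ (inverseʳ (>⇒≉0 0<k)))

  0<expSeq : ∀ {x n} → Admissible x n → 0# < expSeq x n
  0<expSeq {n = n} adm = 0<^ n (0<1+x÷ι adm)

  -1≤ : ∀ {x} → 0# < 1# + x → - 1# ≤ x
  -1≤ {x} 0<1+x = ≤-by (<⇒≤ 0<1+x) (solve 1 (λ x → x :- (:- :1) := :1 :+ x) refl x)

  1+x≤expSeq : ∀ {x n} → Admissible x n → 1# + x ≤ expSeq x n
  1+x≤expSeq {x} {n} adm@(0<k ∧ _) =
    ≤-respˡ-≈ (+-congˡ (sym (x≈y*x÷y (>⇒≉0 0<k)))) (bernoulli n (-1≤ (0<1+x÷ι adm)))

  -- Write s′ = s (1 + u) for the two bases and apply Bernoulli with exponent k + 1. The lower bound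
  -- s^(k+1) (1 + (k+1) u) is exactly s^k, because s + (k+1) (s′ - s) = 1.
  expSeq-increasing : ∀ {x n} → Admissible x n → expSeq x n ≤ expSeq x (suc n)
  expSeq-increasing {x} {n} adm@(0<k ∧ 0<k+x) = ≤-respˡ-≈ lhs (≤-respʳ-≈ rhs
    (*-monoˡ-≤ (<⇒≤ (0<^ (suc n) 0<s)) (bernoulli (suc n) (-1≤ 0<1+u))))
    where
    k = ι n
    k′ = 1# + k
    s = 1# + x ÷ k
    s′ = 1# + x ÷ k′
    u = s′ ÷ s - 1#
    0<k′ : 0# < k′
    0<k′ = 0<ι n
    0<s : 0# < s
    0<s = 0<1+x÷ι adm
    0<s′ : 0# < s′
    0<s′ = 0<1+x÷ι {x} {suc n} (0<k′ ∧ <-respʳ-≈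
      (solve 2 (λ k x → k :+ x :+ :1 := :1 :+ k :+ x) refl k x) (0<x+y 0<k+x 0≤1))
    1+u≈s′÷s : 1# + u ≈ s′ ÷ s
    1+u≈s′÷s = solve 1 (λ v → :1 :+ (v :- :1) := v) refl (s′ ÷ s)
    0<1+u : 0# < 1# + u
    0<1+u = <-respʳ-≈ (sym 1+u≈s′÷s) (0<x*y 0<s′ (0<x⁻¹ 0<s))
    rhs : s ^ suc n * (1# + u) ^ suc n ≈ s′ ^ suc n
    rhs = trans (sym (^-distrib-* s (1# + u) (suc n)))
      (^-cong (suc n) (trans (*-congˡ 1+u≈s′÷s) (sym (x≈y*x÷y (>⇒≉0 0<s)))))
    lhs : s ^ suc n * (1# + k′ * u) ≈ s ^ n
    lhs = begin
      s ^ suc n * (1# + k′ * u)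
        ≈⟨ solve 5 (λ s p k v h → s :* p :* (:1 :+ k :* (v :* h :- :1))
             := p :* (s :+ k :* (s :* (v :* h)) :- k :* s)) refl s (s ^ n) k′ s′ (s ⁻¹) ⟩
      s ^ n * (s + k′ * (s * (s′ ÷ s)) - k′ * s)
        ≈⟨ *-congˡ (+-congʳ (+-congˡ (*-congˡ (sym (x≈y*x÷y (>⇒≉0 0<s)))))) ⟩
      s ^ n * (s + k′ * s′ - k′ * s)
        ≈⟨ *-congˡ (solve 3 (λ k a b →
             (:1 :+ a) :+ (:1 :+ k) :* (:1 :+ b) :- (:1 :+ k) :* (:1 :+ a)
             := :1 :+ (:1 :+ k) :* b :- k :* a) refl k (x ÷ k) (x ÷ k′)) ⟩
      s ^ n * (1# + k′ * (x ÷ k′) - k * (x ÷ k))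
        ≈⟨ *-congˡ (+-cong (+-congˡ (sym (x≈y*x÷y (>⇒≉0 0<k′)))) (-‿cong (sym (x≈y*x÷y (>⇒≉0 0<k))))) ⟩
      s ^ n * (1# + x - x)
        ≈⟨ solve 2 (λ p x → p :* (:1 :+ x :- x) := p) refl (s ^ n) x ⟩
      s ^ n ∎
      where open ≈-Reasoning

  ^≤1 : ∀ {x} n → 0# ≤ x → x ≤ 1# → x ^ n ≤ 1#
  ^≤1 n 0≤x x≤1 = ≤-respʳ-≈ (1^n≈1 n) (^-mono-≤ n 0≤x x≤1)

  expSeq-neg : ∀ {x n} → Admissible x n → Admissible (- x) n → expSeq x n * expSeq (- x) n ≤ 1#
  expSeq-neg {x} {n} adm adm′ = ≤-respˡ-≈ (^-distrib-* _ _ n)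
    (^≤1 n (<⇒≤ (0<x*y (0<1+x÷ι adm) (0<1+x÷ι adm′)))
      (≤-by (0≤x*x (x ÷ ι n)) (solve 2 (λ x h →
        :1 :- (:1 :+ x :* h) :* (:1 :+ (:- x) :* h) := x :* h :* (x :* h)) refl x (ι n ⁻¹))))

  -- By `expSeq-neg` the terms are at most the inverses of those of `expSeq (- x)`, and the latter
  -- increase, so the inverse of any one admissible term bounds all later ones.
  expSeq-bounded : ∀ x → ∃ λ B → EventuallyNat (λ n → expSeq x n ≤ B)
  expSeq-bounded x with ev-admissible (- x)
  ... | N , adm′ = y ⁻¹ , ev-map₂ bound (ev-admissible x) (ev-≥ N)
    where
    y = expSeq (- x) N
    0<y : 0# < y
    0<y = 0<expSeq (adm′ N ℕₚ.≤-refl)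
    y≤ : ∀ {n} → N ℕ.≤ n → y ≤ expSeq (- x) n
    y≤ N≤n = eventually-increasing {expSeq (- x)} (λ n N≤n → expSeq-increasing (adm′ n N≤n))
      ℕₚ.≤-refl (ℕₚ.≤⇒≤′ N≤n)
    bound : ∀ n → Admissible x n → N ℕ.≤ n → expSeq x n ≤ y ⁻¹
    bound n adm N≤n = *-cancelˡ-≤ 0<y
      (≤-trans (*-mono-≤ (<⇒≤ 0<y) (<⇒≤ (0<expSeq adm)) (y≤ N≤n) ≤-refl)
        (≤-respˡ-≈ (*-comm _ _) (≤-respʳ-≈ (sym (inverseʳ (>⇒≉0 0<y))) (expSeq-neg adm (adm′ n N≤n)))))

  exp-limit : ∀ x → expSeq x ⟶ exp x
  exp-limit x = the-spec {expSeq x ⟶_} (monotone-converges (ev-map (λ n → expSeq-increasing) (ev-admissible x))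
    (proj₂ (expSeq-bounded x)))

  ev-expSeq≤exp : ∀ x → EventuallyNat (λ n → expSeq x n ≤ exp x)
  ev-expSeq≤exp x = let (N , adm) = ev-admissible x in N , λ m N≤m → ⟶-lower (exp-limit x)
    (m , λ n m≤n → eventually-increasing {expSeq x} (λ k N≤k → expSeq-increasing (adm k N≤k)) N≤m (ℕₚ.≤⇒≤′ m≤n))

  1+x≤exp : ∀ x → 1# + x ≤ exp x
  1+x≤exp x = ⟶-lower (exp-limit x) (ev-map (λ n → 1+x≤expSeq) (ev-admissible x))

  0<exp : ∀ x → 0# < exp x
  0<exp x = ev-const (ev-map₂ (λ n adm → <-≤-trans (0<expSeq {n = n} adm)) (ev-admissible x) (ev-expSeq≤exp x))

  exp-cong : ∀ {x y} → x ≈ y → exp x ≈ exp y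
  exp-cong x≈y = antisym (mono x≈y) (mono (sym x≈y))
    where
    mono : ∀ {x y} → x ≈ y → exp x ≤ exp y
    mono {x} {y} x≈y = ⟶-upper (exp-limit x) (ev-map (λ n →
      ≤-respˡ-≈ (^-cong n (+-congˡ (*-congʳ (sym x≈y))))) (ev-expSeq≤exp y))

  -- Factor (1 + x/k) (1 + y/k) = s (1 + δ) with s = 1 + (x+y)/k, where δ is of order 1/k².
  -- Bernoulli gives (1 + δ)^k ≥ 1 + k δ, and k δ is at least -c/k. Only this direction is
  -- estimated; the other follows algebraically in `exp-+`.
  exp-+-≤ : ∀ x y → exp (x + y) ≤ exp x * exp y
  exp-+-≤ x y = ≤-from-ε λ ε 0<ε → ⟶-upper (exp-limit (x + y))
    (ev-map₂ (λ n (adm-x , adm-y , x≤ , y≤) ((adm-xy , xy≤) , (1-2xy≤k , C÷ε≤k)) →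
        bound ε 0<ε n adm-x adm-y adm-xy x≤ y≤ xy≤ 1-2xy≤k C÷ε≤k)
      (ev-and (ev-admissible x) (ev-and (ev-admissible y) (ev-and (ev-expSeq≤exp x) (ev-expSeq≤exp y))))
      (ev-and (ev-and (ev-admissible (x + y)) (ev-expSeq≤exp (x + y)))
        (ev-and (ev-≤ι (- ((1# + 1#) * (x + y)))) (ev-≤ι (C ÷ ε)))))
    where
    -- The factor 2 pays for s ≥ ½, which is the condition `large` below. The total loss is
    -- `C ÷ ι n`, hence the requirement `C ÷ ε ≤ ι n`.
    c = (1# + 1#) * ∣ x * y ∣
    C = c * exp (x + y)
    bound : ∀ ε → 0# < ε → ∀ n → Admissible x n → Admissible y n → Admissible (x + y) n →
            expSeq x n ≤ exp x → expSeq y n ≤ exp y → expSeq (x + y) n ≤ exp (x + y) →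
            - ((1# + 1#) * (x + y)) ≤ ι n → C ÷ ε ≤ ι n →
            expSeq (x + y) n ≤ exp x * exp y + ε
    bound ε 0<ε n adm-x adm-y adm-xy@(0<k ∧ _) x≤ y≤ xy≤ large C÷ε≤k = ≤-by
      (0≤x+y (0≤x+y (0≤y-x E·≤) (0≤y-x (*-mono-≤ (<⇒≤ (0<expSeq {n = n} adm-x)) (<⇒≤ (0<expSeq {n = n} adm-y)) x≤ y≤)))
        (0≤x+y (0≤y-x C*h≤ε) (*-nonNeg 0≤c*h (0≤y-x xy≤))))
      (solve 7 (λ P ε e Q c h E → P :+ ε :- e :=
        (Q :- e :* (:1 :- c :* h)) :+ (P :- Q) :+ ((ε :- c :* E :* h) :+ c :* h :* (E :- e))) refl
        (exp x * exp y) ε (expSeq (x + y) n) (expSeq x n * expSeq y n) c h (exp (x + y)))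
      where
      k = ι n
      h = k ⁻¹
      0<h : 0# < h
      0<h = 0<x⁻¹ 0<k
      0≤c*h : 0# ≤ c * h
      0≤c*h = *-nonNeg (*-nonNeg (<⇒≤ 0<2) (0≤∣x∣ _)) (<⇒≤ 0<h)
      C*h≤ε : C * h ≤ ε
      C*h≤ε = ÷-≤ 0<k (≤-respˡ-≈ (sym (x≈y*x÷y (>⇒≉0 0<ε))) (*-monoˡ-≤ (<⇒≤ 0<ε) C÷ε≤k))
      s = 1# + (x + y) ÷ k
      g = x ÷ k * (y ÷ k)
      δ = g ÷ s
      0<s : 0# < s
      0<s = 0<1+x÷ι adm-xy
      1≤2s : 1# ≤ (1# + 1#) * s
      1≤2s = *-cancelˡ-≤ 0<k (≤-by (0≤y-x large) (begin
        k * ((1# + 1#) * s) - k * 1#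
          ≈⟨ solve 3 (λ k z h → k :* ((:1 :+ :1) :* (:1 :+ z :* h)) :- k :* :1
               := k :+ (:1 :+ :1) :* (k :* (z :* h))) refl k (x + y) h ⟩
        k + (1# + 1#) * (k * ((x + y) ÷ k))
          ≈⟨ +-congˡ (*-congˡ (sym (x≈y*x÷y (>⇒≉0 0<k)))) ⟩
        k + (1# + 1#) * (x + y)
          ≈⟨ solve 2 (λ k z → k :+ (:1 :+ :1) :* z := k :- (:- ((:1 :+ :1) :* z))) refl k (x + y) ⟩
        k - - ((1# + 1#) * (x + y)) ∎))
        where open ≈-Reasoning
      s*1+δ : s * (1# + δ) ≈ (1# + x ÷ k) * (1# + y ÷ k)
      s*1+δ = begin
        s * (1# + g ÷ s)   ≈⟨ trans (distribˡ _ _ _) (+-cong (*-identityʳ s) (sym (x≈y*x÷y (>⇒≉0 0<s)))) ⟩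
        s + g              ≈⟨ solve 3 (λ x y h → :1 :+ (x :+ y) :* h :+ x :* h :* (y :* h)
                                := (:1 :+ x :* h) :* (:1 :+ y :* h)) refl x y h ⟩
        (1# + x ÷ k) * (1# + y ÷ k) ∎
        where open ≈-Reasoning
      0<1+δ : 0# < 1# + δ
      0<1+δ = ≰⇒> λ 1+δ≤0 → <⇒≱ (0<x*y (0<1+x÷ι adm-x) (0<1+x÷ι adm-y))
        (≤-respˡ-≈ s*1+δ (≤-respʳ-≈ (zeroʳ s) (*-monoˡ-≤ (<⇒≤ 0<s) 1+δ≤0)))
      -- k·δ = (xy/k)/s ≥ -2∣xy∣/k since s ≥ ½.
      -ch≤kδ : - (c * h) ≤ k * δ
      -ch≤kδ = *-cancelˡ-≤ 0<s (≤-by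
        (0≤x+y (*-nonNeg (<⇒≤ 0<h) (0≤y-x (-x≤∣x∣ (x * y))))
          (*-nonNeg (*-nonNeg (0≤∣x∣ (x * y)) (<⇒≤ 0<h)) (0≤y-x 1≤2s)))
        (begin
          s * (k * δ) - s * - (c * h)
            ≈⟨ solve 6 (λ s k δ m h z → s :* (k :* δ) :- s :* (:- ((:1 :+ :1) :* m :* h))
                 := k :* (s :* δ) :+ (:1 :+ :1) :* s :* m :* h) refl s k δ ∣ x * y ∣ h (x * y) ⟩
          k * (s * δ) + (1# + 1#) * s * ∣ x * y ∣ * h
            ≈⟨ +-congʳ (*-congˡ (sym (x≈y*x÷y (>⇒≉0 0<s)))) ⟩
          k * g + (1# + 1#) * s * ∣ x * y ∣ * h
            ≈⟨ +-congʳ (solve 4 (λ k h x y → k :* (x :* h :* (y :* h)) := (k :* h) :* (x :* y :* h)) refl k h x y) ⟩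
          (k * h) * (x * y * h) + (1# + 1#) * s * ∣ x * y ∣ * h
            ≈⟨ +-congʳ (trans (*-congʳ (inverseʳ (>⇒≉0 0<k))) (*-identityˡ _)) ⟩
          x * y * h + (1# + 1#) * s * ∣ x * y ∣ * h
            ≈⟨ solve 4 (λ z h s m → z :* h :+ (:1 :+ :1) :* s :* m :* h
                 := h :* (m :- (:- z)) :+ m :* h :* ((:1 :+ :1) :* s :- :1)) refl (x * y) h s ∣ x * y ∣ ⟩
          h * (∣ x * y ∣ - - (x * y)) + ∣ x * y ∣ * h * ((1# + 1#) * s - 1#) ∎))
        where open ≈-Reasoning
      E·≤ : expSeq (x + y) n * (1# - c * h) ≤ expSeq x n * expSeq y n
      E·≤ = ≤-respʳ-≈ (trans (sym (^-distrib-* s (1# + δ) n))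
          (trans (^-cong n s*1+δ) (^-distrib-* _ _ n)))
        (*-monoˡ-≤ (<⇒≤ (0<^ n 0<s)) (≤-trans (+-mono-≤ ≤-refl -ch≤kδ) (bernoulli n (-1≤ 0<1+δ))))

  exp0≈1 : exp 0# ≈ 1#
  exp0≈1 = antisym
    (⟶-upper (exp-limit 0#) (ev-always λ n → ≤-reflexive
      (trans (^-cong n (trans (+-congˡ (zeroˡ _)) (+-identityʳ 1#))) (1^n≈1 n))))
    (≤-respˡ-≈ (+-identityʳ 1#) (1+x≤exp 0#))

  -- The limit is taken in one factor at a time, so that no product rule for limits is needed: for m
  -- ≤ n monotonicity replaces `expSeq x m` by `expSeq x n`, and then n tends to infinity with m
  -- fixed.
  expSeq*exp-neg≤1 : ∀ x → EventuallyNat (λ m → expSeq x m * exp (- x) ≤ 1#)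
  expSeq*exp-neg≤1 x = N , λ m N≤m → ≤-respʳ-≈ (inverseʳ (>⇒≉0 (0<e m N≤m)))
    (*-monoˡ-≤ (<⇒≤ (0<e m N≤m)) (⟶-upper (exp-limit (- x)) (ev-map₂ (λ n m≤n adm′ →
      *-cancelˡ-≤ (0<e m N≤m) (≤-respʳ-≈ (sym (inverseʳ (>⇒≉0 (0<e m N≤m)))) (≤-trans
        (*-mono-≤ (<⇒≤ (0<e m N≤m)) (<⇒≤ (0<expSeq adm′))
          (eventually-increasing {expSeq x} (λ k N≤k → expSeq-increasing (adm k N≤k)) N≤m (ℕₚ.≤⇒≤′ m≤n)) ≤-refl)
        (expSeq-neg (adm n (ℕₚ.≤-trans N≤m m≤n)) adm′))))
      (ev-≥ m) (ev-admissible (- x)))))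
    where
    N = proj₁ (ev-admissible x)
    adm = proj₂ (ev-admissible x)
    0<e : ∀ m → N ℕ.≤ m → 0# < expSeq x m
    0<e m N≤m = 0<expSeq (adm m N≤m)

  exp-neg-≤ : ∀ x → exp x * exp (- x) ≤ 1#
  exp-neg-≤ x = ≤-respˡ-≈ (*-comm _ _) (≤-respʳ-≈ (inverseʳ (>⇒≉0 (0<exp (- x))))
    (*-monoˡ-≤ (<⇒≤ (0<exp (- x))) (⟶-upper (exp-limit x) (ev-map (λ n e≤1 →
      *-cancelˡ-≤ (0<exp (- x)) (≤-respˡ-≈ (*-comm _ _)
        (≤-respʳ-≈ (sym (inverseʳ (>⇒≉0 (0<exp (- x))))) e≤1)))
      (expSeq*exp-neg≤1 x)))))

  -- For the reverse inequality apply `exp-+-≤` to x = (x + y) + (- y), multiply by `exp y` and use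
  -- `exp-neg-≤`.
  exp-+ : ∀ x y → exp (x + y) ≈ exp x * exp y
  exp-+ x y = antisym (exp-+-≤ x y) (≤-trans
    (*-mono-≤ (<⇒≤ (0<exp x)) (<⇒≤ (0<exp y))
      (≤-respˡ-≈ (exp-cong (solve 2 (λ x y → x :+ y :+ (:- y) := x) refl x y)) (exp-+-≤ (x + y) (- y))) ≤-refl)
    (≤-respˡ-≈ (solve 3 (λ e f g → e :* (f :* g) := e :* g :* f) refl (exp (x + y)) (exp y) (exp (- y)))
      (≤-respʳ-≈ (*-identityʳ _) (*-monoˡ-≤ (<⇒≤ (0<exp (x + y))) (exp-neg-≤ y)))))

  exp-neg : ∀ x → exp x * exp (- x) ≈ 1#
  exp-neg x = trans (sym (exp-+ x (- x))) (trans (exp-cong (-‿inverseʳ x)) exp0≈1)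

  exp-mono-< : ∀ {x y} → x < y → exp x < exp y
  exp-mono-< {x} {y} x<y = <-respʳ-≈ (trans (sym (exp-+ x (y - x)))
      (exp-cong (solve 2 (λ x y → x :+ (y :- x) := y) refl x y)))
    (<-by (0<x*y (0<exp x) (0<y-x (<-≤-trans
        (<-by (0<y-x x<y) (solve 1 (λ d → :1 :+ d :- :1 := d) refl (y - x))) (1+x≤exp (y - x)))))
      (solve 2 (λ e f → e :* f :- e := e :* (f :- :1)) refl (exp x) (exp (y - x))))

  exp-mono-≤ : ∀ {x y} → x ≤ y → exp x ≤ exp y
  exp-mono-≤ {x} {y} x≤y with em {x ≈ y}
  ... | yes x≈y = ≤-reflexive (exp-cong x≈y)
  ... | no  x≉y = <⇒≤ (exp-mono-< (x≤y , x≉y))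

  exp-cancel-≤ : ∀ {x y} → exp x ≤ exp y → x ≤ y
  exp-cancel-≤ {x} {y} ex≤ey with ≤-or-> x y
  ... | inj₁ x≤y = x≤y
  ... | inj₂ y<x = ⊥-elim (<⇒≱ (exp-mono-< y<x) ex≤ey)

  exp*1-h≤ : ∀ s h → exp s * (1# - h) ≤ exp (s - h)
  exp*1-h≤ s h = ≤-respʳ-≈ (sym (exp-+ s (- h))) (*-monoˡ-≤ (<⇒≤ (0<exp s)) (1+x≤exp (- h)))

  -- Completeness stands in for continuity: `s` is the supremum of the solutions of exp x ≤ y. There
  -- is one, since exp (1/y) ≥ 1/y, and `y` itself is an upper bound because x ≤ exp x.
  exp-surjective : ∀ {y} → 0# < y → ∃ λ x → exp x ≈ y
  exp-surjective {y} 0<y = s , antisym exp-s≤y y≤exp-s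
    where
    S : ℝ → Set
    S x = exp x ≤ y
    S-least : S (- (y ⁻¹))
    S-least = *-cancelˡ-≤ (0<exp (y ⁻¹)) (≤-respˡ-≈ (sym (exp-neg (y ⁻¹)))
      (≤-trans (≤-reflexive (sym (inverseʳ (>⇒≉0 0<y)))) (≤-respˡ-≈ (*-comm _ _)
        (*-mono-≤ (<⇒≤ (0<x⁻¹ 0<y)) (<⇒≤ 0<y)
          (≤-trans (≤-by 0≤1 (solve 1 (λ z → :1 :+ z :- z := :1) refl (y ⁻¹))) (1+x≤exp (y ⁻¹))) ≤-refl))))
    sup = complete S (- (y ⁻¹) , S-least) (y , λ x ex≤y → ≤-trans
      (≤-by 0≤1 (solve 1 (λ x → :1 :+ x :- x := :1) refl x)) (≤-trans (1+x≤exp x) ex≤y))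
    s = proj₁ sup
    E = exp s
    -- With h = 1 - y/E one has E (1 - h) = y.
    exp-s≤y : E ≤ y
    exp-s≤y = by-contradiction λ E≰y →
      let h = 1# - y ÷ E
          0<h = 0<y-x (≤∧≉ (÷-≤ (0<exp s) (≤-respʳ-≈ (sym (*-identityˡ E)) (<⇒≤ (≰⇒> E≰y))))
                  λ y÷E≈1 → E≰y (≤-reflexive (trans (sym (*-identityʳ E))
                    (trans (*-congˡ (sym y÷E≈1)) (sym (x≈y*x÷y (>⇒≉0 (0<exp s))))))))
          y≤exp = ≤-respˡ-≈ (trans (*-congˡ (solve 1 (λ q → :1 :- (:1 :- q) := q) refl (y ÷ E)))
                    (sym (x≈y*x÷y (>⇒≉0 (0<exp s))))) (exp*1-h≤ s h)
      in <⇒≱ (<-by 0<h (solve 2 (λ s h → s :- (s :- h) := h) refl s h))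
           (proj₂ (proj₂ sup) (s - h) λ x ex≤y → exp-cancel-≤ (≤-trans ex≤y y≤exp))
      where
      ≤∧≉ : ∀ {a b} → a ≤ b → a ≉ b → a < b
      ≤∧≉ = _,_
    -- With h = 1 - E/y one has y (1 - h) = E, hence exp (s + h) ≤ y.
    y≤exp-s : y ≤ E
    y≤exp-s = by-contradiction λ y≰E →
      let h = 1# - E ÷ y
          0<h = 0<y-x {E ÷ y} {1#} (÷-≤ 0<y (≤-respʳ-≈ (sym (*-identityˡ y)) (<⇒≤ (≰⇒> y≰E))) ,
                  λ E÷y≈1 → y≰E (≤-reflexive (trans (sym (*-identityʳ y))
                    (trans (*-congˡ (sym E÷y≈1)) (sym (x≈y*x÷y (>⇒≉0 0<y)))))))
          1-h≈ = solve 1 (λ q → :1 :- (:1 :- q) := q) refl (E ÷ y)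
          exp≤y = *-cancelˡ-≤ (0<x*y (0<exp s) (0<x⁻¹ 0<y)) (≤-respʳ-≈
                    (solve 3 (λ y e i → e :* i :* y := e :* i :* y) refl y E (y ⁻¹))
                    (≤-trans (≤-respˡ-≈ (trans (*-congˡ 1-h≈) (*-comm _ _)) (exp*1-h≤ (s + h) h))
                      (≤-reflexive (trans (exp-cong (solve 2 (λ s h → s :+ h :- h := s) refl s h))
                        (trans (x≈y*x÷y (>⇒≉0 0<y)) (*-comm _ _))))))
      in <⇒≱ (<-by 0<h (solve 2 (λ s h → s :+ h :- s := h) refl s h)) (proj₁ (proj₂ sup) (s + h) exp≤y)

  exp-log : ∀ {y} → 0# < y → exp (log y) ≈ y
  exp-log {y} 0<y = the-spec {λ x → exp x ≈ y} (exp-surjective 0<y)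

-- Germs of sequences at infinity, and domination up to a constant.

module Asymptotics (em : ExcludedMiddle 0ℓ) (𝓡 : CompleteOrderedField) where
  open Reals em 𝓡
  open OrderedField em 𝓡
  open RingSolver commutativeRing
  open Exponential em 𝓡

  Seq : Set
  Seq = ℕ → ℝ

  infixl 6 _⊕_
  infixl 7 _⊗_
  infix  8 ⊝_
  infix  9 _⁻

  K : ℝ → Seq
  K c n = c

  _⊕_ _⊗_ : Seq → Seq → Seq
  (f ⊕ g) n = f n + g n
  (f ⊗ g) n = f n * g n

  ⊝_ _⁻ E Δ : Seq → Seq
  (⊝ f) n = - f n
  (f ⁻) n = f n ⁻¹
  E f n   = f (suc n)
  Δ f n   = f (suc n) - f n

  infix 4 _≋_ _≲_

  -- Equality of germs at infinity. Germs form a commutative ring, so the solver handles sequences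
  -- and their shifts as variables, and nonvanishing is only required eventually.
  record _≋_ (f g : Seq) : Set where
    constructor eventually
    field ev : EventuallyNat (λ n → f n ≈ g n)
  open _≋_ public

  pointwise : ∀ {f g} → (∀ n → f n ≈ g n) → f ≋ g
  pointwise p = eventually (ev-always p)

  sequenceRing : CommutativeRing 0ℓ 0ℓ
  sequenceRing = record
    { Carrier = Seq
    ; _≈_ = _≋_
    ; _+_ = _⊕_
    ; _*_ = _⊗_
    ; -_ = ⊝_
    ; 0# = K 0#
    ; 1# = K 1#
    ; isCommutativeRing = record
      { isRing = record
        { +-isAbelianGroup = record
          { isGroup = record
            { isMonoid = record
              { isSemigroup = record
                { isMagma = record
                  { isEquivalence = record
                    { refl = pointwise λ n → refl
                    ; sym = λ p → eventually (ev-map (λ n → sym) (ev p))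
                    ; trans = λ p q → eventually (ev-map₂ (λ n → trans) (ev p) (ev q))
                    }
                  ; ∙-cong = λ p q → eventually (ev-map₂ (λ n → +-cong) (ev p) (ev q))
                  }
                ; assoc = λ f g h → pointwise λ n → +-assoc (f n) (g n) (h n)
                }
              ; identity = (λ f → pointwise λ n → +-identityˡ (f n)) , λ f → pointwise λ n → +-identityʳ (f n)
              }
            ; inverse = (λ f → pointwise λ n → -‿inverseˡ (f n)) , λ f → pointwise λ n → -‿inverseʳ (f n)
            ; ⁻¹-cong = λ p → eventually (ev-map (λ n → -‿cong) (ev p))
            }
          ; comm = λ f g → pointwise λ n → +-comm (f n) (g n)
          }
        ; *-cong = λ p q → eventually (ev-map₂ (λ n → *-cong) (ev p) (ev q))
        ; *-assoc = λ f g h → pointwise λ n → *-assoc (f n) (g n) (h n)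
        ; *-identity = (λ f → pointwise λ n → *-identityˡ (f n)) , λ f → pointwise λ n → *-identityʳ (f n)
        ; distrib = (λ f g h → pointwise λ n → distribˡ (f n) (g n) (h n)) , λ f g h → pointwise λ n → distribʳ (f n) (g n) (h n)
        }
      ; *-comm = λ f g → pointwise λ n → *-comm (f n) (g n)
      }
    }

  module Sq = CommutativeRing sequenceRing

  ⁻-cong : ∀ {f g} → f ≋ g → f ⁻ ≋ g ⁻
  ⁻-cong p = eventually (ev-map (λ n → ⁻¹-cong) (ev p))

  E-cong : ∀ {f g} → f ≋ g → E f ≋ E g
  E-cong p = eventually (ev-suc (ev p))

  Δ-cong : ∀ {f g} → f ≋ g → Δ f ≋ Δ g
  Δ-cong p = eventually (ev-map₂ (λ n q r → +-cong q (-‿cong r)) (ev-suc (ev p)) (ev p))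

  NonZero : Seq → Set
  NonZero f = EventuallyNat (λ n → f n ≉ 0#)

  ⁻-inverse : ∀ {f} → NonZero f → f ⊗ f ⁻ ≋ K 1#
  ⁻-inverse nz = eventually (ev-map (λ n → inverseʳ) nz)

  NonZero-⁻ : ∀ {f} → NonZero f → NonZero (f ⁻)
  NonZero-⁻ = ev-map λ n → ⁻¹-≉0

  NonZero-⊗ : ∀ {f g} → NonZero f → NonZero g → NonZero (f ⊗ g)
  NonZero-⊗ = ev-map₂ λ n → *-≉0

  ⁻-⊗ : ∀ f g → (f ⊗ g) ⁻ ≋ f ⁻ ⊗ g ⁻
  ⁻-⊗ f g = pointwise λ n → ⁻¹-distrib-* (f n) (g n)

  -- This is f = O(g). The absolute value on the right spares sign conditions on weights.
  record _≲_ (f g : Seq) : Set where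
    constructor bounded
    field
      C     : ℝ
      0≤C   : 0# ≤ C
      bound : EventuallyNat (λ n → ∣ f n ∣ ≤ C * ∣ g n ∣)

  ≲-pointwise : ∀ {f g} → EventuallyNat (λ n → ∣ f n ∣ ≤ ∣ g n ∣) → f ≲ g
  ≲-pointwise p = bounded 1# 0≤1 (ev-map (λ n → ≤-respʳ-≈ (sym (*-identityˡ _))) p)

  ≋⇒≲ : ∀ {f g} → f ≋ g → f ≲ g
  ≋⇒≲ p = ≲-pointwise (ev-map (λ n q → ≤-reflexive (∣-∣-cong q)) (ev p))

  ≲-refl : ∀ {f} → f ≲ f
  ≲-refl = ≋⇒≲ Sq.refl

  ≲-trans : ∀ {f g h} → f ≲ g → g ≲ h → f ≲ h
  ≲-trans (bounded C 0≤C p) (bounded D 0≤D q) = bounded (C * D) (*-nonNeg 0≤C 0≤D)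
    (ev-map₂ (λ n p q → ≤-trans p (≤-respʳ-≈ (sym (*-assoc _ _ _)) (*-monoˡ-≤ 0≤C q))) p q)

  ≲-respˡ : ∀ {f g h} → f ≋ g → f ≲ h → g ≲ h
  ≲-respˡ p = ≲-trans (≋⇒≲ (Sq.sym p))

  ≲-respʳ : ∀ {f g h} → g ≋ h → f ≲ g → f ≲ h
  ≲-respʳ p q = ≲-trans q (≋⇒≲ p)

  ≲-⊗ : ∀ {f f′ g g′} → f ≲ f′ → g ≲ g′ → f ⊗ g ≲ f′ ⊗ g′
  ≲-⊗ (bounded C 0≤C p) (bounded D 0≤D q) = bounded (C * D) (*-nonNeg 0≤C 0≤D)
    (ev-map₂ (λ n p q → ≤-respˡ-≈ (sym (∣x*y∣≈∣x∣*∣y∣ _ _)) (≤-trans (*-mono-≤ (0≤∣x∣ _) (0≤∣x∣ _) p q)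
      (≤-reflexive (trans (solve 4 (λ C D x y → C :* x :* (D :* y) := C :* D :* (x :* y)) refl C D _ _)
        (*-congˡ (sym (∣x*y∣≈∣x∣*∣y∣ _ _))))))) p q)

  ≲-⊗ˡ : ∀ {f g} h → f ≲ g → h ⊗ f ≲ h ⊗ g
  ≲-⊗ˡ h = ≲-⊗ ≲-refl

  ≲-⊗ʳ : ∀ {f g} h → f ≲ g → f ⊗ h ≲ g ⊗ h
  ≲-⊗ʳ h p = ≲-⊗ p ≲-refl

  ≲-⊕ : ∀ {f g h} → f ≲ h → g ≲ h → f ⊕ g ≲ h
  ≲-⊕ (bounded C 0≤C p) (bounded D 0≤D q) = bounded (C + D) (0≤x+y 0≤C 0≤D)
    (ev-map₂ (λ n p q → ≤-trans (∣x+y∣≤∣x∣+∣y∣ _ _) (≤-respʳ-≈ (sym (distribʳ _ _ _)) (+-mono-≤ p q))) p q)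

  ≲-⊝ : ∀ {f g} → f ≲ g → ⊝ f ≲ g
  ≲-⊝ (bounded C 0≤C p) = bounded C 0≤C (ev-map (λ n → ≤-respˡ-≈ (sym (∣-x∣≈∣x∣ _))) p)

  ≲-E : ∀ {f g} → f ≲ g → E f ≲ E g
  ≲-E (bounded C 0≤C p) = bounded C 0≤C (ev-suc p)

  ≲-0 : ∀ {f} → K 0# ≲ f
  ≲-0 = ≲-pointwise (ev-always λ n → ≤-respˡ-≈ (sym (0≤x⇒∣x∣≈x ≤-refl)) (0≤∣x∣ _))

  ≲-K : ∀ c → K c ≲ K 1#
  ≲-K c = bounded ∣ c ∣ (0≤∣x∣ c) (ev-always λ n → ≤-reflexive
    (sym (trans (*-congˡ (0≤x⇒∣x∣≈x 0≤1)) (*-identityʳ _))))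

  ≲-⁻ : ∀ {f g} → NonZero g → g ≲ f → f ⁻ ≲ g ⁻
  ≲-⁻ {f} {g} nz (bounded C 0≤C p) = bounded C 0≤C (ev-map₂ inverted nz p)
    where
    inverted : ∀ n → g n ≉ 0# → ∣ g n ∣ ≤ C * ∣ f n ∣ → ∣ f n ⁻¹ ∣ ≤ C * ∣ g n ⁻¹ ∣
    inverted n g≉0 g≤Cf = *-cancelˡ-≤ (x≉0⇒0<∣x∣ g≉0) (≤-trans
      (≤-respˡ-≈ (*-comm _ _) (*-monoˡ-≤ (0≤∣x∣ _) g≤Cf))
      (≤-reflexive (begin
        ∣ f n ⁻¹ ∣ * (C * ∣ f n ∣)  ≈⟨ solve 3 (λ a C b → a :* (C :* b) := C :* (a :* b)) refl _ C _ ⟩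
        C * (∣ f n ⁻¹ ∣ * ∣ f n ∣)  ≈⟨ *-congˡ (trans (∣x⁻¹∣*∣x∣≈1 f≉0) (sym (∣x⁻¹∣*∣x∣≈1 g≉0))) ⟩
        C * (∣ g n ⁻¹ ∣ * ∣ g n ∣)  ≈⟨ solve 3 (λ a C b → C :* (a :* b) := b :* (C :* a)) refl _ C _ ⟩
        ∣ g n ∣ * (C * ∣ g n ⁻¹ ∣)  ∎)))
      where
      open ≈-Reasoning
      f≉0 : f n ≉ 0#
      f≉0 f≈0 = <⇒≱ (x≉0⇒0<∣x∣ g≉0) (≤-respʳ-≈ (trans (*-congˡ (trans (∣-∣-cong f≈0)
        (0≤x⇒∣x∣≈x ≤-refl))) (zeroʳ C)) g≤Cf)

  NonZero-≲ : ∀ {f g} → NonZero g → g ≲ f → NonZero f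
  NonZero-≲ {f} {g} nz (bounded C 0≤C p) = ev-map₂ (λ n g≉0 g≤Cf f≈0 →
    <⇒≱ (x≉0⇒0<∣x∣ g≉0) (≤-respʳ-≈ (trans (*-congˡ (trans (∣-∣-cong f≈0)
        (0≤x⇒∣x∣≈x ≤-refl))) (zeroʳ C)) g≤Cf)) nz p

  ≲-cancelʳ : ∀ {f g h} → NonZero h → f ⊗ h ≲ g ⊗ h → f ≲ g
  ≲-cancelʳ {f} {g} {h} nz p = ≲-respˡ (cancel f) (≲-respʳ (cancel g) (≲-⊗ʳ (h ⁻) p))
    where
    cancel : ∀ f → f ⊗ h ⊗ h ⁻ ≋ f
    cancel f = Sq.trans (Sq.*-assoc f h (h ⁻)) (Sq.trans (Sq.*-congˡ (⁻-inverse nz)) (Sq.*-identityʳ f))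

  -- A shift may change the weight only by a bounded factor. Both directions are asked for, since
  -- inversion exchanges them.
  record Tame (w : Seq) : Set where
    field
      nonZero : NonZero w
      Ew≲w    : E w ≲ w
      w≲Ew    : w ≲ E w
  open Tame public

  Tame-⊗ : ∀ {u v} → Tame u → Tame v → Tame (u ⊗ v)
  Tame-⊗ tu tv = record
    { nonZero = NonZero-⊗ (nonZero tu) (nonZero tv)
    ; Ew≲w = ≲-⊗ (Ew≲w tu) (Ew≲w tv)
    ; w≲Ew = ≲-⊗ (w≲Ew tu) (w≲Ew tv)
    }

  Tame-⁻ : ∀ {w} → Tame w → Tame (w ⁻)
  Tame-⁻ tw = record
    { nonZero = NonZero-⁻ (nonZero tw)
    ; Ew≲w = ≲-⁻ (nonZero tw) (w≲Ew tw)
    ; w≲Ew = ≲-⁻ (ev-suc (nonZero tw)) (Ew≲w tw)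
    }

  Tame-1 : Tame (K 1#)
  Tame-1 = record { nonZero = ev-always λ n 1≈0 → 0≉1 (sym 1≈0) ; Ew≲w = ≲-refl ; w≲Ew = ≲-refl }

  ν : Seq
  ν = ι ⁻

  NonZero-ι : NonZero ι
  NonZero-ι = ev-map (λ n → >⇒≉0) ev-0<ι

  ι⊗ν≋1 : ι ⊗ ν ≋ K 1#
  ι⊗ν≋1 = ⁻-inverse NonZero-ι

  1≲ι : K 1# ≲ ι
  1≲ι = ≲-pointwise (ev-map (λ n 1≤n → ≤-respˡ-≈ (sym (0≤x⇒∣x∣≈x 0≤1)) (≤-trans 1≤n (x≤∣x∣ _))) (ev-≤ι 1#))

  Tame-ι : Tame ι
  Tame-ι = record
    { nonZero = NonZero-ι
    ; Ew≲w = ≲-⊕ 1≲ι ≲-refl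
    ; w≲Ew = ≲-pointwise (ev-always λ n → ≤-respˡ-≈ (sym (0≤x⇒∣x∣≈x (0≤ι n)))
        (≤-trans (ι-mono (ℕₚ.n≤1+n n)) (x≤∣x∣ _)))
    }

  Tame-ν : Tame ν
  Tame-ν = Tame-⁻ Tame-ι

  1⁻≋1 : K 1# ⁻ ≋ K 1#
  1⁻≋1 = pointwise λ n → ⁻¹-unique (*-identityˡ 1#)

  ν≲1 : ν ≲ K 1#
  ν≲1 = ≲-respʳ 1⁻≋1 (≲-⁻ (nonZero Tame-1) 1≲ι)

-- The calculus of symbols under finite differences.

module Symbols (em : ExcludedMiddle 0ℓ) (𝓡 : CompleteOrderedField) where
  open Reals em 𝓡
  open OrderedField em 𝓡
  open Exponential em 𝓡
  open Asymptotics em 𝓡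
  open RingSolver sequenceRing

  -- The number of controlled differences is an index so that closure properties are inductions on
  -- it: a further difference of a product or an inverse involves the factors only up to the
  -- previous level.
  data Symbolₙ : ℕ → Seq → Seq → Set where
    done : ∀ {w f} → f ≲ w → Symbolₙ 0 w f
    step : ∀ {k w f} → f ≲ w → Symbolₙ k (w ⊗ ν) (Δ f) → Symbolₙ (suc k) w f

  record Symbol (w f : Seq) : Set where
    constructor symbol
    field upTo : ∀ k → Symbolₙ k w f
  open Symbol public

  size : ∀ {k w f} → Symbolₙ k w f → f ≲ w
  size (done p)   = p
  size (step p _) = p

  Symbolₙ-pred : ∀ {k w f} → Symbolₙ (suc k) w f → Symbolₙ k w f
  Symbolₙ-pred {0}     (step p _) = done p
  Symbolₙ-pred {suc k} (step p q) = step p (Symbolₙ-pred q)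

  Symbolₙ-weaken : ∀ {k v w f} → v ≲ w → Symbolₙ k v f → Symbolₙ k w f
  Symbolₙ-weaken v≲w (done p)   = done (≲-trans p v≲w)
  Symbolₙ-weaken v≲w (step p q) = step (≲-trans p v≲w) (Symbolₙ-weaken (≲-⊗ʳ ν v≲w) q)

  Symbolₙ-cong : ∀ {k w f g} → f ≋ g → Symbolₙ k w f → Symbolₙ k w g
  Symbolₙ-cong eq (done p)   = done (≲-respˡ eq p)
  Symbolₙ-cong eq (step p q) = step (≲-respˡ eq p) (Symbolₙ-cong (Δ-cong eq) q)

  Δ-⊕ : ∀ f g → Δ (f ⊕ g) ≋ Δ f ⊕ Δ g
  Δ-⊕ f g = solve 4 (λ f g f′ g′ → (f′ :+ g′) :- (f :+ g) := (f′ :- f) :+ (g′ :- g)) Sq.refl f g (E f) (E g)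

  Δ-⊝ : ∀ f → Δ (⊝ f) ≋ ⊝ Δ f
  Δ-⊝ f = solve 2 (λ f f′ → (:- f′) :- (:- f) := :- (f′ :- f)) Sq.refl f (E f)

  Δ-⊗ : ∀ f g → Δ (f ⊗ g) ≋ Δ f ⊗ g ⊕ f ⊗ Δ g ⊕ Δ f ⊗ Δ g
  Δ-⊗ f g = solve 4 (λ f g f′ g′ → f′ :* g′ :- f :* g :=
    (f′ :- f) :* g :+ f :* (g′ :- g) :+ (f′ :- f) :* (g′ :- g)) Sq.refl f g (E f) (E g)

  Δ-K : ∀ c → Δ (K c) ≋ K 0#
  Δ-K c = pointwise λ n → -‿inverseʳ c

  Δ-⁻ : ∀ {f} → NonZero f → Δ (f ⁻) ≋ ⊝ (Δ f ⊗ (f ⁻ ⊗ E (f ⁻)))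
  Δ-⁻ {f} nz = begin
    E (f ⁻) ⊕ ⊝ f ⁻
      ≈⟨ solve 2 (λ h h′ → h′ :- h := h′ :* :1 :- h :* :1) Sq.refl (f ⁻) (E (f ⁻)) ⟩
    E (f ⁻) ⊗ K 1# ⊕ ⊝ (f ⁻ ⊗ K 1#)
      ≈⟨ Sq.+-cong (Sq.*-congˡ (Sq.sym (⁻-inverse nz))) (Sq.-‿cong (Sq.*-congˡ (Sq.sym (⁻-inverse {E f} (ev-suc nz))))) ⟩
    E (f ⁻) ⊗ (f ⊗ f ⁻) ⊕ ⊝ (f ⁻ ⊗ (E f ⊗ E (f ⁻)))
      ≈⟨ solve 4 (λ f f′ h h′ → h′ :* (f :* h) :- h :* (f′ :* h′) := :- ((f′ :- f) :* (h :* h′)))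
           Sq.refl f (E f) (f ⁻) (E (f ⁻)) ⟩
    ⊝ (Δ f ⊗ (f ⁻ ⊗ E (f ⁻))) ∎
    where open import Relation.Binary.Reasoning.Setoid Sq.setoid

  Symbolₙ-0 : ∀ {w} k → Symbolₙ k w (K 0#)
  Symbolₙ-0 0       = done ≲-0
  Symbolₙ-0 (suc k) = step ≲-0 (Symbolₙ-cong (Sq.sym (Δ-K 0#)) (Symbolₙ-0 k))

  Symbolₙ-⊕ : ∀ {k w f g} → Symbolₙ k w f → Symbolₙ k w g → Symbolₙ k w (f ⊕ g)
  Symbolₙ-⊕ (done p) (done q) = done (≲-⊕ p q)
  Symbolₙ-⊕ {f = f} {g} (step p ps) (step q qs) =
    step (≲-⊕ p q) (Symbolₙ-cong (Sq.sym (Δ-⊕ f g)) (Symbolₙ-⊕ ps qs))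

  Symbolₙ-⊝ : ∀ {k w f} → Symbolₙ k w f → Symbolₙ k w (⊝ f)
  Symbolₙ-⊝ (done p) = done (≲-⊝ p)
  Symbolₙ-⊝ {f = f} (step p ps) = step (≲-⊝ p) (Symbolₙ-cong (Sq.sym (Δ-⊝ f)) (Symbolₙ-⊝ ps))

  Symbolₙ-⊗ : ∀ {k u v f g} → Symbolₙ k u f → Symbolₙ k v g → Symbolₙ k (u ⊗ v) (f ⊗ g)
  Symbolₙ-⊗ (done p) (done q) = done (≲-⊗ p q)
  Symbolₙ-⊗ {u = u} {v} {f} {g} s@(step p ps) t@(step q qs) =
    step (≲-⊗ p q) (Symbolₙ-cong (Sq.sym (Δ-⊗ f g)) (Symbolₙ-⊕ (Symbolₙ-⊕
      (Symbolₙ-weaken (≋⇒≲ (solve 3 (λ u v n → u :* n :* v := u :* v :* n) Sq.refl u v ν))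
        (Symbolₙ-⊗ ps (Symbolₙ-pred t)))
      (Symbolₙ-weaken (≋⇒≲ (solve 3 (λ u v n → u :* (v :* n) := u :* v :* n) Sq.refl u v ν))
        (Symbolₙ-⊗ (Symbolₙ-pred s) qs)))
      -- The term `Δ f ⊗ Δ g`, absent from the Leibniz rule for derivatives, has a surplus factor
      -- `ν` in its weight.
      (Symbolₙ-weaken (≲-respˡ (solve 3 (λ u v n → n :* (u :* v :* n) := u :* n :* (v :* n)) Sq.refl u v ν)
        (≲-respʳ (Sq.*-identityˡ _) (≲-⊗ʳ (u ⊗ v ⊗ ν) ν≲1))) (Symbolₙ-⊗ ps qs))))

  Symbolₙ-E : ∀ {k w f} → Tame w → Symbolₙ k w f → Symbolₙ k w (E f)
  Symbolₙ-E tw (done p)   = done (≲-trans (≲-E p) (Ew≲w tw))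
  Symbolₙ-E tw (step p q) = step (≲-trans (≲-E p) (Ew≲w tw)) (Symbolₙ-E (Tame-⊗ tw Tame-ν) q)

  -- By Δ(1/f) = -Δf / (f · E f) one more difference of the inverse only needs the inverse at the
  -- previous level.
  Symbolₙ-⁻ : ∀ {k w f} → Tame w → w ≲ f → Symbolₙ k w f → Symbolₙ k (w ⁻) (f ⁻)
  Symbolₙ-⁻ tw w≲f (done p) = done (≲-⁻ (nonZero tw) w≲f)
  Symbolₙ-⁻ {w = w} tw w≲f s@(step p q) = step (≲-⁻ (nonZero tw) w≲f)
    (Symbolₙ-cong (Sq.sym (Δ-⁻ (NonZero-≲ (nonZero tw) w≲f))) (Symbolₙ-⊝
      (Symbolₙ-weaken (≋⇒≲ weight) (Symbolₙ-⊗ q (Symbolₙ-⊗ ih (Symbolₙ-E (Tame-⁻ tw) ih))))))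
    where
    ih = Symbolₙ-⁻ tw w≲f (Symbolₙ-pred s)
    weight : w ⊗ ν ⊗ (w ⁻ ⊗ w ⁻) ≋ w ⁻ ⊗ ν
    weight = Sq.trans (solve 3 (λ w n h → w :* n :* (h :* h) := w :* h :* (h :* n)) Sq.refl w ν (w ⁻))
      (Sq.trans (Sq.*-congʳ (⁻-inverse (nonZero tw))) (Sq.*-identityˡ _))

  Symbol-≲ : ∀ {w f} → Symbol w f → f ≲ w
  Symbol-≲ s = size (upTo s 0)

  Symbol-Δ : ∀ {w f} → Symbol w f → Symbol (w ⊗ ν) (Δ f)
  Symbol-Δ {w} {f} s = symbol λ k → tail (upTo s (suc k))
    where
    tail : ∀ {k} → Symbolₙ (suc k) w f → Symbolₙ k (w ⊗ ν) (Δ f)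
    tail (step _ q) = q

  Symbol-step : ∀ {w f} → f ≲ w → Symbol (w ⊗ ν) (Δ f) → Symbol w f
  Symbol-step p s = symbol λ where
    0       → done p
    (suc k) → step p (upTo s k)

  Symbol-weaken : ∀ {v w f} → v ≲ w → Symbol v f → Symbol w f
  Symbol-weaken p s = symbol λ k → Symbolₙ-weaken p (upTo s k)

  Symbol-cong : ∀ {w f g} → f ≋ g → Symbol w f → Symbol w g
  Symbol-cong p s = symbol λ k → Symbolₙ-cong p (upTo s k)

  Symbol-0 : ∀ {w} → Symbol w (K 0#)
  Symbol-0 = symbol Symbolₙ-0

  Symbol-⊕ : ∀ {w f g} → Symbol w f → Symbol w g → Symbol w (f ⊕ g)
  Symbol-⊕ s t = symbol λ k → Symbolₙ-⊕ (upTo s k) (upTo t k)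

  Symbol-⊝ : ∀ {w f} → Symbol w f → Symbol w (⊝ f)
  Symbol-⊝ s = symbol λ k → Symbolₙ-⊝ (upTo s k)

  Symbol-⊗ : ∀ {u v f g} → Symbol u f → Symbol v g → Symbol (u ⊗ v) (f ⊗ g)
  Symbol-⊗ s t = symbol λ k → Symbolₙ-⊗ (upTo s k) (upTo t k)

  Symbol-E : ∀ {w f} → Tame w → Symbol w f → Symbol w (E f)
  Symbol-E tw s = symbol λ k → Symbolₙ-E tw (upTo s k)

  Symbol-⁻ : ∀ {w f} → Tame w → w ≲ f → Symbol w f → Symbol (w ⁻) (f ⁻)
  Symbol-⁻ tw p s = symbol λ k → Symbolₙ-⁻ tw p (upTo s k)

  Symbol-K : ∀ c → Symbol (K 1#) (K c)
  Symbol-K c = Symbol-step (≲-K c) (Symbol-cong (Sq.sym (Δ-K c)) Symbol-0)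

  Symbol-ι : Symbol ι ι
  Symbol-ι = Symbol-step ≲-refl (Symbol-weaken (≋⇒≲ (Sq.sym ι⊗ν≋1)) (Symbol-cong
    (solve 1 (λ k → :1 := :1 :+ k :- k) Sq.refl ι) (Symbol-K 1#)))

  Symbol-ν : Symbol ν ν
  Symbol-ν = Symbol-⁻ Tame-ι ≲-refl Symbol-ι

-- Exponentials and logarithms of symbols, and the sequence log n.

module Logarithm (em : ExcludedMiddle 0ℓ) (𝓡 : CompleteOrderedField) where
  open Reals em 𝓡
  open OrderedField em 𝓡
  open Exponential em 𝓡
  open Asymptotics em 𝓡
  open Symbols em 𝓡
  private
    module P = RingSolver commutativeRing
    module S = RingSolver sequenceRing

  exp-1≤ : ∀ u → exp u - 1# ≤ u * exp u
  exp-1≤ u = ≤-by (0≤y-x (≤-respʳ-≈ (exp-neg u) (*-monoˡ-≤ (<⇒≤ (0<exp u)) (1+x≤exp (- u)))))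
    (P.solve 2 (λ u e → u P.:* e P.:- (e P.:- P.:1) P.:= P.:1 P.:- e P.:* (P.:1 P.:+ (P.:- u))) refl u (exp u))

  u≤exp-1 : ∀ u → u ≤ exp u - 1#
  u≤exp-1 u = ≤-by (0≤y-x (1+x≤exp u))
    (P.solve 2 (λ u e → (e P.:- P.:1) P.:- u P.:= e P.:- (P.:1 P.:+ u)) refl u (exp u))

  -- No derivative of `exp` enters: this and `∣u∣≤exp-1` come from 1 + u ≤ exp u, taken at `u` and
  -- at `- u`.
  ∣exp-1∣≤ : ∀ {u B} → ∣ u ∣ ≤ B → ∣ exp u - 1# ∣ ≤ exp B * ∣ u ∣
  ∣exp-1∣≤ {u} {B} ∣u∣≤B = ∣x∣≤
    (≤-trans (exp-1≤ u) (≤-respʳ-≈ (*-comm _ _) (≤-trans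
      (≤-by (*-nonNeg (<⇒≤ (0<exp u)) (0≤y-x (x≤∣x∣ u)))
        (P.solve 3 (λ u e a → a P.:* e P.:- u P.:* e P.:= e P.:* (a P.:- u)) refl u (exp u) ∣ u ∣))
      (*-monoˡ-≤ (0≤∣x∣ u) (exp-mono-≤ (≤-trans (x≤∣x∣ u) ∣u∣≤B))))))
    (≤-trans (neg-mono-≤ (u≤exp-1 u)) (≤-trans (-x≤∣x∣ u)
      (≤-respˡ-≈ (*-identityˡ _) (*-mono-≤ 0≤1 (0≤∣x∣ u) 1≤expB ≤-refl))))
    where
    1≤expB : 1# ≤ exp B
    1≤expB = ≤-respˡ-≈ exp0≈1 (exp-mono-≤ (≤-trans (0≤∣x∣ u) ∣u∣≤B))

  -- The upper bound for `u` costs the constant 1, the one for `- u` the constant `D`; the sum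
  -- covers both.
  ∣u∣≤exp-1 : ∀ {u D} → exp (- u) ≤ D → ∣ u ∣ ≤ (1# + D) * ∣ exp u - 1# ∣
  ∣u∣≤exp-1 {u} {D} e≤D = ∣x∣≤
    (≤-trans (u≤exp-1 u) (≤-trans (x≤∣x∣ _) (≤-by (*-nonNeg 0≤D (0≤∣x∣ (exp u - 1#)))
      (P.solve 2 (λ d a → (P.:1 P.:+ d) P.:* a P.:- a P.:= d P.:* a) refl D ∣ exp u - 1# ∣))))
    (≤-trans (u≤exp-1 (- u)) (≤-trans (≤-respˡ-≈ eq (*-mono-≤′ (-x≤∣x∣ (exp u - 1#))))
      (≤-by (0≤∣x∣ (exp u - 1#))
        (P.solve 2 (λ d a → (P.:1 P.:+ d) P.:* a P.:- d P.:* a P.:= a) refl D ∣ exp u - 1# ∣))))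
    where
    0≤D : 0# ≤ D
    0≤D = ≤-trans (<⇒≤ (0<exp (- u))) e≤D
    eq : exp (- u) * (- (exp u - 1#)) ≈ exp (- u) - 1#
    eq = trans (P.solve 2 (λ e f → f P.:* (P.:- (e P.:- P.:1)) P.:= f P.:- e P.:* f) refl (exp u) (exp (- u)))
      (+-congˡ (-‿cong (exp-neg u)))
    *-mono-≤′ : ∀ {x y} → x ≤ ∣ y ∣ → exp (- u) * x ≤ D * ∣ y ∣
    *-mono-≤′ {x} {y} x≤y = ≤-trans (*-monoˡ-≤ (<⇒≤ (0<exp (- u))) x≤y)
      (*-mono-≤ (<⇒≤ (0<exp (- u))) (0≤∣x∣ y) e≤D ≤-refl)

  exp∘ : Seq → Seq
  exp∘ u n = exp (u n)

  -- For bounded `u` this has the size of `u`, whereas `exp∘ u` only has size 1; symbol weights pass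
  -- through it in both directions.
  exp∘-1 : Seq → Seq
  exp∘-1 u = exp∘ u ⊕ ⊝ K 1#

  exp∘-cong : ∀ {u v} → u ≋ v → exp∘ u ≋ exp∘ v
  exp∘-cong p = eventually (ev-map (λ n → exp-cong) (ev p))

  exp∘-⊕ : ∀ u v → exp∘ (u ⊕ v) ≋ exp∘ u ⊗ exp∘ v
  exp∘-⊕ u v = pointwise λ n → exp-+ (u n) (v n)

  exp∘-⊝ : ∀ u → exp∘ u ⊗ exp∘ (⊝ u) ≋ K 1#
  exp∘-⊝ u = pointwise λ n → exp-neg (u n)

  exp∘-⊝-⁻ : ∀ u → exp∘ (⊝ u) ≋ exp∘ u ⁻
  exp∘-⊝-⁻ u = pointwise λ n → sym (⁻¹-unique (exp-neg (u n)))

  exp∘-Δ : ∀ u → exp∘ u ⊗ exp∘ (Δ u) ≋ E (exp∘ u)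
  exp∘-Δ u = Sq.trans (Sq.sym (exp∘-⊕ u (Δ u)))
    (exp∘-cong (S.solve 2 (λ u u′ → u S.:+ (u′ S.:- u) S.:= u′) Sq.refl u (E u)))

  NonZero-exp∘ : ∀ u → NonZero (exp∘ u)
  NonZero-exp∘ u = ev-always λ n → >⇒≉0 (0<exp (u n))

  exp∘≋exp∘-1⊕1 : ∀ u → exp∘-1 u ⊕ K 1# ≋ exp∘ u
  exp∘≋exp∘-1⊕1 u = S.solve 1 (λ e → e S.:- S.:1 S.:+ S.:1 S.:= e) Sq.refl (exp∘ u)

  exp∘-1≲ : ∀ {u} → u ≲ K 1# → exp∘-1 u ≲ u
  exp∘-1≲ (bounded C 0≤C p) = bounded (exp (C * ∣ 1# ∣)) (<⇒≤ (0<exp _)) (ev-map (λ n → ∣exp-1∣≤) p)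

  exp∘≲1 : ∀ {u} → u ≲ K 1# → exp∘ u ≲ K 1#
  exp∘≲1 {u} p = ≲-respˡ (exp∘≋exp∘-1⊕1 u) (≲-⊕ (≲-trans (exp∘-1≲ p) p) ≲-refl)

  1≲exp∘ : ∀ {u} → u ≲ K 1# → K 1# ≲ exp∘ u
  1≲exp∘ {u} p = ≲-cancelʳ (NonZero-exp∘ (⊝ u)) (≲-respˡ (Sq.sym (Sq.*-identityˡ _))
    (≲-respʳ (Sq.sym (exp∘-⊝ u)) (exp∘≲1 (≲-⊝ p))))

  ≲exp∘-1 : ∀ {u} → K 1# ≲ exp∘ u → u ≲ exp∘-1 u
  ≲exp∘-1 {u} p = let bounded C 0≤C q = ≲-respʳ 1⁻≋1 (≲-⁻ (nonZero Tame-1) p) in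
    bounded (1# + C * ∣ 1# ∣) (0≤x+y 0≤1 (*-nonNeg 0≤C (0≤∣x∣ 1#)))
    (ev-map (λ n q → ∣u∣≤exp-1 (≤-respˡ-≈ (⁻¹-unique (exp-neg (u n))) (≤-trans (x≤∣x∣ _) q))) q)

  -- Since Δ(exp u - 1) = exp u · (exp (Δu) - 1), the induction passes from `u` to `Δ u`, whose
  -- weight is again bounded.
  Symbolₙ-exp : ∀ {k v u} → v ≲ K 1# → Symbolₙ k v u → Symbolₙ k v (exp∘-1 u)
  Symbolₙ-exp v≲1 (done p) = done (≲-trans (exp∘-1≲ (≲-trans p v≲1)) p)
  Symbolₙ-exp {suc k} {v} {u} v≲1 s@(step p q) = step (≲-trans (exp∘-1≲ (≲-trans p v≲1)) p)
    (Symbolₙ-cong eq (Symbolₙ-weaken (≋⇒≲ (Sq.*-identityˡ _)) (Symbolₙ-⊗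
      (Symbolₙ-cong (exp∘≋exp∘-1⊕1 u)
        (Symbolₙ-⊕ (Symbolₙ-weaken v≲1 (Symbolₙ-exp v≲1 (Symbolₙ-pred s))) (upTo (Symbol-K 1#) k)))
      (Symbolₙ-exp (≲-respʳ (Sq.*-identityˡ _) (≲-⊗ v≲1 ν≲1)) q))))
    where
    eq : exp∘ u ⊗ exp∘-1 (Δ u) ≋ Δ (exp∘-1 u)
    eq = begin
      exp∘ u ⊗ (exp∘ (Δ u) ⊕ ⊝ K 1#)
        ≈⟨ S.solve 2 (λ e d → e S.:* (d S.:- S.:1) S.:= e S.:* d S.:- e) Sq.refl (exp∘ u) (exp∘ (Δ u)) ⟩
      exp∘ u ⊗ exp∘ (Δ u) ⊕ ⊝ exp∘ u
        ≈⟨ Sq.+-congʳ (exp∘-Δ u) ⟩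
      E (exp∘ u) ⊕ ⊝ exp∘ u
        ≈⟨ S.solve 2 (λ e e′ → e′ S.:- e S.:= (e′ S.:- S.:1) S.:- (e S.:- S.:1)) Sq.refl (exp∘ u) (E (exp∘ u)) ⟩
      Δ (exp∘-1 u) ∎
      where open import Relation.Binary.Reasoning.Setoid Sq.setoid

  -- The same identity read backwards: exp (Δu) - 1 is the difference of exp u - 1 divided by exp u,
  -- so the induction again passes to `Δ u`.
  Symbolₙ-log : ∀ {k v u} → v ≲ K 1# → K 1# ≲ exp∘ u → Symbolₙ k v (exp∘-1 u) → Symbolₙ k v u
  Symbolₙ-log v≲1 1≲e (done p) = done (≲-trans (≲exp∘-1 1≲e) p)
  Symbolₙ-log {suc k} {v} {u} v≲1 1≲e s@(step p q) = step (≲-trans (≲exp∘-1 1≲e) p)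
    (Symbolₙ-log (≲-respʳ (Sq.*-identityˡ _) (≲-⊗ v≲1 ν≲1)) 1≲exp∘Δ
      (Symbolₙ-cong eq (Symbolₙ-weaken (≋⇒≲ (Sq.trans (Sq.*-congˡ 1⁻≋1) (Sq.*-identityʳ _)))
        (Symbolₙ-⊗ q (Symbolₙ-⁻ Tame-1 1≲e e-symbol)))))
    where
    e-symbol : Symbolₙ k (K 1#) (exp∘ u)
    e-symbol = Symbolₙ-cong (exp∘≋exp∘-1⊕1 u)
      (Symbolₙ-⊕ (Symbolₙ-weaken v≲1 (Symbolₙ-pred s)) (upTo (Symbol-K 1#) k))
    nz : NonZero (exp∘ u)
    nz = NonZero-exp∘ u
    quotient : E (exp∘ u) ⊗ exp∘ u ⁻ ≋ exp∘ (Δ u)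
    quotient = Sq.trans (Sq.*-congʳ (Sq.sym (exp∘-Δ u)))
      (Sq.trans (S.solve 3 (λ e d h → e S.:* d S.:* h S.:= e S.:* h S.:* d) Sq.refl (exp∘ u) (exp∘ (Δ u)) (exp∘ u ⁻))
      (Sq.trans (Sq.*-congʳ (⁻-inverse nz)) (Sq.*-identityˡ _)))
    1≲exp∘Δ : K 1# ≲ exp∘ (Δ u)
    1≲exp∘Δ = ≲-respʳ quotient (≲-respˡ (Sq.*-identityˡ (K 1#)) (≲-⊗ (≲-E 1≲e)
      (≲-respˡ 1⁻≋1 (≲-⁻ nz (size e-symbol)))))
    eq : Δ (exp∘-1 u) ⊗ exp∘ u ⁻ ≋ exp∘-1 (Δ u)
    eq = begin
      Δ (exp∘-1 u) ⊗ exp∘ u ⁻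
        ≈⟨ S.solve 3 (λ e e′ h → ((e′ S.:- S.:1) S.:- (e S.:- S.:1)) S.:* h S.:= e′ S.:* h S.:- e S.:* h)
             Sq.refl (exp∘ u) (E (exp∘ u)) (exp∘ u ⁻) ⟩
      E (exp∘ u) ⊗ exp∘ u ⁻ ⊕ ⊝ (exp∘ u ⊗ exp∘ u ⁻)
        ≈⟨ Sq.+-cong quotient (Sq.-‿cong (⁻-inverse nz)) ⟩
      exp∘-1 (Δ u) ∎
      where open import Relation.Binary.Reasoning.Setoid Sq.setoid

  Symbol-exp : ∀ {v u} → v ≲ K 1# → Symbol v u → Symbol v (exp∘-1 u)
  Symbol-exp p s = symbol λ k → Symbolₙ-exp p (upTo s k)

  Symbol-log : ∀ {v u} → v ≲ K 1# → K 1# ≲ exp∘ u → Symbol v (exp∘-1 u) → Symbol v u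
  Symbol-log p q s = symbol λ k → Symbolₙ-log p q (upTo s k)

  -- All estimates on `L` below come from `exp∘-L`; `L-def` serves to translate the hypothesis of
  -- the theorem.
  abstract
    L : Seq
    L n = log (ι n)

    L-def : ∀ n → log (ι n) ≡ L n
    L-def n = ≡.refl

    exp∘-L : exp∘ L ≋ ι
    exp∘-L = eventually (ev-map (λ n → exp-log) ev-0<ι)

  ev-≤L : ∀ X → EventuallyNat (λ n → X ≤ L n)
  ev-≤L X = ev-map₂ (λ n eq eX≤n → exp-cancel-≤ (≤-respʳ-≈ (sym eq) eX≤n)) (ev exp∘-L) (ev-≤ι (exp X))

  1≲L : K 1# ≲ L
  1≲L = ≲-pointwise (ev-map (λ n 1≤L → ≤-respˡ-≈ (sym (0≤x⇒∣x∣≈x 0≤1)) (≤-trans 1≤L (x≤∣x∣ _))) (ev-≤L 1#))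

  -- Here exp (ΔL) = (n+1)/n = 1 + ν, and `ν` is a symbol.
  Symbol-ΔL : Symbol ν (Δ L)
  Symbol-ΔL = Symbol-log ν≲1 (≲-respʳ (Sq.sym exp∘ΔL) 1≲1⊕ν)
    (Symbol-cong (Sq.sym (Sq.trans (Sq.+-congʳ exp∘ΔL)
      (S.solve 1 (λ v → S.:1 S.:+ v S.:- S.:1 S.:= v) Sq.refl ν))) Symbol-ν)
    where
    exp∘ΔL : exp∘ (Δ L) ≋ K 1# ⊕ ν
    exp∘ΔL = begin
      exp∘ (Δ L)                     ≈⟨ Sq.*-identityʳ _ ⟨
      exp∘ (Δ L) ⊗ K 1#              ≈⟨ Sq.*-congˡ ι⊗ν≋1 ⟨
      exp∘ (Δ L) ⊗ (ι ⊗ ν)           ≈⟨ Sq.*-congˡ (Sq.*-congʳ exp∘-L) ⟨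
      exp∘ (Δ L) ⊗ (exp∘ L ⊗ ν)      ≈⟨ S.solve 3 (λ d e v → d S.:* (e S.:* v) S.:= e S.:* d S.:* v) Sq.refl _ _ ν ⟩
      exp∘ L ⊗ exp∘ (Δ L) ⊗ ν        ≈⟨ Sq.*-congʳ (exp∘-Δ L) ⟩
      E (exp∘ L) ⊗ ν                 ≈⟨ Sq.*-congʳ (E-cong exp∘-L) ⟩
      (K 1# ⊕ ι) ⊗ ν                 ≈⟨ S.solve 2 (λ i v → (S.:1 S.:+ i) S.:* v S.:= v S.:+ i S.:* v) Sq.refl ι ν ⟩
      ν ⊕ ι ⊗ ν                      ≈⟨ Sq.+-congˡ ι⊗ν≋1 ⟩
      ν ⊕ K 1#                       ≈⟨ Sq.+-comm _ _ ⟩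
      K 1# ⊕ ν                       ∎
      where open import Relation.Binary.Reasoning.Setoid Sq.setoid
    1≲1⊕ν : K 1# ≲ K 1# ⊕ ν
    1≲1⊕ν = ≲-pointwise (ev-map (λ n 0<ιn → ≤-respˡ-≈ (sym (0≤x⇒∣x∣≈x 0≤1)) (≤-trans
      (≤-by (<⇒≤ (0<x⁻¹ 0<ιn)) (P.solve 1 (λ h → P.:1 P.:+ h P.:- P.:1 P.:= h) refl (ι n ⁻¹))) (x≤∣x∣ _))) ev-0<ι)

  ΔL≲1 : Δ L ≲ K 1#
  ΔL≲1 = ≲-trans (Symbol-≲ Symbol-ΔL) ν≲1

  Tame-L : Tame L
  Tame-L = record
    { nonZero = NonZero-≲ (nonZero Tame-1) 1≲L
    ; Ew≲w = ≲-respˡ (S.solve 2 (λ l l′ → l S.:+ (l′ S.:- l) S.:= l′) Sq.refl L (E L))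
        (≲-⊕ ≲-refl (≲-trans ΔL≲1 1≲L))
    ; w≲Ew = ≲-respˡ (S.solve 2 (λ l l′ → l′ S.:+ (S.:- (l′ S.:- l)) S.:= l) Sq.refl L (E L))
        (≲-⊕ ≲-refl (≲-⊝ (≲-trans ΔL≲1 (≲-E 1≲L))))
    }

  μ : Seq
  μ = L ⁻

  Tame-μ : Tame μ
  Tame-μ = Tame-⁻ Tame-L

  L⊗μ≋1 : L ⊗ μ ≋ K 1#
  L⊗μ≋1 = ⁻-inverse (nonZero Tame-L)

  μ≲1 : μ ≲ K 1#
  μ≲1 = ≲-respʳ 1⁻≋1 (≲-⁻ (nonZero Tame-1) 1≲L)

  -- As log n is unbounded, a factor `μ` beats every constant. This is how domination with unknown
  -- constants is turned into actual inequalities.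
  ≲μ⇒small : ∀ {f g} → f ≲ μ ⊗ g → ∀ ε → 0# < ε → EventuallyNat (λ n → ∣ f n ∣ ≤ ε * ∣ g n ∣)
  ≲μ⇒small {f} {g} (bounded C 0≤C p) ε 0<ε = ev-map₂ (λ n q (C÷ε≤L , 1≤L) → small q C÷ε≤L (<-≤-trans 0<1 1≤L))
    p (ev-and (ev-≤L (C ÷ ε)) (ev-≤L 1#))
    where
    small : ∀ {n} → ∣ f n ∣ ≤ C * ∣ μ n * g n ∣ → C ÷ ε ≤ L n → 0# < L n → ∣ f n ∣ ≤ ε * ∣ g n ∣
    small {n} q C÷ε≤L 0<L = ≤-trans q (≤-respˡ-≈ eq (*-mono-≤
      (*-nonNeg 0≤C (<⇒≤ (0<x⁻¹ 0<L))) (0≤∣x∣ (g n))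
      (÷-≤ 0<L (≤-respˡ-≈ (sym (x≈y*x÷y (>⇒≉0 0<ε))) (*-monoˡ-≤ (<⇒≤ 0<ε) C÷ε≤L))) ≤-refl))
      where
      eq : C * μ n * ∣ g n ∣ ≈ C * ∣ μ n * g n ∣
      eq = trans (*-assoc _ _ _) (*-congˡ (trans (*-congʳ (sym (0≤x⇒∣x∣≈x (<⇒≤ (0<x⁻¹ 0<L))))) (sym (∣x*y∣≈∣x∣*∣y∣ _ _))))

  -- The perturbation is eventually at most ε times the weight, which leaves |w| ≤ C |f + g| + ½
  -- |w|; hence the constant C + C.
  ≲-absorb : ∀ {f g w} → w ≲ f → g ≲ μ ⊗ w → w ≲ f ⊕ g
  ≲-absorb {f} {g} {w} (bounded C 0≤C p) q = bounded (C + C) (0≤x+y 0≤C 0≤C)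
    (ev-map₂ absorb p (≲μ⇒small q ε 0<ε))
    where
    -- Chosen so that C ε ≤ ½; dividing by 1 + C rather than C also covers C = 0.
    ε = (1# + C) ⁻¹ * ½
    0<1+C = 0<x+y 0<1 0≤C
    0<ε : 0# < ε
    0<ε = 0<x*y (0<x⁻¹ 0<1+C) 0<½
    Cε≤½ : C * ε ≤ ½
    Cε≤½ = ≤-respˡ-≈ (*-assoc _ _ _) (≤-respʳ-≈ (*-identityˡ ½) (*-mono-≤ (*-nonNeg 0≤C (<⇒≤ (0<x⁻¹ 0<1+C))) (<⇒≤ 0<½)
      (÷-≤ 0<1+C (≤-by 0≤1 (P.solve 1 (λ c → P.:1 P.:* (P.:1 P.:+ c) P.:- c P.:= P.:1) refl C))) ≤-refl))
    absorb : ∀ n → ∣ w n ∣ ≤ C * ∣ f n ∣ → ∣ g n ∣ ≤ ε * ∣ w n ∣ → ∣ w n ∣ ≤ (C + C) * ∣ f n + g n ∣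
    absorb n w≤ g≤ = ≤-by (0≤x+y 0≤rest 0≤rest) (begin
      (C + C) * s - a
        ≈⟨ trans (+-congˡ (-‿cong (trans (sym (*-identityˡ a)) (*-congʳ (sym ½+½≈1)))))
             (P.solve 4 (λ C s a h → (C P.:+ C) P.:* s P.:- (h P.:+ h) P.:* a
               P.:= (C P.:* s P.:- h P.:* a) P.:+ (C P.:* s P.:- h P.:* a)) refl C s a ½) ⟩
      (C * s - ½ * a) + (C * s - ½ * a) ∎)
      where
      open ≈-Reasoning
      s = ∣ f n + g n ∣
      a = ∣ w n ∣
      f≤ : ∣ f n ∣ ≤ s + ∣ g n ∣
      f≤ = ≤-respˡ-≈ (∣-∣-cong (P.solve 2 (λ f g → f P.:+ g P.:+ (P.:- g) P.:= f) refl (f n) (g n)))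
        (≤-respʳ-≈ (+-congˡ (∣-x∣≈∣x∣ (g n))) (∣x+y∣≤∣x∣+∣y∣ (f n + g n) (- g n)))
      a≤Cs+½a : a ≤ C * s + ½ * a
      a≤Cs+½a = ≤-trans w≤ (≤-trans (*-monoˡ-≤ 0≤C (≤-trans f≤ (+-mono-≤ ≤-refl g≤)))
        (≤-respˡ-≈ (P.solve 4 (λ C s e a → C P.:* s P.:+ (C P.:* e) P.:* a P.:= C P.:* (s P.:+ e P.:* a)) refl C s ε a)
          (+-mono-≤ ≤-refl (*-mono-≤ (*-nonNeg 0≤C (<⇒≤ 0<ε)) (0≤∣x∣ (w n)) Cε≤½ ≤-refl))))
      0≤rest : 0# ≤ C * s - ½ * a
      0≤rest = ≤-respʳ-≈ (trans (+-congˡ (-‿cong (trans (sym (*-identityˡ a)) (*-congʳ (sym ½+½≈1)))))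
          (P.solve 3 (λ c h a → c P.:+ h P.:* a P.:- (h P.:+ h) P.:* a P.:= c P.:- h P.:* a) refl (C * s) ½ a))
        (0≤y-x a≤Cs+½a)

-- Powers of n, powers of log n, and rational functions of log n.

module LogarithmicScale (em : ExcludedMiddle 0ℓ) (𝓡 : CompleteOrderedField) where
  open Reals em 𝓡
  open OrderedField em 𝓡
  open Exponential em 𝓡
  open Asymptotics em 𝓡
  open Symbols em 𝓡
  open Logarithm em 𝓡
  private
    module P = RingSolver commutativeRing
  open RingSolver sequenceRing

  -- The power n^γ.
  ω : ℝ → Seq
  ω γ = exp∘ (K γ ⊗ L)

  ω-cong : ∀ {α β} → α ≈ β → ω α ≋ ω β
  ω-cong p = exp∘-cong (Sq.*-congʳ (pointwise λ n → p))

  ω-+ : ∀ α β → ω (α + β) ≋ ω α ⊗ ω β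
  ω-+ α β = Sq.trans (exp∘-cong (pointwise λ n → distribʳ _ _ _)) (exp∘-⊕ _ _)

  ω-0 : ω 0# ≋ K 1#
  ω-0 = pointwise λ n → trans (exp-cong (zeroˡ _)) exp0≈1

  ω-1 : ω 1# ≋ ι
  ω-1 = Sq.trans (exp∘-cong (Sq.*-identityˡ L)) exp∘-L

  ω-neg : ∀ α → ω (- α) ≋ ω α ⁻
  ω-neg α = Sq.trans (exp∘-cong (solve 2 (λ a l → (:- a) :* l := :- (a :* l)) Sq.refl (K α) L)) (exp∘-⊝-⁻ _)

  0<ω : ∀ γ n → 0# < ω γ n
  0<ω γ n = 0<exp _

  NonZero-ω : ∀ γ → NonZero (ω γ)
  NonZero-ω γ = NonZero-exp∘ _

  Symbol-γΔL : ∀ γ → Symbol ν (K γ ⊗ Δ L)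
  Symbol-γΔL γ = Symbol-weaken (≋⇒≲ (Sq.*-identityˡ ν)) (Symbol-⊗ (Symbol-K γ) Symbol-ΔL)

  Eω : ∀ γ → ω γ ⊗ exp∘ (K γ ⊗ Δ L) ≋ E (ω γ)
  Eω γ = Sq.trans (Sq.*-congˡ (exp∘-cong
      (solve 3 (λ g l l′ → g :* (l′ :- l) := g :* l′ :- g :* l) Sq.refl (K γ) L (E L)))) (exp∘-Δ _)

  -- The difference is n^γ (exp (γ ΔL) - 1), and `Symbol-exp` gives the second factor weight `ν`.
  Symbol-ω : ∀ γ → Symbol (ω γ) (ω γ)
  Symbol-ω γ = symbol go
    where
    Δω : ω γ ⊗ exp∘-1 (K γ ⊗ Δ L) ≋ Δ (ω γ)
    Δω = Sq.trans (solve 2 (λ w e → w :* (e :- :1) := w :* e :- w) Sq.refl _ _) (Sq.+-congʳ (Eω γ))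
    go : ∀ k → Symbolₙ k (ω γ) (ω γ)
    go 0       = done ≲-refl
    go (suc k) = step ≲-refl (Symbolₙ-cong Δω (Symbolₙ-⊗ (go k) (upTo (Symbol-exp ν≲1 (Symbol-γΔL γ)) k)))

  Tame-ω : ∀ γ → Tame (ω γ)
  Tame-ω γ = record
    { nonZero = NonZero-ω γ
    ; Ew≲w = ≲-respˡ (Eω γ) (≲-respʳ (Sq.*-identityʳ _) (≲-⊗ˡ (ω γ) (exp∘≲1 γΔL≲1)))
    ; w≲Ew = ≲-respʳ (Eω γ) (≲-respˡ (Sq.*-identityʳ _) (≲-⊗ˡ (ω γ) (1≲exp∘ γΔL≲1)))
    }
    where
    γΔL≲1 : K γ ⊗ Δ L ≲ K 1#
    γΔL≲1 = ≲-trans (Symbol-≲ (Symbol-γΔL γ)) ν≲1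

  Subpolynomial : Seq → Set
  Subpolynomial P = ∀ δ → 0# < δ → P ≲ ω δ

  Subpolynomial-⊗ : ∀ {P Q} → Subpolynomial P → Subpolynomial Q → Subpolynomial (P ⊗ Q)
  Subpolynomial-⊗ p q δ 0<δ = ≲-respʳ (Sq.trans (Sq.sym (ω-+ (δ * ½) (δ * ½)))
      (ω-cong (trans (sym (distribˡ _ _ _)) (trans (*-congˡ ½+½≈1) (*-identityʳ δ)))))
    (≲-⊗ (p (δ * ½) (0<x*y 0<δ 0<½)) (q (δ * ½) (0<x*y 0<δ 0<½)))

  0<L : EventuallyNat (λ n → 0# < L n)
  0<L = ev-map (λ n → <-≤-trans 0<1) (ev-≤L 1#)

  Subpolynomial-1 : Subpolynomial (K 1#)
  Subpolynomial-1 δ 0<δ = ≲-pointwise (ev-map (λ n 0<Ln → ≤-respˡ-≈ (sym (0≤x⇒∣x∣≈x 0≤1)) (≤-trans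
    (≤-trans (≤-by (<⇒≤ (0<x*y 0<δ 0<Ln)) (P.solve 1 (λ x → P.:1 P.:+ x P.:- P.:1 P.:= x) refl (δ * L n)))
      (1+x≤exp (δ * L n))) (x≤∣x∣ _))) 0<L)

  Subpolynomial-≲1 : ∀ {P} → P ≲ K 1# → Subpolynomial P
  Subpolynomial-≲1 p δ 0<δ = ≲-trans p (Subpolynomial-1 δ 0<δ)

  Subpolynomial-L : Subpolynomial L
  Subpolynomial-L δ 0<δ = bounded (δ ⁻¹) (<⇒≤ (0<x⁻¹ 0<δ)) (ev-map (λ n 0<Ln →
    ≤-respˡ-≈ (sym (0≤x⇒∣x∣≈x (<⇒≤ 0<Ln))) (*-cancelˡ-≤ 0<δ (≤-trans
      (≤-trans (≤-by 0≤1 (P.solve 1 (λ x → P.:1 P.:+ x P.:- x P.:= P.:1) refl (δ * L n))) (1+x≤exp (δ * L n)))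
      (≤-trans (x≤∣x∣ _) (≤-reflexive (trans (x≈y*x÷y (>⇒≉0 0<δ)) (*-congˡ (*-comm _ _)))))))) 0<L)

  -- Models products of powers of log n with exponents of either sign. As both `P` and its inverse
  -- are below every positive power of n, comparing n^α P with n^β Q only depends on α < β.
  record LogWeight (P : Seq) : Set where
    field
      tame : Tame P
      pos  : EventuallyNat (λ n → 0# < P n)
      sub  : Subpolynomial P
      sub⁻ : Subpolynomial (P ⁻)
  open LogWeight public

  LogWeight-1 : LogWeight (K 1#)
  LogWeight-1 = record { tame = Tame-1 ; pos = ev-always (λ n → 0<1) ; sub = Subpolynomial-1 ; sub⁻ = Subpolynomial-≲1 (≋⇒≲ 1⁻≋1) }

  LogWeight-L : LogWeight L
  LogWeight-L = record { tame = Tame-L ; pos = 0<L ; sub = Subpolynomial-L ; sub⁻ = Subpolynomial-≲1 μ≲1 }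

  Subpolynomial-≋ : ∀ {P Q} → P ≋ Q → Subpolynomial P → Subpolynomial Q
  Subpolynomial-≋ p s δ 0<δ = ≲-respˡ p (s δ 0<δ)

  ⁻-involutive : ∀ {f} → NonZero f → f ≋ f ⁻ ⁻
  ⁻-involutive nz = eventually (ev-map (λ n f≉0 → sym (⁻¹-unique (trans (*-comm _ _) (inverseʳ f≉0)))) nz)

  LogWeight-⊗ : ∀ {P Q} → LogWeight P → LogWeight Q → LogWeight (P ⊗ Q)
  LogWeight-⊗ {P} {Q} p q = record
    { tame = Tame-⊗ (tame p) (tame q)
    ; pos = ev-map₂ (λ n → 0<x*y) (pos p) (pos q)
    ; sub = Subpolynomial-⊗ (sub p) (sub q)
    ; sub⁻ = Subpolynomial-≋ (Sq.sym (⁻-⊗ P Q)) (Subpolynomial-⊗ (sub⁻ p) (sub⁻ q))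
    }

  LogWeight-⁻ : ∀ {P} → LogWeight P → LogWeight (P ⁻)
  LogWeight-⁻ p = record
    { tame = Tame-⁻ (tame p)
    ; pos = ev-map (λ n → 0<x⁻¹) (pos p)
    ; sub = sub⁻ p
    ; sub⁻ = Subpolynomial-≋ (⁻-involutive (nonZero (tame p))) (sub p)
    }

  LogWeight-μ : LogWeight μ
  LogWeight-μ = LogWeight-⁻ LogWeight-L

  ω⊗LogWeight-≲ : ∀ {α β P Q} → α < β → LogWeight P → LogWeight Q → ω α ⊗ P ≲ ω β ⊗ Q
  ω⊗LogWeight-≲ {α} {β} {P} {Q} α<β p q = ≲-respˡ lhs (≲-respʳ rhs
    (≲-⊗ˡ (ω α ⊗ Q) (Subpolynomial-⊗ (sub p) (sub⁻ q) (β - α) (0<y-x α<β))))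
    where
    lhs : ω α ⊗ Q ⊗ (P ⊗ Q ⁻) ≋ ω α ⊗ P
    lhs = Sq.trans (solve 4 (λ a q p h → a :* q :* (p :* h) := q :* h :* (a :* p)) Sq.refl (ω α) Q P (Q ⁻))
      (Sq.trans (Sq.*-congʳ (⁻-inverse (nonZero (tame q)))) (Sq.*-identityˡ _))
    rhs : ω α ⊗ Q ⊗ ω (β - α) ≋ ω β ⊗ Q
    rhs = Sq.trans (solve 3 (λ a q b → a :* q :* b := a :* b :* q) Sq.refl (ω α) Q (ω (β - α)))
      (Sq.*-congʳ (Sq.trans (Sq.sym (ω-+ α (β - α)))
        (ω-cong (P.solve 2 (λ a b → a P.:+ (b P.:- a) P.:= b) refl α β))))

  -- Each difference of a function of log n gains 1/(n log n), not only 1/n.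
  record LogSymbol (w f : Seq) : Set where
    constructor logSymbol
    field
      size′  : f ≲ w
      Δ-gain : Symbol (w ⊗ (μ ⊗ ν)) (Δ f)

    toSymbol : Symbol w f
    toSymbol = Symbol-step size′ (Symbol-weaken
      (≲-⊗ˡ w (≲-respʳ (Sq.*-identityˡ ν) (≲-⊗ʳ ν μ≲1))) Δ-gain)
  open LogSymbol public

  LogSymbol-weaken : ∀ {v w f} → v ≲ w → LogSymbol v f → LogSymbol w f
  LogSymbol-weaken v≲w s = logSymbol (≲-trans (size′ s) v≲w) (Symbol-weaken (≲-⊗ʳ _ v≲w) (Δ-gain s))

  LogSymbol-cong : ∀ {w f g} → f ≋ g → LogSymbol w f → LogSymbol w g
  LogSymbol-cong p s = logSymbol (≲-respˡ p (size′ s)) (Symbol-cong (Δ-cong p) (Δ-gain s))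

  LogSymbol-0 : ∀ {w} → LogSymbol w (K 0#)
  LogSymbol-0 = logSymbol ≲-0 (Symbol-cong (Sq.sym (Δ-K 0#)) Symbol-0)

  LogSymbol-K : ∀ c → LogSymbol (K 1#) (K c)
  LogSymbol-K c = logSymbol (≲-K c) (Symbol-cong (Sq.sym (Δ-K c)) Symbol-0)

  LogSymbol-L : LogSymbol L L
  LogSymbol-L = logSymbol ≲-refl (Symbol-weaken (≋⇒≲ eq) Symbol-ΔL)
    where
    eq : ν ≋ L ⊗ (μ ⊗ ν)
    eq = Sq.trans (Sq.trans (Sq.sym (Sq.*-identityˡ ν)) (Sq.*-congʳ (Sq.sym L⊗μ≋1))) (Sq.*-assoc _ _ _)

  LogSymbol-⊕ : ∀ {w f g} → LogSymbol w f → LogSymbol w g → LogSymbol w (f ⊕ g)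
  LogSymbol-⊕ {f = f} {g} s t = logSymbol (≲-⊕ (size′ s) (size′ t))
    (Symbol-cong (Sq.sym (Δ-⊕ f g)) (Symbol-⊕ (Δ-gain s) (Δ-gain t)))

  LogSymbol-⊗ : ∀ {u v f g} → LogSymbol u f → LogSymbol v g → LogSymbol (u ⊗ v) (f ⊗ g)
  LogSymbol-⊗ {u} {v} {f} {g} s t = logSymbol (≲-⊗ (size′ s) (size′ t))
    (Symbol-cong (Sq.sym (Δ-⊗ f g)) (Symbol-⊕ (Symbol-⊕
      (Symbol-weaken (≋⇒≲ (solve 3 (λ u v θ → u :* θ :* v := u :* v :* θ) Sq.refl u v (μ ⊗ ν)))
        (Symbol-⊗ (Δ-gain s) (toSymbol t)))
      (Symbol-weaken (≋⇒≲ (solve 3 (λ u v θ → u :* (v :* θ) := u :* v :* θ) Sq.refl u v (μ ⊗ ν)))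
        (Symbol-⊗ (toSymbol s) (Δ-gain t))))
      (Symbol-weaken (≲-respˡ (solve 3 (λ u v θ → θ :* (u :* v :* θ) := u :* θ :* (v :* θ)) Sq.refl u v (μ ⊗ ν))
        (≲-respʳ (Sq.*-identityˡ _) (≲-⊗ʳ (u ⊗ v ⊗ (μ ⊗ ν)) (≲-respʳ (Sq.*-identityˡ _) (≲-⊗ μ≲1 ν≲1)))))
        (Symbol-⊗ (Δ-gain s) (Δ-gain t)))))

  LogSymbol-⁻ : ∀ {w f} → Tame w → w ≲ f → LogSymbol w f → LogSymbol (w ⁻) (f ⁻)
  LogSymbol-⁻ {w} tw w≲f s = logSymbol (≲-⁻ (nonZero tw) w≲f)
    (Symbol-cong (Sq.sym (Δ-⁻ (NonZero-≲ (nonZero tw) w≲f))) (Symbol-⊝ (Symbol-weaken (≋⇒≲ weight)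
      (Symbol-⊗ (Δ-gain s) (Symbol-⊗ inv (Symbol-E (Tame-⁻ tw) inv))))))
    where
    inv = Symbol-⁻ tw w≲f (toSymbol s)
    weight : w ⊗ (μ ⊗ ν) ⊗ (w ⁻ ⊗ w ⁻) ≋ w ⁻ ⊗ (μ ⊗ ν)
    weight = Sq.trans (solve 3 (λ w n h → w :* n :* (h :* h) := w :* h :* (h :* n)) Sq.refl w (μ ⊗ ν) (w ⁻))
      (Sq.trans (Sq.*-congʳ (⁻-inverse (nonZero tw))) (Sq.*-identityˡ _))

  polySeq : List ℝ → Seq
  polySeq cs n = evalPoly cs (L n)

  -- The size of `f` is pinned from both sides: the lower bound is needed to divide by `f`, and
  -- later to bound `D` from below.
  record LogAsymptotic (f : Seq) : Set where
    field
      {weight}  : Seq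
      logWeight : LogWeight weight
      behaviour : LogSymbol weight f
      lower     : weight ≲ f
  open LogAsymptotic public

  private
    -- One step of Horner's scheme: since 1 ≲ `weight a`, the constant is smaller than the new
    -- weight `L ⊗ weight a` by a factor log n and is absorbed.
    LogAsymptotic-c⊕Lp : ∀ c {p} (a : LogAsymptotic p) → K 1# ≲ weight a → LogAsymptotic (K c ⊕ L ⊗ p)
    LogAsymptotic-c⊕Lp c a 1≲w = record
      { weight = L ⊗ weight a
      ; logWeight = LogWeight-⊗ LogWeight-L (logWeight a)
      ; behaviour = LogSymbol-⊕ (LogSymbol-weaken 1≲Lw (LogSymbol-K c)) (LogSymbol-⊗ LogSymbol-L (behaviour a))
      ; lower = ≲-respʳ (Sq.+-comm _ _) (≲-absorb (≲-⊗ˡ L (lower a)) (≲-trans (≲-K c) (≲-respʳ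
          (Sq.trans (Sq.sym (Sq.*-identityˡ _)) (Sq.trans (Sq.*-congʳ (Sq.trans (Sq.sym L⊗μ≋1) (Sq.*-comm _ _))) (Sq.*-assoc _ _ _))) 1≲w)))
      }
      where
      1≲Lw : K 1# ≲ L ⊗ weight a
      1≲Lw = ≲-respˡ (Sq.*-identityˡ _) (≲-⊗ 1≲L 1≲w)

  -- A polynomial either vanishes or has the size of its leading power of log n. The first
  -- alternative also records that no coefficient is nonzero, to contradict `den≉0`.
  polynomial-asymptotics : ∀ cs →
    ((∀ x → evalPoly cs x ≈ 0#) × ¬ Any (_≉ 0#) cs) ⊎ ∃ λ (a : LogAsymptotic (polySeq cs)) → K 1# ≲ weight a
  polynomial-asymptotics [] = inj₁ ((λ x → refl) , λ ())
  polynomial-asymptotics (c ∷ cs) with polynomial-asymptotics cs | em {c ≈ 0#}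
  ... | inj₁ (cs≈0 , ¬any) | yes c≈0 = inj₁
    ( (λ x → trans (+-cong c≈0 (trans (*-congˡ (cs≈0 x)) (zeroʳ x))) (+-identityʳ 0#))
    , λ where (here c≉0) → c≉0 c≈0 ; (there any) → ¬any any)
  ... | inj₁ (cs≈0 , _) | no c≉0 = inj₂ (record
      { logWeight = LogWeight-1
      ; behaviour = LogSymbol-cong (Sq.sym p≋c) (LogSymbol-K c)
      ; lower = ≲-respʳ (Sq.sym p≋c) (≲-respˡ (pointwise λ n → inverseʳ c≉0)
          (≲-respʳ (Sq.*-identityʳ (K c)) (≲-⊗ˡ (K c) (≲-K (c ⁻¹)))))
      } , ≲-refl)
    where
    p≋c : polySeq (c ∷ cs) ≋ K c
    p≋c = pointwise λ n → trans (+-congˡ (trans (*-congˡ (cs≈0 (L n))) (zeroʳ _))) (+-identityʳ c)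
  ... | inj₂ (a , 1≲w) | _ = inj₂
    (LogAsymptotic-c⊕Lp c a 1≲w
    , ≲-respˡ (Sq.*-identityˡ _) (≲-⊗ 1≲L 1≲w))

  LogAsymptotic-÷ : ∀ {f g} → LogAsymptotic f → LogAsymptotic g → LogAsymptotic (f ⊗ g ⁻)
  LogAsymptotic-÷ a b = record
    { logWeight = LogWeight-⊗ (logWeight a) (LogWeight-⁻ (logWeight b))
    ; behaviour = LogSymbol-⊗ (behaviour a) (LogSymbol-⁻ tame-b (lower b) (behaviour b))
    ; lower = ≲-⊗ (lower a) (≲-⁻ (NonZero-≲ (nonZero tame-b) (lower b)) (size′ (behaviour b)))
    }
    where tame-b = tame (logWeight b)

  ratSeq : RationalFunction → Seq
  ratSeq r n = eval r (L n)

  open RationalFunction using (num; den; den≉0)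

  den-asymptotics : ∀ r → LogAsymptotic (polySeq (den r))
  den-asymptotics r with polynomial-asymptotics (den r)
  ... | inj₁ (_ , ¬any) = ⊥-elim (¬any (den≉0 r))
  ... | inj₂ (a , _)    = a

  -- For the coefficients after the first, which may vanish identically; then weight 1 serves.
  rational-upper : ∀ r → ∃ λ P → LogWeight P × LogSymbol P (ratSeq r)
  rational-upper r with polynomial-asymptotics (num r)
  ... | inj₁ (num≈0 , _) = K 1# , LogWeight-1 ,
    LogSymbol-cong (pointwise λ n → sym (trans (*-congʳ (num≈0 (L n))) (zeroˡ _))) LogSymbol-0
  ... | inj₂ (a , _) = let q = LogAsymptotic-÷ a (den-asymptotics r) in weight q , logWeight q , behaviour q

  rational-asymptotics : ∀ r → EventuallyNat (λ n → ratSeq r n ≉ 0#) → LogAsymptotic (ratSeq r)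
  rational-asymptotics r r≉0 with polynomial-asymptotics (num r)
  ... | inj₁ (num≈0 , _) = ⊥-elim (ev-const (ev-map (λ n r≉0 → r≉0 (trans (*-congʳ (num≈0 (L n))) (zeroˡ _))) r≉0))
  ... | inj₂ (a , _) = LogAsymptotic-÷ a (den-asymptotics r)

  scaleP : ℝ → List ℝ → List ℝ
  scaleP c = map (c *_)

  evalPoly-scaleP : ∀ c ps x → evalPoly (scaleP c ps) x ≈ c * evalPoly ps x
  evalPoly-scaleP c []       x = sym (zeroʳ c)
  evalPoly-scaleP c (p ∷ ps) x = trans (+-congˡ (*-congˡ (evalPoly-scaleP c ps x)))
    (P.solve 4 (λ c p x v → c P.:* p P.:+ x P.:* (c P.:* v) P.:= c P.:* (p P.:+ x P.:* v)) refl c p x (evalPoly ps x))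

  subP : List ℝ → List ℝ → List ℝ
  subP []       qs       = scaleP (- 1#) qs
  subP (p ∷ ps) []       = p ∷ ps
  subP (p ∷ ps) (q ∷ qs) = (p - q) ∷ subP ps qs

  evalPoly-subP : ∀ ps qs x → evalPoly (subP ps qs) x ≈ evalPoly ps x - evalPoly qs x
  evalPoly-subP []       qs x = trans (evalPoly-scaleP (- 1#) qs x)
    (P.solve 1 (λ v → (P.:- P.:1) P.:* v P.:= P.:0 P.:- v) refl (evalPoly qs x))
  evalPoly-subP (p ∷ ps) [] x = P.solve 1 (λ v → v P.:= v P.:- P.:0) refl (evalPoly (p ∷ ps) x)
  evalPoly-subP (p ∷ ps) (q ∷ qs) x = trans (+-congˡ (*-congˡ (evalPoly-subP ps qs x)))
    (P.solve 5 (λ p q x v w → (p P.:- q) P.:+ x P.:* (v P.:- w) P.:= (p P.:+ x P.:* v) P.:- (q P.:+ x P.:* w))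
      refl p q x (evalPoly ps x) (evalPoly qs x))

  -- Keeps c - r among the rational functions, so that its exact size is known even when `r` tends
  -- to `c`.
  constant-minus : ℝ → RationalFunction → RationalFunction
  constant-minus c r = record { num = subP (scaleP c (den r)) (num r) ; den = den r ; den≉0 = den≉0 r }

  ratSeq-constant-minus : ∀ c r → ratSeq (constant-minus c r) ≋ K c ⊕ ⊝ ratSeq r
  ratSeq-constant-minus c r = eventually (ev-map (λ n den≉0 → begin
      evalPoly (subP (scaleP c (den r)) (num r)) (L n) ÷ d n
        ≈⟨ *-congʳ (trans (evalPoly-subP (scaleP c (den r)) (num r) (L n)) (+-congʳ (evalPoly-scaleP c (den r) (L n)))) ⟩
      (c * d n - evalPoly (num r) (L n)) ÷ d n
        ≈⟨ P.solve 4 (λ c d m h → (c P.:* d P.:- m) P.:* h P.:= c P.:* (d P.:* h) P.:- m P.:* h) refl c (d n) _ (d n ⁻¹) ⟩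
      c * (d n ÷ d n) - evalPoly (num r) (L n) ÷ d n
        ≈⟨ +-congʳ (trans (*-congˡ (inverseʳ den≉0)) (*-identityʳ c)) ⟩
      c - evalPoly (num r) (L n) ÷ d n ∎)
    (NonZero-≲ (nonZero (tame (logWeight a))) (lower a)))
    where
    open ≈-Reasoning
    a = den-asymptotics r
    d : Seq
    d = polySeq (den r)

-- One step of the dynamics: perturbation of the error, evolution of the main term.

module RatioDynamics (em : ExcludedMiddle 0ℓ) (𝓡 : CompleteOrderedField) where
  open Reals em 𝓡
  open OrderedField em 𝓡
  open Exponential em 𝓡
  open Asymptotics em 𝓡
  open Symbols em 𝓡
  open Logarithm em 𝓡
  open LogarithmicScale em 𝓡
  private
    module P = RingSolver commutativeRing
  open RingSolver sequenceRing
  open import Relation.Binary.Reasoning.Setoid Sq.setoid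

  -- A multiplicative second difference. Being multiplicative, it splits y/n² into an explicit
  -- factor and `ρ y`.
  ρ : Seq → Seq
  ρ x = x ⊗ E (E x) ⊗ (E x ⁻ ⊗ E x ⁻)

  next : Seq → Seq
  next x = (K 1# ⊕ E x) ⊗ (K 1# ⊕ E x) ⊗ ρ x ⊕ ⊝ K 1#

  next-cong : ∀ {x y} → x ≋ y → next x ≋ next y
  next-cong p = Sq.+-congʳ (Sq.*-cong (Sq.*-cong (Sq.+-congˡ p₁) (Sq.+-congˡ p₁))
    (Sq.*-cong (Sq.*-cong p (E-cong p₁)) (Sq.*-cong (⁻-cong p₁) (⁻-cong p₁))))
    where p₁ = E-cong p

  ρ-⊗ : ∀ f g → ρ (f ⊗ g) ≋ ρ f ⊗ ρ g
  ρ-⊗ f g = begin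
    ρ (f ⊗ g)
      ≈⟨ Sq.*-congˡ (Sq.*-cong (⁻-⊗ _ _) (⁻-⊗ _ _)) ⟩
    f ⊗ g ⊗ (E (E f) ⊗ E (E g)) ⊗ ((E f ⁻ ⊗ E g ⁻) ⊗ (E f ⁻ ⊗ E g ⁻))
      ≈⟨ solve 6 (λ f g f₂ g₂ h k → f :* g :* (f₂ :* g₂) :* (h :* k :* (h :* k))
           := f :* f₂ :* (h :* h) :* (g :* g₂ :* (k :* k))) Sq.refl f g (E (E f)) (E (E g)) (E f ⁻) (E g ⁻) ⟩
    ρ f ⊗ ρ g ∎

  ρ-≲ : ∀ {s w} → Tame w → s ≲ w → w ≲ s → ρ s ≲ K 1#
  ρ-≲ {s} {w} tw s≲w w≲s = ≲-respʳ eq (≲-⊗ (≲-⊗ s≲w (≲-trans (≲-E s₁≲w) (Ew≲w tw))) (≲-⊗ s₁⁻≲ s₁⁻≲))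
    where
    s₁≲w : E s ≲ w
    s₁≲w = ≲-trans (≲-E s≲w) (Ew≲w tw)
    s₁⁻≲ : E s ⁻ ≲ w ⁻
    s₁⁻≲ = ≲-⁻ (nonZero tw) (≲-trans (w≲Ew tw) (≲-E w≲s))
    eq : w ⊗ w ⊗ (w ⁻ ⊗ w ⁻) ≋ K 1#
    eq = Sq.trans (solve 2 (λ w h → w :* w :* (h :* h) := w :* h :* (w :* h)) Sq.refl w (w ⁻))
      (Sq.trans (Sq.*-cong (⁻-inverse (nonZero tw)) (⁻-inverse (nonZero tw))) (Sq.*-identityˡ _))

  -- With e = s u one has next (s + e) - next s =
  -- ρ s (((1 + E s + E e)² - (1 + E s)²) + (1 + E s + E e)² (ρ (1 + u) - 1)).
  next-perturb : ∀ {s e g w} → Tame g → g ≲ μ → Tame w → w ≲ K 1# → s ≲ w → w ≲ s → e ≲ g ⊗ w →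
                 next (s ⊕ e) ⊕ ⊝ next s ≲ g
  next-perturb {s} {e} {g} {w} tg g≲μ tw w≲1 s≲w w≲s e≲gw = ≲-respˡ (Sq.sym difference)
    (≲-respʳ (Sq.*-identityˡ g) (≲-⊗ (ρ-≲ tw s≲w w≲s) (≲-⊕ squares
      (≲-respʳ (Sq.trans (Sq.*-congʳ (Sq.*-identityˡ _)) (Sq.*-identityˡ g)) (≲-⊗ (≲-⊗ 1+x₁≲1 1+x₁≲1) σ≲g)))))
    where
    nz-s : NonZero s
    nz-s = NonZero-≲ (nonZero tw) w≲s
    g≲1 : g ≲ K 1#
    g≲1 = ≲-trans g≲μ μ≲1
    u v v⁻ σ : Seq
    u = e ⊗ s ⁻
    v = K 1# ⊕ u
    v⁻ = E v ⁻
    -- This is `ρ v - 1`; its numerator (1 + u) (1 + E E u) - (1 + E u)² is expanded so that every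
    -- term has a factor of size `g`.
    σ = (u ⊕ E (E u) ⊕ u ⊗ E (E u) ⊕ ⊝ (K 1# ⊕ K 1#) ⊗ E u ⊕ ⊝ (E u ⊗ E u)) ⊗ (v⁻ ⊗ v⁻)
    ws⁻≲1 : w ⊗ s ⁻ ≲ K 1#
    ws⁻≲1 = ≲-respʳ (⁻-inverse nz-s) (≲-⊗ʳ (s ⁻) w≲s)
    u≲g : u ≲ g
    u≲g = ≲-trans (≲-⊗ʳ (s ⁻) e≲gw) (≲-respˡ (Sq.sym (Sq.*-assoc _ _ _))
      (≲-respʳ (Sq.*-identityʳ g) (≲-⊗ˡ g ws⁻≲1)))
    u₁≲g : E u ≲ g
    u₁≲g = ≲-trans (≲-E u≲g) (Ew≲w tg)
    u₂≲g : E (E u) ≲ g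
    u₂≲g = ≲-trans (≲-E u₁≲g) (Ew≲w tg)
    -- The condition `g ≲ μ` makes `u` tend to 0, which keeps `v` away from zero.
    1≲v : K 1# ≲ v
    1≲v = ≲-absorb ≲-refl (≲-respʳ (Sq.sym (Sq.*-identityʳ μ)) (≲-trans u≲g g≲μ))
    v⁻≲1 : v⁻ ≲ K 1#
    v⁻≲1 = ≲-respʳ 1⁻≋1 (≲-⁻ (nonZero Tame-1) (≲-E 1≲v))
    g⊗≲ : ∀ {a b} → a ≲ g → b ≲ K 1# → a ⊗ b ≲ g
    g⊗≲ p q = ≲-respʳ (Sq.*-identityʳ g) (≲-⊗ p q)
    σ≲g : σ ≲ g
    σ≲g = g⊗≲ (≲-⊕ (≲-⊕ (≲-⊕ (≲-⊕ u≲g u₂≲g) (g⊗≲ u≲g (≲-trans u₂≲g g≲1)))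
        (≲-respˡ (Sq.*-comm _ _) (g⊗≲ u₁≲g (≲-⊝ (≲-⊕ ≲-refl ≲-refl))))) (≲-⊝ (g⊗≲ u₁≲g (≲-trans u₁≲g g≲1))))
      (≲-respʳ (Sq.*-identityˡ _) (≲-⊗ v⁻≲1 v⁻≲1))
    s₁≲1 : E s ≲ K 1#
    s₁≲1 = ≲-E (≲-trans s≲w w≲1)
    e₁≲g : E e ≲ g
    e₁≲g = ≲-trans (≲-E (≲-trans e≲gw (g⊗≲ ≲-refl w≲1))) (Ew≲w tg)
    1+x₁≲1 : K 1# ⊕ (E s ⊕ E e) ≲ K 1#
    1+x₁≲1 = ≲-⊕ ≲-refl (≲-⊕ s₁≲1 (≲-trans e₁≲g g≲1))
    squares : E e ⊗ (K 1# ⊕ E s ⊕ (K 1# ⊕ (E s ⊕ E e))) ≲ g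
    squares = g⊗≲ e₁≲g (≲-⊕ (≲-⊕ ≲-refl s₁≲1) 1+x₁≲1)
    s⊕e≋sv : s ⊕ e ≋ s ⊗ v
    s⊕e≋sv = Sq.sym (begin
      s ⊗ (K 1# ⊕ e ⊗ s ⁻)   ≈⟨ solve 3 (λ s e h → s :* (:1 :+ e :* h) := s :+ e :* (s :* h)) Sq.refl s e (s ⁻) ⟩
      s ⊕ e ⊗ (s ⊗ s ⁻)      ≈⟨ Sq.+-congˡ (Sq.trans (Sq.*-congˡ (⁻-inverse nz-s)) (Sq.*-identityʳ e)) ⟩
      s ⊕ e                  ∎)
    v₁v₁⁻≋1 : E v ⊗ v⁻ ≋ K 1#
    v₁v₁⁻≋1 = ⁻-inverse (ev-suc (NonZero-≲ (nonZero Tame-1) 1≲v))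
    ρv≋1+σ : ρ v ≋ K 1# ⊕ σ
    ρv≋1+σ = begin
      v ⊗ E (E v) ⊗ (v⁻ ⊗ v⁻)
        ≈⟨ solve 4 (λ u u₁ u₂ h → (:1 :+ u) :* (:1 :+ u₂) :* (h :* h)
             := (:1 :+ u₁) :* h :* ((:1 :+ u₁) :* h)
             :+ (u :+ u₂ :+ u :* u₂ :+ (:- (:1 :+ :1)) :* u₁ :- u₁ :* u₁) :* (h :* h)) Sq.refl u (E u) (E (E u)) v⁻ ⟩
      E v ⊗ v⁻ ⊗ (E v ⊗ v⁻) ⊕ σ
        ≈⟨ Sq.+-congʳ (Sq.trans (Sq.*-cong v₁v₁⁻≋1 v₁v₁⁻≋1) (Sq.*-identityˡ _)) ⟩
      K 1# ⊕ σ ∎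
    ρ[s⊕e] : ρ (s ⊕ e) ≋ ρ s ⊗ (K 1# ⊕ σ)
    ρ[s⊕e] = Sq.trans (Sq.*-cong (Sq.*-cong s⊕e≋sv (E-cong (E-cong s⊕e≋sv)))
        (Sq.*-cong (⁻-cong (E-cong s⊕e≋sv)) (⁻-cong (E-cong s⊕e≋sv))))
      (Sq.trans (ρ-⊗ s v) (Sq.*-congˡ ρv≋1+σ))
    x₁ : Seq
    x₁ = K 1# ⊕ (E s ⊕ E e)
    difference : next (s ⊕ e) ⊕ ⊝ next s ≋
      ρ s ⊗ (E e ⊗ (K 1# ⊕ E s ⊕ x₁) ⊕ x₁ ⊗ x₁ ⊗ σ)
    difference = Sq.trans (Sq.+-congʳ (Sq.+-congʳ (Sq.*-congˡ ρ[s⊕e])))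
      (solve 4 (λ r c s e → (:1 :+ (s :+ e)) :* (:1 :+ (s :+ e)) :* (r :* (:1 :+ c)) :- :1
          :- ((:1 :+ s) :* (:1 :+ s) :* r :- :1)
          := r :* (e :* (:1 :+ s :+ (:1 :+ (s :+ e))) :+ (:1 :+ (s :+ e)) :* (:1 :+ (s :+ e)) :* c))
        Sq.refl (ρ s) σ (E s) (E e))

  1≲1⊕ : ∀ {f} → EventuallyNat (λ n → 0# ≤ f n) → K 1# ≲ K 1# ⊕ f
  1≲1⊕ {f} 0≤f = ≲-pointwise (ev-map (λ n 0≤fn → ≤-respˡ-≈ (sym (0≤x⇒∣x∣≈x 0≤1)) (≤-trans
    (≤-by 0≤fn (P.solve 1 (λ w → P.:1 P.:+ w P.:- P.:1 P.:= w) refl (f n))) (x≤∣x∣ _))) 0≤f)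

  ≲1⊕ : ∀ {f} → EventuallyNat (λ n → 0# ≤ f n) → f ≲ K 1# ⊕ f
  ≲1⊕ {f} 0≤f = ≲-pointwise (ev-map (λ n 0≤fn → ≤-respˡ-≈ (sym (0≤x⇒∣x∣≈x 0≤fn)) (≤-trans
    (≤-by 0≤1 (P.solve 1 (λ w → P.:1 P.:+ w P.:- w P.:= P.:1) refl (f n))) (x≤∣x∣ _))) 0≤f)

  -- `W` is the explicit weight with the size of `D`. `M` is the size of τ - κ D, in which either
  -- term may dominate, and `δ` is what counts as negligible against `D`.
  record Setting : Set where
    field
      W D    : Seq
      Tame-W : Tame W
      0≤W    : EventuallyNat (λ n → 0# ≤ W n)
      0<D    : EventuallyNat (λ n → 0# < D n)
      W≲D    : W ≲ D
      D-symbol  : Symbol W D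

    M : Seq
    M = K 1# ⊕ W

    δ : Seq
    δ = W ⊗ μ

    field
      -- Where M / log n is bounded below this follows from `D-symbol`. Otherwise a gain is
      -- demanded, and one factor 1/log n suffices because M ≥ 1 eventually.
      ΔD-symbol : Symbol (W ⊗ (μ ⊗ (M ⊗ ν))) (Δ D)
      Mν≲δ      : M ⊗ ν ≲ δ
      MνMν≲δ    : M ⊗ ν ⊗ (M ⊗ ν) ≲ δ

  module Dynamics (setting : Setting) where
    open Setting setting public

    1≲M : K 1# ≲ M
    1≲M = 1≲1⊕ 0≤W

    W≲M : W ≲ M
    W≲M = ≲1⊕ 0≤W

    Tame-M : Tame M
    Tame-M = record
      { nonZero = NonZero-≲ (nonZero Tame-1) 1≲M
      ; Ew≲w = ≲-⊕ 1≲M (≲-trans (Ew≲w Tame-W) W≲M)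
      ; w≲Ew = ≲-⊕ (≲-E 1≲M) (≲-trans (w≲Ew Tame-W) (≲-E W≲M))
      }

    ≲-1⊗ : ∀ {f g} → g ≲ K 1# → f ⊗ g ≲ f
    ≲-1⊗ {f} p = ≲-respʳ (Sq.*-identityʳ f) (≲-⊗ˡ f p)

    δ≲W : δ ≲ W
    δ≲W = ≲-1⊗ μ≲1

    ν≲Mν : ν ≲ M ⊗ ν
    ν≲Mν = ≲-respˡ (Sq.*-identityˡ ν) (≲-⊗ʳ ν 1≲M)

    ν≲δ : ν ≲ δ
    ν≲δ = ≲-trans ν≲Mν Mν≲δ

    Mνν≲1 : M ⊗ (ν ⊗ ν) ≲ K 1#
    Mνν≲1 = ≲-cancelʳ (nonZero Tame-M) (≲-respˡ
      (solve 2 (λ m v → m :* v :* (m :* v) := m :* (v :* v) :* m) Sq.refl M ν)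
      (≲-respʳ (Sq.sym (Sq.*-identityˡ M)) (≲-trans MνMν≲δ (≲-trans δ≲W W≲M))))

    model : ℝ → ℝ → Seq
    model τ κ = K τ ⊕ ⊝ (K κ ⊗ D)

    record Near (τ κ : ℝ) (y : Seq) : Set where
      constructor near
      field error : Symbol δ (y ⊕ ⊝ model τ κ)
    open Near public

    -- The size of D/n², which will be n^(-α₁) up to powers of log n. Each step costs the error one
    -- such factor.
    w : Seq
    w = ν ⊗ ν ⊗ W

    Tame-w : Tame w
    Tame-w = Tame-⊗ (Tame-⊗ Tame-ν Tame-ν) Tame-W

    w≲1 : w ≲ K 1#
    w≲1 = ≲-trans (≲-respˡ (Sq.*-comm W (ν ⊗ ν)) (≲-⊗ʳ (ν ⊗ ν) W≲M)) Mνν≲1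

    module _ {τ κ : ℝ} {y : Seq} (y-near : Near τ κ y) where

      private
        g : Seq
        g = y ⊕ ⊝ model τ κ
        y≋ : model τ κ ⊕ g ≋ y
        y≋ = solve 2 (λ y m → m :+ (y :- m) := y) Sq.refl y (model τ κ)
        K⊗ : ∀ {v f} → Symbol v f → Symbol v (K κ ⊗ f)
        K⊗ s = Symbol-weaken (≋⇒≲ (Sq.*-identityˡ _)) (Symbol-⊗ (Symbol-K κ) s)

      Near⇒Symbol : Symbol M y
      Near⇒Symbol = Symbol-cong y≋ (Symbol-⊕ (Symbol-⊕ (Symbol-weaken 1≲M (Symbol-K τ))
        (Symbol-⊝ (K⊗ (Symbol-weaken W≲M D-symbol)))) (Symbol-weaken (≲-trans δ≲W W≲M) (error y-near)))

      private
        Δy : ∀ {v} → Symbol v (Δ D) → δ ⊗ ν ≲ v → Symbol v (Δ y)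
        Δy s p = Symbol-cong
          (solve 6 (λ t k d d′ y y′ → (:- (k :* (d′ :- d)))
              :+ ((y′ :- (t :- k :* d′)) :- (y :- (t :- k :* d))) := y′ :- y)
            Sq.refl (K τ) (K κ) D (E D) y (E y))
          (Symbol-⊕ (Symbol-⊝ (K⊗ s)) (Symbol-weaken p (Symbol-Δ (error y-near))))

      Near⇒SymbolΔ : Symbol (W ⊗ ν) (Δ y)
      Near⇒SymbolΔ = Δy (Symbol-Δ D-symbol) (≲-⊗ʳ ν δ≲W)

      Near⇒SymbolΔ′ : Symbol (W ⊗ (μ ⊗ (M ⊗ ν))) (Δ y)
      Near⇒SymbolΔ′ = Δy ΔD-symbol (≲-respˡ (Sq.sym (Sq.*-assoc _ _ _)) (≲-⊗ˡ W (≲-⊗ˡ μ ν≲Mν)))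

      -- Half of κ D pays for the error, which is smaller than `D` by a factor log n.
      Near⇒≤ : 0# < κ → EventuallyNat (λ n → y n ≤ τ - κ * ½ * D n)
      Near⇒≤ 0<κ = ev-map₂ (λ n g≤ 0<Dn → ≤-by
          (0≤y-x (≤-trans (x≤∣x∣ (g n)) (≤-respʳ-≈ (*-congˡ (0≤x⇒∣x∣≈x (<⇒≤ 0<Dn))) g≤)))
          (trans (P.solve 5 (λ t k h d y → (t P.:- k P.:* h P.:* d) P.:- y
                   P.:= (k P.:* (P.:1 P.:- h) P.:* d) P.:- (y P.:- (t P.:- k P.:* d))) refl τ κ ½ (D n) (y n))
            (+-congʳ (*-congʳ (*-congˡ 1-½≈½)))))
        (≲μ⇒small (≲-trans (Symbol-≲ (error y-near)) (≲-respˡ (Sq.*-comm μ W) (≲-⊗ˡ μ W≲D))) (κ * ½) (0<x*y 0<κ 0<½))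
        0<D

      module _ (0<κ : 0# < κ) (τ<0 : τ < 0#) where

        -- By `Near⇒≤`, - y is at least - τ plus half of κ D, so strict negativity of τ bounds 1 and
        -- positivity of κ bounds `D`. This lower bound is what permits division by `y` in the next
        -- step.
        M≲y : M ≲ y
        M≲y = ≲-⊕ 1≲y (≲-trans W≲D D≲y)
          where
          y-lower : EventuallyNat (λ n → 0# - τ + κ * ½ * D n ≤ ∣ y n ∣)
          y-lower = ev-map (λ n y≤ → ≤-trans (≤-by (0≤y-x y≤)
            (P.solve 3 (λ t d y → (P.:- y) P.:- (P.:0 P.:- t P.:+ d) P.:= (t P.:- d) P.:- y) refl τ (κ * ½ * D n) (y n)))
            (-x≤∣x∣ (y n))) (Near⇒≤ 0<κ)
          0<-τ : 0# < 0# - τ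
          0<-τ = 0<y-x τ<0
          0<κ½ : 0# < κ * ½
          0<κ½ = 0<x*y 0<κ 0<½
          1≲y : K 1# ≲ y
          1≲y = bounded ((0# - τ) ⁻¹) (<⇒≤ (0<x⁻¹ 0<-τ)) (ev-map₂ (λ n 0<Dn lo →
            ≤-respˡ-≈ (sym (0≤x⇒∣x∣≈x 0≤1)) (≤-respˡ-≈ (trans (*-comm _ _) (inverseʳ (>⇒≉0 0<-τ)))
              (*-monoˡ-≤ (<⇒≤ (0<x⁻¹ 0<-τ)) (≤-trans (≤-by (*-nonNeg (<⇒≤ 0<κ½) (<⇒≤ 0<Dn))
                (P.solve 2 (λ t d → t P.:+ d P.:- t P.:= d) refl (0# - τ) (κ * ½ * D n))) lo)))) 0<D y-lower)
          D≲y : D ≲ y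
          D≲y = bounded ((κ * ½) ⁻¹) (<⇒≤ (0<x⁻¹ 0<κ½)) (ev-map₂ (λ n 0<Dn lo →
            ≤-respˡ-≈ (sym (0≤x⇒∣x∣≈x (<⇒≤ 0<Dn))) (≤-respˡ-≈ (trans (sym (*-assoc _ _ _))
                (trans (*-congʳ (trans (*-comm _ _) (inverseʳ (>⇒≉0 0<κ½)))) (*-identityˡ _)))
              (*-monoˡ-≤ (<⇒≤ (0<x⁻¹ 0<κ½)) (≤-trans (≤-by (<⇒≤ 0<-τ)
                (P.solve 2 (λ t d → t P.:+ d P.:- d P.:= t) refl (0# - τ) (κ * ½ * D n))) lo)))) 0<D y-lower)

      y₁ ν₁ ν₂ : Seq
      y₁ = E y
      ν₁ = E ν
      ν₂ = E (E ν)

      private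
        ν₁-symbol : Symbol ν ν₁
        ν₁-symbol = Symbol-E Tame-ν Symbol-ν
        ν₂-symbol : Symbol ν ν₂
        ν₂-symbol = Symbol-E Tame-ν ν₁-symbol
        y₁-symbol : Symbol M y₁
        y₁-symbol = Symbol-E Tame-M Near⇒Symbol
        ι₁ν₁≋1 : (K 1# ⊕ ι) ⊗ ν₁ ≋ K 1#
        ι₁ν₁≋1 = E-cong ι⊗ν≋1
        ι₂ν₂≋1 : (K 1# ⊕ (K 1# ⊕ ι)) ⊗ ν₂ ≋ K 1#
        ι₂ν₂≋1 = E-cong ι₁ν₁≋1

      -- From n/(n+1) = 1 - ν₁ the shift of y/n² differs from it, after multiplication by n², by
      -- terms of weight M/n only. It serves in the recursion and again for the index shift of the
      -- initial expansion.
      shift-symbol : Symbol δ (ι ⊗ ι ⊗ E (ν ⊗ ν ⊗ y) ⊕ ⊝ y)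
      shift-symbol = Symbol-cong (Sq.sym eq) (Symbol-⊕
        (Symbol-weaken (≲-trans (≲-⊗ʳ ν W≲M) Mν≲δ) Near⇒SymbolΔ)
        (Symbol-weaken (≲-trans (≲-1⊗ ≲-refl) (≲-respˡ (Sq.*-comm M ν) Mν≲δ)) (Symbol-⊗ (Symbol-⊗ ν₁-symbol y₁-symbol)
          (Symbol-⊕ (Symbol-weaken ν≲1 ν₁-symbol) (Symbol-⊝ (Symbol-⊕ (Symbol-K 1#) (Symbol-K 1#)))))))
        where
        eq : ι ⊗ ι ⊗ E (ν ⊗ ν ⊗ y) ⊕ ⊝ y ≋ Δ y ⊕ ν₁ ⊗ y₁ ⊗ (ν₁ ⊕ ⊝ (K 1# ⊕ K 1#))
        eq = begin
          ι ⊗ ι ⊗ (ν₁ ⊗ ν₁ ⊗ y₁) ⊕ ⊝ y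
            ≈⟨ solve 4 (λ i v y y′ → i :* i :* (v :* v :* y′) :- y
                 := ((:1 :+ i) :* v :- v) :* ((:1 :+ i) :* v :- v) :* y′ :- y) Sq.refl ι ν₁ y y₁ ⟩
          ((K 1# ⊕ ι) ⊗ ν₁ ⊕ ⊝ ν₁) ⊗ ((K 1# ⊕ ι) ⊗ ν₁ ⊕ ⊝ ν₁) ⊗ y₁ ⊕ ⊝ y
            ≈⟨ Sq.+-congʳ (Sq.*-congʳ (Sq.*-cong (Sq.+-congʳ ι₁ν₁≋1) (Sq.+-congʳ ι₁ν₁≋1))) ⟩
          (K 1# ⊕ ⊝ ν₁) ⊗ (K 1# ⊕ ⊝ ν₁) ⊗ y₁ ⊕ ⊝ y
            ≈⟨ solve 3 (λ v y y′ → (:1 :- v) :* (:1 :- v) :* y′ :- y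
                 := (y′ :- y) :+ v :* y′ :* (v :- (:1 :+ :1))) Sq.refl ν₁ y y₁ ⟩
          Δ y ⊕ ν₁ ⊗ y₁ ⊗ (ν₁ ⊕ ⊝ (K 1# ⊕ K 1#)) ∎

      module _ (M≲y : M ≲ y) where

        private
          M≲y₁ : M ≲ y₁
          M≲y₁ = ≲-trans (w≲Ew Tame-M) (≲-E M≲y)
          y₁⁻ : Seq
          y₁⁻ = y₁ ⁻
          y₁⁻-symbol : Symbol (M ⁻) y₁⁻
          y₁⁻-symbol = Symbol-⁻ Tame-M M≲y₁ y₁-symbol
          y₁y₁⁻≋1 : y₁ ⊗ y₁⁻ ≋ K 1#
          y₁y₁⁻≋1 = ⁻-inverse (NonZero-≲ (nonZero Tame-M) M≲y₁)
          MM⁻≋1 : M ⊗ M ⁻ ≋ K 1#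
          MM⁻≋1 = ⁻-inverse (nonZero Tame-M)

          p q s s₁ t y′ : Seq
          -- This is `ρ ν - 1`, that is 1/(n (n+2)). It enters squared as (1 + p)², which produces
          -- the summand 2 in y ↦ 2 y + 2.
          p = ν ⊗ ν₂
          q = ρ y ⊕ ⊝ K 1#
          s = ν ⊗ ν ⊗ y
          s₁ = ν₁ ⊗ ν₁ ⊗ y₁
          t = s₁ ⊕ p ⊕ s₁ ⊗ p
          y′ = ι ⊗ ι ⊗ next s

        -- Here ρ y - 1 = (y₁ Δ²y - Δy · E(Δy)) / y₁². In each product one factor is estimated
        -- through `Near⇒SymbolΔ′`; both then have weight M² δ/n², and M² cancels against y₁².
        q-symbol : Symbol (δ ⊗ (ν ⊗ ν)) (ρ y ⊕ ⊝ K 1#)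
        q-symbol = Symbol-cong (Sq.sym eq) (Symbol-weaken (≋⇒≲ weight≋) (Symbol-⊗
          (Symbol-⊕
            (Symbol-weaken (≋⇒≲ (solve 4 (λ m w u v → m :* (w :* (u :* (m :* v)) :* v)
                := m :* m :* (w :* u :* (v :* v))) Sq.refl M W μ ν))
              (Symbol-⊗ y₁-symbol (Symbol-Δ Near⇒SymbolΔ′)))
            (Symbol-⊝ (Symbol-weaken (≲-respˡ
                (solve 4 (λ m w u v → w :* (m :* (w :* u :* (v :* v)))
                  := w :* v :* (w :* (u :* (m :* v)))) Sq.refl M W μ ν)
                (≲-respʳ (Sq.sym (Sq.*-assoc _ _ _)) (≲-⊗ʳ (M ⊗ (δ ⊗ (ν ⊗ ν))) W≲M)))
              (Symbol-⊗ Near⇒SymbolΔ (Symbol-E Tame-v Near⇒SymbolΔ′)))))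
          (Symbol-⊗ y₁⁻-symbol y₁⁻-symbol)))
          where
          Tame-v : Tame (W ⊗ (μ ⊗ (M ⊗ ν)))
          Tame-v = Tame-⊗ Tame-W (Tame-⊗ Tame-μ (Tame-⊗ Tame-M Tame-ν))
          weight≋ : M ⊗ M ⊗ (δ ⊗ (ν ⊗ ν)) ⊗ (M ⁻ ⊗ M ⁻) ≋ δ ⊗ (ν ⊗ ν)
          weight≋ = Sq.trans (solve 3 (λ m d h → m :* m :* d :* (h :* h) := m :* h :* (m :* h) :* d) Sq.refl M (δ ⊗ (ν ⊗ ν)) (M ⁻))
            (Sq.trans (Sq.*-congʳ (Sq.trans (Sq.*-cong MM⁻≋1 MM⁻≋1) (Sq.*-identityˡ _))) (Sq.*-identityˡ _))
          eq : ρ y ⊕ ⊝ K 1# ≋ (y₁ ⊗ Δ (Δ y) ⊕ ⊝ (Δ y ⊗ E (Δ y))) ⊗ (y₁⁻ ⊗ y₁⁻)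
          eq = begin
            y ⊗ E y₁ ⊗ (y₁⁻ ⊗ y₁⁻) ⊕ ⊝ K 1#
              ≈⟨ Sq.+-congˡ (Sq.-‿cong (Sq.trans (Sq.sym (Sq.*-identityˡ _)) (Sq.sym (Sq.*-cong y₁y₁⁻≋1 y₁y₁⁻≋1)))) ⟩
            y ⊗ E y₁ ⊗ (y₁⁻ ⊗ y₁⁻) ⊕ ⊝ (y₁ ⊗ y₁⁻ ⊗ (y₁ ⊗ y₁⁻))
              ≈⟨ solve 4 (λ a b c h → a :* c :* (h :* h) :- b :* h :* (b :* h)
                   := (b :* ((c :- b) :- (b :- a)) :- (b :- a) :* (c :- b)) :* (h :* h)) Sq.refl y y₁ (E y₁) y₁⁻ ⟩
            (y₁ ⊗ Δ (Δ y) ⊕ ⊝ (Δ y ⊗ E (Δ y))) ⊗ (y₁⁻ ⊗ y₁⁻) ∎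

        private
          ν₁⁻≋ι₁ : ν₁ ⁻ ≋ K 1# ⊕ ι
          ν₁⁻≋ι₁ = Sq.sym (⁻-involutive (ev-suc NonZero-ι))

          νν₂ι₁ι₁≋1+p : ν ⊗ ν₂ ⊗ ((K 1# ⊕ ι) ⊗ (K 1# ⊕ ι)) ≋ K 1# ⊕ p
          νν₂ι₁ι₁≋1+p = begin
            ν ⊗ ν₂ ⊗ ((K 1# ⊕ ι) ⊗ (K 1# ⊕ ι))
              ≈⟨ solve 3 (λ v v₂ i → v :* v₂ :* ((:1 :+ i) :* (:1 :+ i))
                   := i :* v :* ((:1 :+ (:1 :+ i)) :* v₂) :+ v :* v₂) Sq.refl ν ν₂ ι ⟩
            ι ⊗ ν ⊗ ((K 1# ⊕ (K 1# ⊕ ι)) ⊗ ν₂) ⊕ ν ⊗ ν₂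
              ≈⟨ Sq.+-congʳ (Sq.trans (Sq.*-cong ι⊗ν≋1 ι₂ν₂≋1) (Sq.*-identityˡ _)) ⟩
            K 1# ⊕ p ∎

          ρs : ρ s ≋ (K 1# ⊕ p) ⊗ (K 1# ⊕ p) ⊗ (K 1# ⊕ q)
          ρs = begin
            ρ (ν ⊗ ν ⊗ y)
              ≈⟨ Sq.trans (ρ-⊗ (ν ⊗ ν) y) (Sq.*-congʳ (ρ-⊗ ν ν)) ⟩
            ρ ν ⊗ ρ ν ⊗ ρ y
              ≈⟨ Sq.*-cong (Sq.*-cong ρν ρν) (solve 1 (λ r → r := :1 :+ (r :- :1)) Sq.refl (ρ y)) ⟩
            (K 1# ⊕ p) ⊗ (K 1# ⊕ p) ⊗ (K 1# ⊕ q) ∎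
            where
            ρν : ρ ν ≋ K 1# ⊕ p
            ρν = Sq.trans (Sq.*-congˡ (Sq.*-cong ν₁⁻≋ι₁ ν₁⁻≋ι₁)) νν₂ι₁ι₁≋1+p

          ιιp : ι ⊗ ι ⊗ p ⊕ ⊝ K 1# ≋ ⊝ (ν₂ ⊕ ν₂)
          ιιp = begin
            ι ⊗ ι ⊗ (ν ⊗ ν₂) ⊕ ⊝ K 1#
              ≈⟨ solve 3 (λ i v v₂ → i :* i :* (v :* v₂) :- :1 := i :* v :* ((:1 :+ (:1 :+ i)) :* v₂ :- (v₂ :+ v₂)) :- :1)
                   Sq.refl ι ν ν₂ ⟩
            ι ⊗ ν ⊗ ((K 1# ⊕ (K 1# ⊕ ι)) ⊗ ν₂ ⊕ ⊝ (ν₂ ⊕ ν₂)) ⊕ ⊝ K 1#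
              ≈⟨ Sq.+-congʳ (Sq.*-cong ι⊗ν≋1 (Sq.+-congʳ ι₂ν₂≋1)) ⟩
            K 1# ⊗ (K 1# ⊕ ⊝ (ν₂ ⊕ ν₂)) ⊕ ⊝ K 1#
              ≈⟨ solve 1 (λ v → :1 :* (:1 :- v) :- :1 := :- v) Sq.refl (ν₂ ⊕ ν₂) ⟩
            ⊝ (ν₂ ⊕ ν₂) ∎

          -- next s = 2 t + t² + q (1 + t)² with 1 + t = (1 + E s) (1 + p).
          y′-expansion : y′ ⊕ ⊝ (y ⊕ y ⊕ (K 1# ⊕ K 1#)) ≋
            (ι ⊗ ι ⊗ s₁ ⊕ ⊝ y) ⊕ (ι ⊗ ι ⊗ s₁ ⊕ ⊝ y) ⊕ (⊝ (ν₂ ⊕ ν₂) ⊕ ⊝ (ν₂ ⊕ ν₂))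
              ⊕ (ι ⊗ ι ⊗ s₁ ⊗ p ⊕ ι ⊗ ι ⊗ s₁ ⊗ p) ⊕ ι ⊗ ι ⊗ (t ⊗ t) ⊕ ι ⊗ ι ⊗ (q ⊗ ((K 1# ⊕ t) ⊗ (K 1# ⊕ t)))
          y′-expansion = begin
            ι ⊗ ι ⊗ next s ⊕ ⊝ (y ⊕ y ⊕ (K 1# ⊕ K 1#))
              ≈⟨ Sq.+-congʳ (Sq.*-congˡ (Sq.+-congʳ (Sq.*-congˡ ρs))) ⟩
            ι ⊗ ι ⊗ ((K 1# ⊕ s₁) ⊗ (K 1# ⊕ s₁) ⊗ ((K 1# ⊕ p) ⊗ (K 1# ⊕ p) ⊗ (K 1# ⊕ q)) ⊕ ⊝ K 1#)
              ⊕ ⊝ (y ⊕ y ⊕ (K 1# ⊕ K 1#))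
              ≈⟨ solve 5 (λ i s p q y →
                   i :* i :* ((:1 :+ s) :* (:1 :+ s) :* ((:1 :+ p) :* (:1 :+ p) :* (:1 :+ q)) :- :1)
                     :- (y :+ y :+ (:1 :+ :1))
                   := (i :* i :* s :- y) :+ (i :* i :* s :- y) :+ ((i :* i :* p :- :1) :+ (i :* i :* p :- :1))
                     :+ (i :* i :* s :* p :+ i :* i :* s :* p)
                     :+ i :* i :* ((s :+ p :+ s :* p) :* (s :+ p :+ s :* p))
                     :+ i :* i :* (q :* ((:1 :+ (s :+ p :+ s :* p)) :* (:1 :+ (s :+ p :+ s :* p)))))
                   Sq.refl ι s₁ p q y ⟩
            (ι ⊗ ι ⊗ s₁ ⊕ ⊝ y) ⊕ (ι ⊗ ι ⊗ s₁ ⊕ ⊝ y) ⊕ ((ι ⊗ ι ⊗ p ⊕ ⊝ K 1#) ⊕ (ι ⊗ ι ⊗ p ⊕ ⊝ K 1#))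
              ⊕ (ι ⊗ ι ⊗ s₁ ⊗ p ⊕ ι ⊗ ι ⊗ s₁ ⊗ p) ⊕ ι ⊗ ι ⊗ (t ⊗ t) ⊕ ι ⊗ ι ⊗ (q ⊗ ((K 1# ⊕ t) ⊗ (K 1# ⊕ t)))
              ≈⟨ Sq.+-congʳ (Sq.+-congʳ (Sq.+-congʳ (Sq.+-congˡ (Sq.+-cong ιιp ιιp)))) ⟩
            (ι ⊗ ι ⊗ s₁ ⊕ ⊝ y) ⊕ (ι ⊗ ι ⊗ s₁ ⊕ ⊝ y) ⊕ (⊝ (ν₂ ⊕ ν₂) ⊕ ⊝ (ν₂ ⊕ ν₂))
              ⊕ (ι ⊗ ι ⊗ s₁ ⊗ p ⊕ ι ⊗ ι ⊗ s₁ ⊗ p) ⊕ ι ⊗ ι ⊗ (t ⊗ t) ⊕ ι ⊗ ι ⊗ (q ⊗ ((K 1# ⊕ t) ⊗ (K 1# ⊕ t))) ∎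

          s₁-symbol : Symbol (ν ⊗ ν ⊗ M) s₁
          s₁-symbol = Symbol-⊗ (Symbol-⊗ ν₁-symbol ν₁-symbol) y₁-symbol
          p-symbol : Symbol (ν ⊗ ν) p
          p-symbol = Symbol-⊗ Symbol-ν ν₂-symbol
          νν≲1 : ν ⊗ ν ≲ K 1#
          νν≲1 = ≲-trans (≲-1⊗ ν≲1) ν≲1
          t-symbol : Symbol (ν ⊗ ν ⊗ M) t
          t-symbol = Symbol-⊕ (Symbol-⊕ s₁-symbol
              (Symbol-weaken (≲-respˡ (Sq.*-identityʳ _) (≲-⊗ˡ (ν ⊗ ν) 1≲M)) p-symbol))
            (Symbol-weaken (≲-1⊗ νν≲1) (Symbol-⊗ s₁-symbol p-symbol))
          1+t-symbol : Symbol (K 1#) (K 1# ⊕ t)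
          1+t-symbol = Symbol-⊕ (Symbol-K 1#)
            (Symbol-weaken (≲-respˡ (Sq.*-comm M (ν ⊗ ν)) Mνν≲1) t-symbol)
          ιιs₁-symbol : Symbol M (ι ⊗ ι ⊗ s₁)
          ιιs₁-symbol = Symbol-cong (solve 2 (λ z y → (z :- y) :+ y := z) Sq.refl (ι ⊗ ι ⊗ s₁) y)
            (Symbol-⊕ (Symbol-weaken (≲-trans δ≲W W≲M) shift-symbol) Near⇒Symbol)
          ιιs₁p-symbol : Symbol δ (ι ⊗ ι ⊗ s₁ ⊗ p)
          ιιs₁p-symbol = Symbol-weaken (≲-respˡ (Sq.*-assoc _ _ _) (≲-trans (≲-1⊗ ν≲1) Mν≲δ)) (Symbol-⊗ ιιs₁-symbol p-symbol)
          ιι-symbol : ∀ {v f} → Symbol (v ⊗ (ν ⊗ ν)) f → Symbol v (ι ⊗ ι ⊗ f)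
          ιι-symbol {v} s = Symbol-weaken (≋⇒≲ (Sq.trans
              (solve 3 (λ i v n → i :* i :* (v :* (n :* n)) := i :* n :* (i :* n) :* v) Sq.refl ι v ν)
              (Sq.trans (Sq.*-congʳ (Sq.trans (Sq.*-cong ι⊗ν≋1 ι⊗ν≋1) (Sq.*-identityˡ _))) (Sq.*-identityˡ _))))
            (Symbol-⊗ (Symbol-⊗ Symbol-ι Symbol-ι) s)

        -- The term n² t² has weight (M/n)² and is covered by `MνMν≲δ`, the one with `q` by
        -- `q-symbol`; all others are of size at most M/n and covered by `Mν≲δ`.
        y′-symbol : Symbol δ (ι ⊗ ι ⊗ next (ν ⊗ ν ⊗ y) ⊕ ⊝ (y ⊕ y ⊕ (K 1# ⊕ K 1#)))
        y′-symbol = Symbol-cong (Sq.sym y′-expansion) (Symbol-⊕ (Symbol-⊕ (Symbol-⊕ (Symbol-⊕ (Symbol-⊕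
            shift-symbol shift-symbol) (Symbol-⊕ ν₂ν₂ ν₂ν₂)) (Symbol-⊕ ιιs₁p-symbol ιιs₁p-symbol))
            (Symbol-weaken MνMν≲δ (ιι-symbol (Symbol-weaken
              (≋⇒≲ (solve 2 (λ v m → v :* v :* m :* (v :* v :* m) := m :* v :* (m :* v) :* (v :* v)) Sq.refl ν M))
              (Symbol-⊗ t-symbol t-symbol)))))
            (ιι-symbol (Symbol-weaken (≲-1⊗ (≲-1⊗ ≲-refl)) (Symbol-⊗ q-symbol (Symbol-⊗ 1+t-symbol 1+t-symbol)))))
          where
          ν₂ν₂ : Symbol δ (⊝ (ν₂ ⊕ ν₂))
          ν₂ν₂ = Symbol-weaken ν≲δ (Symbol-⊝ (Symbol-⊕ ν₂-symbol ν₂-symbol))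

        Near-next : Near (τ + τ + (1# + 1#)) (κ + κ) (ι ⊗ ι ⊗ next (ν ⊗ ν ⊗ y))
        Near-next = near (Symbol-cong
          (solve 5 (λ y y′ t k d → (y′ :- (y :+ y :+ (:1 :+ :1))) :+ ((y :- (t :- k :* d)) :+ (y :- (t :- k :* d)))
              := y′ :- ((t :+ t :+ (:1 :+ :1)) :- (k :+ k) :* d)) Sq.refl y y′ (K τ) (K κ) D)
          (Symbol-⊕ y′-symbol (Symbol-⊕ (error y-near) (error y-near))))

    ννιι : ∀ f → ν ⊗ ν ⊗ (ι ⊗ ι ⊗ f) ≋ f
    ννιι f = Sq.trans (solve 3 (λ n i f → n :* n :* (i :* i :* f) := i :* n :* (i :* n) :* f) Sq.refl ν ι f)
      (Sq.trans (Sq.*-congʳ (Sq.trans (Sq.*-cong ι⊗ν≋1 ι⊗ν≋1) (Sq.*-identityˡ _))) (Sq.*-identityˡ _))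

-- Iterating the step, and positivity of the iterates of φ.

module Iterates (em : ExcludedMiddle 0ℓ) (𝓡 : CompleteOrderedField) where
  open Reals em 𝓡
  open OrderedField em 𝓡
  open Exponential em 𝓡
  open Asymptotics em 𝓡
  open Symbols em 𝓡
  open Logarithm em 𝓡
  open LogarithmicScale em 𝓡
  open RatioDynamics em 𝓡
  private
    module P = RingSolver commutativeRing
  open RingSolver sequenceRing
  open import Relation.Binary.Reasoning.Setoid Sq.setoid

  deviation : Seq → Seq
  deviation a = a ⊗ E (E a) ⊗ (E a ⊗ E a) ⁻ ⊕ ⊝ K 1#

  φ-deviation : ∀ {a} → NonZero a → φ a ≋ ⊝ (E a ⊗ E a ⊗ deviation a)
  φ-deviation {a} nz = begin
    φ a
      ≈⟨ pointwise (λ n → P.solve 3 (λ a b c → b P.:* (b P.:* P.:1) P.:- a P.:* c P.:= b P.:* b P.:- a P.:* c P.:* P.:1)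
           refl (a n) (a (suc n)) (a (suc (suc n)))) ⟩
    E a ⊗ E a ⊕ ⊝ (a ⊗ E (E a) ⊗ K 1#)
      ≈⟨ Sq.+-congˡ (Sq.-‿cong (Sq.*-congˡ (⁻-inverse {E a ⊗ E a} (NonZero-⊗ nz₁ nz₁)))) ⟨
    E a ⊗ E a ⊕ ⊝ (a ⊗ E (E a) ⊗ (E a ⊗ E a ⊗ (E a ⊗ E a) ⁻))
      ≈⟨ solve 4 (λ a b c h → b :* b :- a :* c :* (b :* b :* h) := :- (b :* b :* (a :* c :* h :- :1)))
           Sq.refl a (E a) (E (E a)) ((E a ⊗ E a) ⁻) ⟩
    ⊝ (E a ⊗ E a ⊗ deviation a) ∎
    where nz₁ = ev-suc nz

  deviation-φ : ∀ {a} → NonZero a → deviation (φ a) ≋ next (deviation a)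
  deviation-φ {a} nz = begin
    deviation (φ a)
      ≈⟨ Sq.+-congʳ (Sq.*-cong (Sq.*-cong eq₀ eq₂) (⁻-cong (Sq.*-cong eq₁ eq₁))) ⟩
    ⊝ (a₁ ⊗ a₁ ⊗ x) ⊗ ⊝ (a₃ ⊗ a₃ ⊗ x₂) ⊗ (⊝ (a₂ ⊗ a₂ ⊗ x₁) ⊗ ⊝ (a₂ ⊗ a₂ ⊗ x₁)) ⁻ ⊕ ⊝ K 1#
      ≈⟨ Sq.+-congʳ (Sq.*-congˡ (Sq.trans (⁻-cong (solve 2 (λ b x →
           (:- (b :* x)) :* (:- (b :* x)) := b :* b :* (x :* x)) Sq.refl (a₂ ⊗ a₂) x₁))
           (Sq.trans (⁻-⊗ _ _) (Sq.*-cong (⁻-⊗ _ _) (⁻-⊗ _ _))))) ⟩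
    ⊝ (a₁ ⊗ a₁ ⊗ x) ⊗ ⊝ (a₃ ⊗ a₃ ⊗ x₂) ⊗ (h ⊗ h ⊗ (x₁ ⁻ ⊗ x₁ ⁻)) ⊕ ⊝ K 1#
      ≈⟨ solve 6 (λ a₁ a₃ h x x₂ k →
           (:- (a₁ :* a₁ :* x)) :* (:- (a₃ :* a₃ :* x₂)) :* (h :* h :* (k :* k)) :- :1
           := (:1 :+ (a₁ :* a₃ :* h :- :1)) :* (:1 :+ (a₁ :* a₃ :* h :- :1)) :* (x :* x₂ :* (k :* k)) :- :1)
           Sq.refl a₁ a₃ h x x₂ (x₁ ⁻) ⟩
    next x ∎
    where
    x a₁ a₂ a₃ x₁ x₂ h : Seq
    x = deviation a
    a₁ = E a
    a₂ = E a₁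
    a₃ = E a₂
    x₁ = E x
    x₂ = E x₁
    h = (a₂ ⊗ a₂) ⁻
    eq₀ : φ a ≋ ⊝ (a₁ ⊗ a₁ ⊗ x)
    eq₀ = φ-deviation nz
    eq₁ : E (φ a) ≋ ⊝ (a₂ ⊗ a₂ ⊗ x₁)
    eq₁ = E-cong eq₀
    eq₂ : E (E (φ a)) ≋ ⊝ (a₃ ⊗ a₃ ⊗ x₂)
    eq₂ = E-cong eq₁

  φ-positive : ∀ {a} → NonZero a → EventuallyNat (λ n → deviation a n < 0#) → EventuallyNat (λ n → 0# < φ a n)
  φ-positive {a} nz neg = ev-map₂ (λ n (eq , a≉0) x<0 → <-respʳ-≈ (sym eq) (<-respʳ-≈
      (P.solve 2 (λ s x → s P.:* (P.:0 P.:- x) P.:= P.:- (s P.:* x)) refl (a (suc n) * a (suc n)) (deviation a n))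
      (0<x*y (0≤x*x _ , λ 0≈aa → *-≉0 a≉0 a≉0 (sym 0≈aa)) (0<y-x x<0))))
    (ev-and (ev (φ-deviation nz)) (ev-suc nz)) neg

  -- `iterate` applies `φ` on the inside, so the induction replaces both sequences by their images
  -- and must range over all pairs.
  iterate-φ-shift : ∀ N k {a b : Seq} → (∀ n → b n ≈ a (N ℕ.+ n)) → ∀ n → iterate φ b k n ≈ iterate φ a k (N ℕ.+ n)
  iterate-φ-shift N zero    b≈a = b≈a
  iterate-φ-shift N (suc k) {a} {b} b≈a = iterate-φ-shift N k λ n →
    let b₁≈a₁ = λ n → trans (b≈a (suc n)) (reflexive (≡.cong a (ℕₚ.+-suc N n)))
        b₂≈a₂ = trans (b₁≈a₁ (suc n)) (reflexive (≡.cong (λ k → a (suc k)) (ℕₚ.+-suc N n)))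
    in +-cong (^-cong 2 (b₁≈a₁ n)) (-‿cong (*-cong (b≈a n) b₂≈a₂))

  module Iteration (setting : Setting) where
    open Dynamics setting

    w^_ : ℕ → Seq
    w^ zero  = K 1#
    w^ suc i = w ⊗ w^ i

    Tame-w^ : ∀ i → Tame (w^ i)
    Tame-w^ zero    = Tame-1
    Tame-w^ (suc i) = Tame-⊗ Tame-w (Tame-w^ i)

    w^≲1 : ∀ i → w^ i ≲ K 1#
    w^≲1 zero    = ≲-refl
    w^≲1 (suc i) = ≲-respʳ (Sq.*-identityˡ _) (≲-⊗ w≲1 (w^≲1 i))

    -- The bound on τ says that τ ≤ 0 still holds after i further steps τ ↦ 2τ + 2.
    record State (i : ℕ) (x : Seq) : Set where
      field
        τ κ           : ℝ
        y e           : Seq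
        decomposition : x ≋ ν ⊗ ν ⊗ y ⊕ e
        y-near        : Near τ κ y
        0<κ           : 0# < κ
        τ-bound       : ι 2 ^ i * (τ + ι 2) ≤ ι 2
        e-small       : e ≲ μ ⊗ w^ suc i

    1≤2^ : ∀ i → 1# ≤ ι 2 ^ i
    1≤2^ zero    = ≤-refl
    1≤2^ (suc i) = ≤-respˡ-≈ (*-identityˡ 1#) (*-mono-≤ 0≤1 0≤1
      (≤-by 0≤1 (P.solve 0 ((P.:1 P.:+ (P.:1 P.:+ P.:0)) P.:- P.:1 P.:= P.:1) refl)) (1≤2^ i))

    cancel-2^ : ∀ i {x y} → 0# ≤ y → ι 2 ^ i * x ≤ y → x ≤ y
    cancel-2^ i {x} {y} 0≤y 2ⁱx≤y with total 0# x
    ... | inj₁ 0≤x = ≤-trans (≤-respˡ-≈ (*-identityˡ x) (*-mono-≤ 0≤1 0≤x (1≤2^ i) ≤-refl)) 2ⁱx≤y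
    ... | inj₂ x≤0 = ≤-trans x≤0 0≤y

    -- Of the main term κ D/n², half is spent in `Near⇒≤` and a quarter on `e`; the last quarter
    -- gives strictness, which matters when τ = 0.
    State⇒negative : ∀ {i x} → State i x → EventuallyNat (λ n → x n < 0#)
    State⇒negative {i} {x} st = ev-map₂ (λ n (eq , y≤ , 0<Dn) (e≤ , 0<ιn) → negative eq y≤ 0<Dn e≤ (0<x⁻¹ 0<ιn))
      (ev-and (ev decomposition) (ev-and (Near⇒≤ y-near 0<κ) 0<D))
      (ev-and (≲μ⇒small e≲ (κ * ½ * ½) (0<x*y (0<x*y 0<κ 0<½) 0<½)) ev-0<ι)
      where
      open State st
      τ≤0 : τ ≤ 0#
      τ≤0 = ≤-by (0≤y-x (cancel-2^ i (0≤ι 2) τ-bound))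
        (P.solve 2 (λ t c → P.:0 P.:- t P.:= c P.:- (t P.:+ c)) refl τ (ι 2))
      e≲ : e ≲ μ ⊗ (ν ⊗ ν ⊗ D)
      e≲ = ≲-trans e-small (≲-⊗ˡ μ (≲-trans (≲-1⊗ (w^≲1 i)) (≲-⊗ˡ (ν ⊗ ν) W≲D)))
      negative : ∀ {n} → x n ≈ ν n * ν n * y n + e n → y n ≤ τ - κ * ½ * D n → 0# < D n →
                 ∣ e n ∣ ≤ κ * ½ * ½ * ∣ ν n * ν n * D n ∣ → 0# < ν n → x n < 0#
      negative {n} eq y≤ 0<Dn e≤ 0<ν = <-respˡ-≈ (sym eq) (<-by
        (0<x+y (0<x*y (0<x*y (0<x*y 0<κ 0<½) 0<½) 0<vvD)
          (0≤x+y (*-nonNeg (<⇒≤ 0<vv) (0≤x+y (0≤y-x y≤) (0≤y-x τ≤0)))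
            (0≤y-x (≤-trans (x≤∣x∣ (e n)) (≤-respʳ-≈ (*-congˡ (0≤x⇒∣x∣≈x (<⇒≤ 0<vvD))) e≤)))))
        (trans (expand (ν n * ν n) (y n) (e n) κ ½ (D n) τ) (+-congʳ (*-congʳ (*-congˡ 1-½≈½)))))
        where
        0<vv : 0# < ν n * ν n
        0<vv = 0<x*y 0<ν 0<ν
        0<vvD : 0# < ν n * ν n * D n
        0<vvD = 0<x*y 0<vv 0<Dn
        expand : ∀ v y e k h d t → 0# - (v * y + e) ≈
          k * h * (1# - h) * (v * d) + (v * ((t - k * h * d - y) + (0# - t)) + (k * h * h * (v * d) - e))
        expand = P.solve 7 (λ v y e k h d t → P.:0 P.:- (v P.:* y P.:+ e) P.:=
          k P.:* h P.:* (P.:1 P.:- h) P.:* (v P.:* d) P.:+ (v P.:* ((t P.:- k P.:* h P.:* d P.:- y) P.:+ (P.:0 P.:- t))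
            P.:+ (k P.:* h P.:* h P.:* (v P.:* d) P.:- e))) refl

    -- What propagates is the relative error `e / s`, so one power of `w` is spent. The quantity τ +
    -- 2 doubles, which uses up one factor 2 in `τ-bound`.
    State-next : ∀ {i x} → State (suc i) x → State i (next x)
    State-next {i} {x} st = record
      { τ = τ + τ + (1# + 1#)
      ; κ = κ + κ
      ; y = ι ⊗ ι ⊗ next s
      ; e = next (s ⊕ e) ⊕ ⊝ next s
      ; decomposition = Sq.trans (next-cong decomposition)
          (Sq.trans (solve 2 (λ a b → a := b :+ (a :- b)) Sq.refl (next (s ⊕ e)) (next s)) (Sq.+-congʳ (Sq.sym (ννιι (next s)))))
      ; y-near = Near-next y-near M≲y′
      ; 0<κ = 0<x+y 0<κ (<⇒≤ 0<κ)
      ; τ-bound = ≤-respˡ-≈ (P.solve 2 (λ p t → (P.:1 P.:+ (P.:1 P.:+ P.:0)) P.:* p P.:* (t P.:+ (P.:1 P.:+ (P.:1 P.:+ P.:0)))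
            P.:= p P.:* ((t P.:+ t P.:+ (P.:1 P.:+ P.:1)) P.:+ (P.:1 P.:+ (P.:1 P.:+ P.:0)))) refl (ι 2 ^ i) τ) τ-bound
      ; e-small = next-perturb (Tame-⊗ Tame-μ (Tame-w^ (suc i))) (≲-1⊗ (w^≲1 (suc i))) Tame-s
          vvM≲1 s≲ ≲s (≲-trans e-small (≲-respˡ (solve 3 (λ m w p → m :* p :* w := m :* (w :* p)) Sq.refl μ w (w^ suc i))
            (≲-⊗ˡ (μ ⊗ w^ suc i) (≲-⊗ˡ (ν ⊗ ν) W≲M))))
      }
      where
      open State st
      s : Seq
      s = ν ⊗ ν ⊗ y
      -- With a step still to come, 2 · 2^i (τ + 2) ≤ 2 forces τ + 2 ≤ 1, hence τ ≤ -1.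
      τ<0 : τ < 0#
      τ<0 = <-by (0<x+y 0<1 (0≤y-x (cancel-2^ i 0≤1 (*-cancelˡ-≤ (0<ι 1)
          (≤-respˡ-≈ (*-assoc _ _ _) (≤-respʳ-≈ (sym (*-identityʳ _)) τ-bound))))))
        (P.solve 1 (λ t → P.:0 P.:- t P.:= P.:1 P.:+ (P.:1 P.:- (t P.:+ (P.:1 P.:+ (P.:1 P.:+ P.:0))))) refl τ)
      M≲y′ : M ≲ y
      M≲y′ = M≲y y-near 0<κ τ<0
      Tame-s : Tame (ν ⊗ ν ⊗ M)
      Tame-s = Tame-⊗ (Tame-⊗ Tame-ν Tame-ν) Tame-M
      vvM≲1 : ν ⊗ ν ⊗ M ≲ K 1#
      vvM≲1 = ≲-respˡ (Sq.*-comm M (ν ⊗ ν)) Mνν≲1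
      s≲ : s ≲ ν ⊗ ν ⊗ M
      s≲ = ≲-⊗ˡ (ν ⊗ ν) (Symbol-≲ (Near⇒Symbol y-near))
      ≲s : ν ⊗ ν ⊗ M ≲ s
      ≲s = ≲-⊗ˡ (ν ⊗ ν) M≲y′

    State-cong : ∀ {i x x′} → x ≋ x′ → State i x → State i x′
    State-cong p st = record { State st ; decomposition = Sq.trans (Sq.sym p) (State.decomposition st) }

    State⇒0<φ : ∀ {i a} → NonZero a → State i (deviation a) → EventuallyNat (λ n → 0# < φ a n)
    State⇒0<φ nz st = φ-positive nz (State⇒negative st)

    -- The later iterates of `a` are the iterates of `φ a`. Strict positivity of `φ a` supplies the
    -- nonvanishing needed to form its deviation.
    State⇒logConcave : ∀ i {a} → NonZero a → State i (deviation a) →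
      EventuallyNat (λ n → ∀ k → 1 ℕ.≤ k → k ℕ.≤ suc i → 0# ≤ iterate φ a k n)
    State⇒logConcave zero nz st = ev-map (λ where
        n 0<φn (suc zero)    _ _          → <⇒≤ 0<φn
        n 0<φn (suc (suc k)) _ (ℕ.s≤s ()))
      (State⇒0<φ nz st)
    State⇒logConcave (suc i) nz st = ev-map₂ (λ where
        n 0<φn rest (suc zero)    _ _           → <⇒≤ 0<φn
        n 0<φn rest (suc (suc k)) _ (ℕ.s≤s k≤i) → rest (suc k) (ℕ.s≤s ℕ.z≤n) k≤i)
      (State⇒0<φ nz st)
      (State⇒logConcave i (ev-map (λ n → >⇒≉0) (State⇒0<φ nz st))
        (State-cong (Sq.sym (deviation-φ nz)) (State-next st)))

-- From the given expansion to the initial state.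

module Expansions (em : ExcludedMiddle 0ℓ) (𝓡 : CompleteOrderedField) where
  open Reals em 𝓡
  open OrderedField em 𝓡
  open Exponential em 𝓡
  open Asymptotics em 𝓡
  open Symbols em 𝓡
  open Logarithm em 𝓡
  open LogarithmicScale em 𝓡
  open RatioDynamics em 𝓡
  open Iterates em 𝓡
  private
    module P = RingSolver commutativeRing
  open RingSolver sequenceRing
  open import Relation.Binary.Reasoning.Setoid Sq.setoid

  sumSeq : ∀ {m} → (Fin m → Seq) → Seq
  sumSeq f n = sum (λ i → f i n)

  Symbol-sum : ∀ {v m} (f : Fin m → Seq) → (∀ i → Symbol v (f i)) → Symbol v (sumSeq f)
  Symbol-sum {m = zero}  f s = Symbol-0
  Symbol-sum {m = suc m} f s = Symbol-⊕ (s Fin.zero) (Symbol-sum (λ i → f (Fin.suc i)) (λ i → s (Fin.suc i)))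

  ν≋ω-1 : ν ≋ ω (- 1#)
  ν≋ω-1 = Sq.trans (⁻-cong (Sq.sym ω-1)) (Sq.sym (ω-neg 1#))

  ω⊗ω : ∀ {α β γ} → α + β ≈ γ → ω α ⊗ ω β ≋ ω γ
  ω⊗ω {α} {β} p = Sq.trans (Sq.sym (ω-+ α β)) (ω-cong p)

  -- The constant `c` will be 0 for α₁ < 2 and the threshold τ for α₁ = 2, so that D = n^(2-α₁) (c -
  -- r₁(log n)) covers both cases.
  module Expansion
    {m : ℕ} (α : Fin (suc m) → ℝ) (r : Fin (suc m) → RationalFunction)
    (0<α₁ : 0# < α Fin.zero) (α₁≤2 : α Fin.zero ≤ ι 2)
    (α-increasing : ∀ i j → i Fin.< j → α i < α j)
    (c : ℝ) (0<R : EventuallyNat (λ n → 0# < ratSeq (constant-minus c (r Fin.zero)) n))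
    where

    α₁ γ : ℝ
    α₁ = α Fin.zero
    γ = ι 2 - α₁

    R : Seq
    R = ratSeq (constant-minus c (r Fin.zero))

    R-asymptotics : LogAsymptotic R
    R-asymptotics = rational-asymptotics (constant-minus c (r Fin.zero)) (ev-map (λ n → >⇒≉0) 0<R)

    P₁ : Seq
    P₁ = weight R-asymptotics

    P₁-weight : LogWeight P₁
    P₁-weight = logWeight R-asymptotics

    W D : Seq
    W = ω γ ⊗ P₁
    D = ω γ ⊗ R

    0≤W : EventuallyNat (λ n → 0# ≤ W n)
    0≤W = ev-map (λ n 0<P → <⇒≤ (0<x*y (0<ω γ n) 0<P)) (pos P₁-weight)

    D-symbol : Symbol W D
    D-symbol = Symbol-⊗ (Symbol-ω γ) (toSymbol (behaviour R-asymptotics))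

    -- An exponent below `γ` is all that negligibility requires; the logarithmic factors, `μ`
    -- included, are absorbed by the gap.
    ≲W⊗μ : ∀ {f a P} → f ≋ ω a ⊗ P → a < γ → LogWeight P → f ≲ W ⊗ μ
    ≲W⊗μ p a<γ lw = ≲-respˡ (Sq.sym p) (≲-respʳ (Sq.sym (Sq.*-assoc _ _ _))
      (ω⊗LogWeight-≲ a<γ lw (LogWeight-⊗ P₁-weight LogWeight-μ)))

    M : Seq
    M = K 1# ⊕ W

    ν≲Wμ : ν ≲ W ⊗ μ
    ν≲Wμ = ≲W⊗μ (Sq.trans ν≋ω-1 (Sq.sym (Sq.*-identityʳ _)))
      (<-by (0<x+y 0<1 (0≤y-x α₁≤2)) (P.solve 2 (λ t a → t P.:- a P.:- (P.:- P.:1) P.:= P.:1 P.:+ (t P.:- a)) refl (ι 2) α₁))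
      LogWeight-1

    Wν≋ : W ⊗ ν ≋ ω (γ - 1#) ⊗ P₁
    Wν≋ = Sq.trans (solve 3 (λ w p v → w :* p :* v := w :* v :* p) Sq.refl (ω γ) P₁ ν)
      (Sq.*-congʳ (Sq.trans (Sq.*-congˡ ν≋ω-1) (ω⊗ω refl)))

    Wν≲Wμ : W ⊗ ν ≲ W ⊗ μ
    Wν≲Wμ = ≲W⊗μ Wν≋ (<-by 0<1 (P.solve 1 (λ g → g P.:- (g P.:- P.:1) P.:= P.:1) refl γ)) P₁-weight

    -- The exponents compare as 2 (γ - 1) < γ, which is α₁ > 0.
    WνWν≲Wμ : W ⊗ ν ⊗ (W ⊗ ν) ≲ W ⊗ μ
    WνWν≲Wμ = ≲W⊗μ
      (Sq.trans (Sq.*-cong Wν≋ Wν≋) (Sq.trans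
        (solve 2 (λ w p → w :* p :* (w :* p) := w :* w :* (p :* p)) Sq.refl (ω (γ - 1#)) P₁)
        (Sq.*-congʳ (ω⊗ω refl))))
      (<-by 0<α₁ (P.solve 1 (λ a → let two = P.:1 P.:+ (P.:1 P.:+ P.:0) in
        (two P.:- a) P.:- ((two P.:- a P.:- P.:1) P.:+ (two P.:- a P.:- P.:1)) P.:= a) refl α₁))
      (LogWeight-⊗ P₁-weight P₁-weight)

    -- The two inputs that are proved differently in the two cases. `τ-symbol` says that n^γ c
    -- equals τ up to a negligible term.
    module Conclude
      (ΔD-symbol : Symbol (W ⊗ (μ ⊗ (M ⊗ ν))) (Δ D))
      (τ : ℝ) (τ-symbol : Symbol (W ⊗ μ) (ω γ ⊗ K c ⊕ ⊝ K τ))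
      where

      setting : Setting
      setting = record
        { W = W
        ; D = D
        ; Tame-W = Tame-⊗ (Tame-ω γ) (tame P₁-weight)
        ; 0≤W = 0≤W
        ; 0<D = ev-map (λ n 0<Rn → 0<x*y (0<ω γ n) 0<Rn) 0<R
        ; W≲D = ≲-⊗ˡ (ω γ) (lower R-asymptotics)
        ; D-symbol = D-symbol
        ; ΔD-symbol = ΔD-symbol
        ; Mν≲δ = ≲-respˡ (solve 2 (λ w v → v :+ w :* v := (:1 :+ w) :* v) Sq.refl W ν) (≲-⊕ ν≲Wμ Wν≲Wμ)
        ; MνMν≲δ = ≲-respˡ (solve 2 (λ w v → v :* v :+ (w :* v :* v :+ w :* v :* v) :+ w :* v :* (w :* v)
              := (:1 :+ w) :* v :* ((:1 :+ w) :* v)) Sq.refl W ν)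
            (≲-⊕ (≲-⊕ (f⊗ν≲ ν≲Wμ) (≲-⊕ (f⊗ν≲ Wν≲Wμ) (f⊗ν≲ Wν≲Wμ))) WνWν≲Wμ)
        }
        where
        f⊗ν≲ : ∀ {f g} → f ≲ g → f ⊗ ν ≲ g
        f⊗ν≲ p = ≲-respʳ (Sq.*-identityʳ _) (≲-⊗ p ν≲1)

      open Iteration setting
      open Dynamics setting using (Near; near; error; shift-symbol; w; ννιι)

      term : Fin (suc m) → Seq
      term i = ratSeq (r i) ⊗ ω (α i) ⁻

      ιι⊗term : ∀ i → ι ⊗ ι ⊗ term i ≋ ω (ι 2 - α i) ⊗ ratSeq (r i)
      ιι⊗term i = begin
        ι ⊗ ι ⊗ (ratSeq (r i) ⊗ ω (α i) ⁻)
          ≈⟨ Sq.*-cong (Sq.*-cong (Sq.sym ω-1) (Sq.sym ω-1)) (Sq.*-congˡ (Sq.sym (ω-neg (α i)))) ⟩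
        ω 1# ⊗ ω 1# ⊗ (ratSeq (r i) ⊗ ω (- α i))
          ≈⟨ solve 3 (λ o f a → o :* o :* (f :* a) := o :* o :* a :* f) Sq.refl (ω 1#) (ratSeq (r i)) (ω (- α i)) ⟩
        ω 1# ⊗ ω 1# ⊗ ω (- α i) ⊗ ratSeq (r i)
          ≈⟨ Sq.*-congʳ (Sq.trans (Sq.*-congʳ (ω⊗ω refl)) (ω⊗ω
               (P.solve 1 (λ a → P.:1 P.:+ P.:1 P.:+ (P.:- a) P.:= (P.:1 P.:+ (P.:1 P.:+ P.:0)) P.:- a) refl (α i)))) ⟩
        ω (ι 2 - α i) ⊗ ratSeq (r i) ∎

      ιι⊗term-symbol : ∀ i → Symbol (W ⊗ μ) (ι ⊗ ι ⊗ term (Fin.suc i))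
      ιι⊗term-symbol i = let (P , P-weight , P-symbol) = rational-upper (r (Fin.suc i)) in
        Symbol-cong (Sq.sym (ιι⊗term (Fin.suc i))) (Symbol-weaken
          (≲W⊗μ Sq.refl (<-by (0<y-x (α-increasing Fin.zero (Fin.suc i) (ℕ.s≤s ℕ.z≤n)))
            (P.solve 3 (λ t a b → (t P.:- a) P.:- (t P.:- b) P.:= b P.:- a) refl (ι 2) α₁ (α (Fin.suc i)))) P-weight)
          (Symbol-⊗ (Symbol-ω _) (toSymbol P-symbol)))

      series : Seq
      series = sumSeq term

      tail : Fin m → Seq
      tail i = term (Fin.suc i)

      ιι⊗sum : ∀ {m} (f : Fin m → Seq) → ι ⊗ ι ⊗ sumSeq f ≋ sumSeq (λ i → ι ⊗ ι ⊗ f i)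
      ιι⊗sum {zero}  f = Sq.zeroʳ (ι ⊗ ι)
      ιι⊗sum {suc m} f = Sq.trans (Sq.distribˡ (ι ⊗ ι) (f Fin.zero) (sumSeq (λ i → f (Fin.suc i))))
        (Sq.+-congˡ (ιι⊗sum (λ i → f (Fin.suc i))))

      -- The leading term n^γ r₁ cancels against `D`, leaving n^γ c - τ and the terms with exponents
      -- above α₁, which are smaller by a power of n.
      Near-series : Near τ 1# (ι ⊗ ι ⊗ series)
      Near-series = near (Symbol-cong (Sq.sym eq) (Symbol-⊕ τ-symbol
        (Symbol-cong (Sq.sym (ιι⊗sum tail)) (Symbol-sum (λ i → ι ⊗ ι ⊗ tail i) ιι⊗term-symbol))))
        where
        eq : ι ⊗ ι ⊗ series ⊕ ⊝ (K τ ⊕ ⊝ (K 1# ⊗ D)) ≋ (ω γ ⊗ K c ⊕ ⊝ K τ) ⊕ ι ⊗ ι ⊗ sumSeq tail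
        eq = begin
          ι ⊗ ι ⊗ (term Fin.zero ⊕ sumSeq tail) ⊕ ⊝ (K τ ⊕ ⊝ (K 1# ⊗ (ω γ ⊗ R)))
            ≈⟨ Sq.+-cong (Sq.trans (Sq.distribˡ _ _ _) (Sq.+-congʳ (ιι⊗term Fin.zero)))
                 (Sq.-‿cong (Sq.+-congˡ (Sq.-‿cong (Sq.*-congˡ (Sq.*-congˡ (ratSeq-constant-minus c (r Fin.zero))))))) ⟩
          (ω γ ⊗ ratSeq (r Fin.zero) ⊕ ι ⊗ ι ⊗ sumSeq tail)
            ⊕ ⊝ (K τ ⊕ ⊝ (K 1# ⊗ (ω γ ⊗ (K c ⊕ ⊝ ratSeq (r Fin.zero)))))
            ≈⟨ solve 5 (λ o f s t c → (o :* f :+ s) :- (t :- (:1 :* (o :* (c :- f)))) := (o :* c :- t) :+ s)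
                 Sq.refl (ω γ) (ratSeq (r Fin.zero)) (ι ⊗ ι ⊗ sumSeq tail) (K τ) (K c) ⟩
          (ω γ ⊗ K c ⊕ ⊝ K τ) ⊕ ι ⊗ ι ⊗ sumSeq tail ∎

      -- The deviation at n is the ratio of the expansion at n + 1, so the series enters shifted;
      -- `shift-symbol` shows that the model is unaffected.
      y₀ : Seq
      y₀ = ι ⊗ ι ⊗ E (ν ⊗ ν ⊗ (ι ⊗ ι ⊗ series))

      Near-y₀ : Near τ 1# y₀
      Near-y₀ = near (Symbol-cong (solve 3 (λ a b c → (a :- b) :+ (b :- c) := a :- c)
          Sq.refl y₀ (ι ⊗ ι ⊗ series) (K τ ⊕ ⊝ (K 1# ⊗ D)))
        (Symbol-⊕ (shift-symbol Near-series) (error Near-series)))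

      w≋ : w ≋ ω (- α₁) ⊗ P₁
      w≋ = Sq.trans (Sq.*-congʳ (Sq.*-cong ν≋ω-1 ν≋ω-1)) (Sq.trans (Sq.sym (Sq.*-assoc _ _ _))
        (Sq.*-congʳ (Sq.trans (Sq.*-congʳ (ω⊗ω refl)) (ω⊗ω
          (P.solve 1 (λ a → (P.:- P.:1) P.:+ (P.:- P.:1) P.:+ ((P.:1 P.:+ (P.:1 P.:+ P.:0)) P.:- a) P.:= P.:- a) refl α₁)))))

      w^≋ : ∀ i → ∃ λ Q → LogWeight Q × w^ i ≋ ω (- (ι i * α₁)) ⊗ Q
      w^≋ zero = K 1# , LogWeight-1 , Sq.sym (Sq.trans (Sq.*-identityʳ _)
        (Sq.trans (ω-cong (P.solve 1 (λ a → P.:- (P.:0 P.:* a) P.:= P.:0) refl α₁)) ω-0))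
      w^≋ (suc i) = let (Q , Q-weight , eq) = w^≋ i in P₁ ⊗ Q , LogWeight-⊗ P₁-weight Q-weight ,
        Sq.trans (Sq.*-cong w≋ eq) (Sq.trans
          (solve 4 (λ a p b q → a :* p :* (b :* q) := a :* b :* (p :* q)) Sq.refl _ P₁ _ Q)
          (Sq.*-congʳ (ω⊗ω (P.solve 2 (λ i a → (P.:- a) P.:+ (P.:- (i P.:* a)) P.:= P.:- ((P.:1 P.:+ i) P.:* a)) refl (ι i) α₁))))

      -- The strict inequality leaves a positive power of n, which absorbs `μ` and the logarithmic
      -- part of the power of `w`.
      ω-β≲ : ∀ {β} ℓ → ι ℓ * α₁ < β → ω (- β) ≲ μ ⊗ w^ ℓ
      ω-β≲ {β} ℓ ℓα₁<β = let (Q , Q-weight , eq) = w^≋ ℓ in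
        ≲-respˡ (Sq.*-identityʳ _) (≲-respʳ
          (Sq.trans (solve 3 (λ o u q → o :* (u :* q) := u :* (o :* q)) Sq.refl _ μ Q) (Sq.*-congˡ (Sq.sym eq)))
          (ω⊗LogWeight-≲ (<-by (0<y-x ℓα₁<β) (P.solve 2 (λ x b → (P.:- x) P.:- (P.:- b) P.:= b P.:- x) refl (ι ℓ * α₁) β))
            LogWeight-1 (LogWeight-⊗ LogWeight-μ Q-weight)))

      conclusion : ∀ {a β} i → NonZero a → deviation a ⊕ ⊝ E series ≲ E (ω (- β)) →
        ι (suc i) * α₁ < β → ι 2 ^ i * (τ + ι 2) ≤ ι 2 → AsymptoticallyLogConcave (suc i) a
      conclusion {a} {β} i nz e≲ ℓα₁<β bound =
        let (N , h) = State⇒logConcave i nz state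
        in N , λ k 1≤k k≤ℓ n → ≤-respʳ-≈ (sym (iterate-φ-shift N k (λ _ → refl) n)) (h (N ℕ.+ n) (ℕₚ.m≤m+n N n) k 1≤k k≤ℓ)
        where
        state : State i (deviation a)
        state = record
          { τ = τ
          ; κ = 1#
          ; y = y₀
          ; e = deviation a ⊕ ⊝ E series
          ; decomposition = Sq.trans (solve 2 (λ x s → x := s :+ (x :- s)) Sq.refl (deviation a) (E series))
              (Sq.+-congʳ (Sq.sym (Sq.trans (ννιι _) (E-cong (ννιι series)))))
          ; y-near = Near-y₀
          ; 0<κ = 0<1
          ; τ-bound = bound
          ; e-small = ≲-trans e≲ (≲-trans (Ew≲w (Tame-ω (- β))) (ω-β≲ (suc i) ℓα₁<β))
          }

  -- The hypothesis is read at `suc n`, where `pred` returns `n`, and with ε = 1.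
  deviation-error : ∀ {m} (a : Seq) (α : Fin (suc m) → ℝ) (β : ℝ) (r : Fin (suc m) → RationalFunction) →
    LittleO
      (λ n → (a (pred n) * a (suc n)) ÷ (a n ^ 2)
             - (1# + sum (λ i → eval (r i) (log (ι n)) ÷ (ι n ^ʳ α i))))
      (λ n → 1# ÷ (ι n ^ʳ β)) →
    deviation a ⊕ ⊝ E (sumSeq (λ i → ratSeq (r i) ⊗ ω (α i) ⁻)) ≲ E (ω (- β))
  deviation-error a α β r o = ≲-pointwise (ev-map rewritten (ev-suc (o 1# 0<1)))
    where
    gap : ℕ → ℝ → ℝ
    gap n l = a n * a (suc (suc n)) ÷ (a (suc n) ^ 2) - (1# + sum (λ i → eval (r i) l ÷ exp (α i * l)))
    rewritten : ∀ n → ∣ gap n (log (ι (suc n))) ∣ ≤ 1# * ∣ 1# ÷ exp (β * log (ι (suc n))) ∣ →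
      ∣ (deviation a ⊕ ⊝ E (sumSeq (λ i → ratSeq (r i) ⊗ ω (α i) ⁻))) n ∣ ≤ ∣ E (ω (- β)) n ∣
    rewritten n h = ≤-respˡ-≈ (∣-∣-cong eqˡ) (≤-respʳ-≈ (trans (*-identityˡ _) (∣-∣-cong eqʳ))
        (≡.subst (λ l → ∣ gap n l ∣ ≤ 1# * ∣ 1# ÷ exp (β * l) ∣) (L-def (suc n)) h))
      where
      l = L (suc n)
      eqˡ : gap n l ≈ (deviation a ⊕ ⊝ E (sumSeq (λ i → ratSeq (r i) ⊗ ω (α i) ⁻))) n
      eqˡ = trans (+-congʳ (*-congˡ (⁻¹-cong (*-congˡ (*-identityʳ (a (suc n)))))))
        (P.solve 2 (λ q s → q P.:- (P.:1 P.:+ s) P.:= (q P.:- P.:1) P.:- s) refl _ _)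
      eqʳ : 1# ÷ exp (β * l) ≈ E (ω (- β)) n
      eqʳ = trans (*-identityˡ _) (trans (⁻¹-unique (exp-neg (β * l)))
        (exp-cong (P.solve 2 (λ b l → P.:- (b P.:* l) P.:= (P.:- b) P.:* l) refl β l)))

  ev-L : ∀ {P : ℝ → Set} → EventuallyReal P → EventuallyNat (λ n → P (L n))
  ev-L (X , p) = ev-map (λ n → p (L n)) (ev-≤L X)

  0<ratSeq-constant-minus : ∀ c r → EventuallyReal (λ x → eval r x < c) →
    EventuallyNat (λ n → 0# < ratSeq (constant-minus c r) n)
  0<ratSeq-constant-minus c r h = ev-map₂ (λ n eq r<c → <-respʳ-≈ (sym eq) (0<y-x r<c))
    (ev (ratSeq-constant-minus c r)) (ev-L h)

  -- With ℓ = i + 1 the left side is 2^i · 2^(2-ℓ) = 2, an equality. For i = 0 the exponent ℓ - 2 is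
  -- negative and two inversions cancel.
  2^-bound : ∀ i → ι 2 ^ i * (- ι 2 + 1# ÷ (ι 2 ^ᶻ (suc i ⊖ 2)) + ι 2) ≤ ι 2
  2^-bound i = ≤-reflexive (trans
    (P.solve 3 (λ p q t → p P.:* ((P.:- t) P.:+ P.:1 P.:* q P.:+ t) P.:= p P.:* q) refl (ι 2 ^ i) _ (ι 2)) (value i))
    where
    value : ∀ i → ι 2 ^ i * (ι 2 ^ᶻ (suc i ⊖ 2)) ⁻¹ ≈ ι 2
    value zero    = trans (*-identityˡ _) (trans (⁻¹-unique (trans (*-comm _ _) (inverseʳ (>⇒≉0 (0<^ 1 (0<ι 1))))))
      (*-identityʳ (ι 2)))
    value (suc j) = trans (*-assoc _ _ _) (trans (*-congˡ (inverseʳ (>⇒≉0 (0<^ j (0<ι 1))))) (*-identityʳ (ι 2)))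

  α₁≤αₘ : ∀ {m} (α : Fin (suc m) → ℝ) → (∀ i j → i Fin.< j → α i < α j) → α Fin.zero ≤ α (fromℕ m)
  α₁≤αₘ {zero}  α α-increasing = ≤-refl
  α₁≤αₘ {suc m} α α-increasing = <⇒≤ (α-increasing Fin.zero (fromℕ (suc m)) (ℕ.s≤s ℕ.z≤n))

  -- Since α₁ ≤ αₘ, the quotient is at least 1; this gives ℓ ≥ 1, and ℓ - 1 is the number of steps
  -- to take.
  floor≢0 : ∀ {x y} → 0# < x → x ≤ y → ¬ IsFloor (y ÷ x) 0
  floor≢0 0<x x≤y (_ , y÷x<1) =
    <⇒≱ y÷x<1 (≤-÷ 0<x (≤-respˡ-≈ (P.solve 1 (λ x → x P.:= (P.:1 P.:+ P.:0) P.:* x) refl _) x≤y))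

  floor*x≤y : ∀ {x y} ℓ → 0# < x → IsFloor (y ÷ x) ℓ → ι ℓ * x ≤ y
  floor*x≤y ℓ 0<x (ℓ≤y÷x , _) = ≤-respʳ-≈ (sym (x≈y*x÷y (>⇒≉0 0<x)))
    (≤-respˡ-≈ (*-comm _ _) (*-monoˡ-≤ (<⇒≤ 0<x) ℓ≤y÷x))

  -- The cases α₁ < 2 and α₁ = 2.

  module Cases
    {a : Seq} (a≉0 : NonZero a) {m : ℕ} (α : Fin (suc m) → ℝ) (β : ℝ) (r : Fin (suc m) → RationalFunction)
    (0<α₁ : 0# < α Fin.zero) (α-increasing : ∀ i j → i Fin.< j → α i < α j)
    (expansion : LittleO
      (λ n → (a (pred n) * a (suc n)) ÷ (a n ^ 2)
             - (1# + sum (λ i → eval (r i) (log (ι n)) ÷ (ι n ^ʳ α i))))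
      (λ n → 1# ÷ (ι n ^ʳ β)))
    (i : ℕ) (ℓα₁<β : ι (suc i) * α Fin.zero < β)
    where

    below-two : α Fin.zero < ι 2 → EventuallyReal (λ x → eval (r Fin.zero) x < 0#) →
                AsymptoticallyLogConcave (suc i) a
    below-two α₁<2 r₁<0 = conclusion i a≉0 (deviation-error a α β r expansion) ℓα₁<β
      (≤-respˡ-≈ (P.solve 2 (λ p t → P.:0 P.:= p P.:* ((P.:- t) P.:+ t)) refl (ι 2 ^ i) (ι 2)) (0≤ι 2))
      where
      open Expansion α r 0<α₁ (<⇒≤ α₁<2) α-increasing 0# (0<ratSeq-constant-minus 0# (r Fin.zero) r₁<0)
      1≲Wμ : K 1# ≲ W ⊗ μ
      1≲Wμ = ≲W⊗μ (Sq.sym (Sq.trans (Sq.*-identityʳ _) ω-0)) (0<y-x α₁<2) LogWeight-1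
      ΔD-symbol : Symbol (W ⊗ (μ ⊗ (M ⊗ ν))) (Δ D)
      -- As `W ⊗ μ` dominates constants, so does `M ⊗ μ`, and the ordinary weight `W ⊗ ν` of a
      -- difference already fits.
      ΔD-symbol = Symbol-weaken (≲-⊗ˡ W (≲-respˡ (Sq.*-identityˡ ν) (≲-respʳ
          (solve 3 (λ w u v → w :* u :* v := u :* (w :* v)) Sq.refl M μ ν)
          (≲-⊗ʳ ν (≲-trans 1≲Wμ (≲-⊗ʳ μ (≲1⊕ 0≤W)))))))
        (Symbol-Δ {W} {D} D-symbol)
      τ-symbol : Symbol (W ⊗ μ) (ω γ ⊗ K 0# ⊕ ⊝ K (- ι 2))
      τ-symbol = Symbol-weaken 1≲Wμ (Symbol-cong (solve 2 (λ g t → :- t := g :* :0 :- t) Sq.refl (ω γ) (K (- ι 2)))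
        (Symbol-⊝ (Symbol-K (- ι 2))))
      -- Constants are negligible against W μ here; -2 is the fixed point of τ ↦ 2τ + 2.
      open Conclude ΔD-symbol (- ι 2) τ-symbol

    at-two : α Fin.zero ≈ ι 2 →
             EventuallyReal (λ x → eval (r Fin.zero) x < - ι 2 + 1# ÷ (ι 2 ^ᶻ (suc i ⊖ 2))) →
             AsymptoticallyLogConcave (suc i) a
    at-two α₁≈2 r₁<τ = conclusion i a≉0 (deviation-error a α β r expansion) ℓα₁<β (2^-bound i)
      where
      τ = - ι 2 + 1# ÷ (ι 2 ^ᶻ (suc i ⊖ 2))
      open Expansion α r 0<α₁ (≤-reflexive α₁≈2) α-increasing τ (0<ratSeq-constant-minus τ (r Fin.zero) r₁<τ)
      ωγ≋1 : ω γ ≋ K 1#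
      ωγ≋1 = Sq.trans (ω-cong (trans (+-congˡ (-‿cong α₁≈2)) (-‿inverseʳ (ι 2)))) ω-0
      P₁≋W : P₁ ≋ W
      P₁≋W = Sq.trans (Sq.sym (Sq.*-identityˡ P₁)) (Sq.*-congʳ (Sq.sym ωγ≋1))
      R≋D : R ≋ D
      R≋D = Sq.trans (Sq.sym (Sq.*-identityˡ R)) (Sq.*-congʳ (Sq.sym ωγ≋1))
      ΔD-symbol : Symbol (W ⊗ (μ ⊗ (M ⊗ ν))) (Δ D)
      -- Now γ = 0 and `D` is a rational function of log n; the factor `μ` comes from `Δ-gain`.
      ΔD-symbol = Symbol-weaken (≲-trans (≲-⊗ʳ (μ ⊗ ν) (≋⇒≲ P₁≋W))
          (≲-⊗ˡ W (≲-⊗ˡ μ (≲-respˡ (Sq.*-identityˡ ν) (≲-⊗ʳ ν (1≲1⊕ 0≤W))))))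
        (Symbol-cong (Δ-cong R≋D) (Δ-gain (behaviour R-asymptotics)))
      τ-symbol : Symbol (W ⊗ μ) (ω γ ⊗ K τ ⊕ ⊝ K τ)
      τ-symbol = Symbol-cong (Sq.sym (Sq.trans (Sq.+-congʳ (Sq.trans (Sq.*-congʳ ωγ≋1) (Sq.*-identityˡ _)))
        (Sq.-‿inverseʳ (K τ)))) Symbol-0
      open Conclude ΔD-symbol τ τ-symbol

theorem3p2 : (em : ExcludedMiddle 0ℓ) (𝓡 : CompleteOrderedField) →
    let open Reals em 𝓡 in
    (a : ℕ → ℝ) →
    EventuallyNat (λ n → a n ≉ 0#) →
    (m : ℕ) (α : Fin (suc m) → ℝ) (β : ℝ) (r : Fin (suc m) → RationalFunction) →
    0# < α Fin.zero →
    (∀ i j → i Fin.< j → α i < α j) →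
    α (fromℕ m) < β →
    LittleO
    (λ n → (a (pred n) * a (suc n)) ÷ (a n ^ 2)
    - (1# + sum (λ i → eval (r i) (log (ι n)) ÷ (ι n ^ʳ α i))))
    (λ n → 1# ÷ (ι n ^ʳ β)) →
    (ℓ : ℕ) → IsFloor (α (fromℕ m) ÷ α Fin.zero) ℓ →
    ((0# < α Fin.zero × α Fin.zero < ι 2)
    × EventuallyReal (λ x → eval (r Fin.zero) x < 0#))
    ⊎ (α Fin.zero ≈ ι 2
    × EventuallyReal (λ x → eval (r Fin.zero) x < - ι 2 + 1# ÷ (ι 2 ^ᶻ (ℓ ⊖ 2)))) →
    AsymptoticallyLogConcave ℓ a
theorem3p2 em 𝓡 a a≉0 m α β r 0<α₁ α-increasing αₘ<β expansion ℕ.zero floor _ =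
  ⊥-elim (floor≢0 0<α₁ (α₁≤αₘ α α-increasing) floor)
  where open Expansions em 𝓡
theorem3p2 em 𝓡 a a≉0 m α β r 0<α₁ α-increasing αₘ<β expansion (suc i) floor cases =
  [ (λ ((_ , α₁<2) , r₁<0) → below-two α₁<2 r₁<0) , (λ (α₁≈2 , r₁<τ) → at-two α₁≈2 r₁<τ) ]′ cases
  where
  open OrderedField em 𝓡
  open Expansions em 𝓡
  open Cases a≉0 α β r 0<α₁ α-increasing expansion i (≤-<-trans (floor*x≤y (suc i) 0<α₁ floor) αₘ<β)
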